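{- Let $G$ be a graph with $f(G)\le 11$. Then (a) $|V(G)|\ge\chi(G)+2f(G)$ if $f(G)\le 6$; (b) $|V(G)|\ge\chi(G)+2f(G)-1$ if $f(G)=7$ or $f(G)=8$; (c) $|V(G)|\ge\chi(G)+16$ if $f(G)=9$; (d) $|V(G)|\ge\chi(G)+2f(G)-3$ if $f(G)=10$ or $f(G)=11$.
   Context: All graphs are finite, simple and undirected. $\chi(G)$ is the chromatic number, $\omega(G)$ the clique number, and $f(G)=\chi(G)-\omega(G)$. -}

module Defs where

open import Data.Nat using (ℕ; _≤_; _<_)
open import Data.Fin using (Fin)
open import Data.Bool using (Bool; true; false)
open import Data.Product using (_×_; ∃)
open import Relation.Binary.PropositionalEquality using (_≡_; _≢_)
open import Relation.Nullary using (¬_)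
open import Function.Definitions using (Injective)

record Graph (n : ℕ) : Set where
  field
    adj   : Fin n → Fin n → Bool
    sym   : ∀ u v → adj u v ≡ adj v u
    irrefl : ∀ v → adj v v ≡ false

open Graph public

Adj : ∀ {n} → Graph n → Fin n → Fin n → Set
Adj G u v = adj G u v ≡ true

IsProperColouring : ∀ {n} → Graph n → (k : ℕ) → (Fin n → Fin k) → Set
IsProperColouring G k c = ∀ u v → Adj G u v → c u ≢ c v

Colourable : ∀ {n} → Graph n → ℕ → Set
Colourable {n} G k = ∃ λ (c : Fin n → Fin k) → IsProperColouring G k c

IsChromaticNumber : ∀ {n} → Graph n → ℕ → Set
IsChromaticNumber G k = Colourable G k × (∀ j → j < k → ¬ Colourable G j)

IsClique : ∀ {n} → Graph n → (k : ℕ) → (Fin k → Fin n) → Set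
IsClique G k f = Injective _≡_ _≡_ f × (∀ i j → i ≢ j → Adj G (f i) (f j))

HasClique : ∀ {n} → Graph n → ℕ → Set
HasClique {n} G k = ∃ λ (f : Fin k → Fin n) → IsClique G k f

IsCliqueNumber : ∀ {n} → Graph n → ℕ → Set
IsCliqueNumber G k = HasClique G k × (∀ j → k < j → ¬ HasClique G j)

{-# OPTIONS --safe #-}
module Submission where

-- Let g(f) be the claimed excess of |V| over χ. One shows by induction on |V| that V has a partition
-- into c independent sets and a clique of size w with c + g(c - w) ≤ |V|. If there are three
-- independent vertices, remove them. Otherwise the complement H is triangle-free, partitions are
-- matchings of H, and cliques are independent sets of H. If H - v has no smaller deficiency than H for
-- some v, or if H is disconnected, induction applies, since g is subadditive. In the remaining
-- case |V| = 2c - 1 by Gallai's lemma, and H has a large independent set because R(3,7) ≤ 23,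
-- R(3,8) ≤ 29 and R(3,9) ≤ 37 (and by the smaller Ramsey numbers R(3,k)).
--
-- The Ramsey bounds are obtained in the style of Graver and Yackel, by bounding from below the number of
-- edges of a triangle-free graph with n vertices and independence number at most k. If v has degree
-- d, the vertices far from v (neither v nor adjacent to it) induce a graph with independence number at
-- most k - 1 on n - 1 - d vertices; summing over v bounds the edges for k from those for k - 1. In a
-- few tight cases some far graph must be extremal, hence belongs to a short catalogue, and a search
-- evaluated by the type checker finds all ways of putting v and its neighbours back.

open import Defs
open import Data.Bool using (Bool; true; false; not; _∧_; _∨_; if_then_else_; T)
open import Data.Bool.Properties using (∧-zeroʳ)
import Data.Bool.Properties as Bool
open import Data.Empty using (⊥; ⊥-elim)
open import Data.Fin using (Fin; zero; suc; toℕ; fromℕ<)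
import Data.Fin.Properties as Fin
open import Data.List using (List; []; _∷_; _++_; map; zipWith; replicate; length; concatMap)
open import Data.List.Properties using (map-++; map-cong; length-map)
open import Data.List.Membership.Propositional using (_∈_)
open import Data.List.Membership.Propositional.Properties using (∈-map⁺; ∈-map⁻; ∈-++⁺ˡ; ∈-++⁺ʳ; ∈-++⁻)
open import Data.List.Relation.Binary.Pointwise using (Pointwise; []; _∷_)
open import Data.List.Relation.Unary.All as All using (All; []; _∷_)
open import Data.List.Relation.Unary.All.Properties using (++⁺; map⁺)
open import Data.List.Relation.Unary.Any using (Any; here; there)
open import Data.Maybe using (Maybe; just; nothing)
open import Data.Nat
open import Data.Nat.DivMod using (m*n/n≡m)
open import Data.Nat.Properties
open import Data.Nat.Solver using (module +-*-Solver)
open import Data.Product using (_×_; _,_; proj₁; proj₂; ∃)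
open import Data.Sum using (_⊎_; inj₁; inj₂; [_,_]′)
open import Data.Unit using (⊤; tt)
open import Relation.Binary.PropositionalEquality
  using (_≡_; _≢_; refl; cong; cong₂; subst; subst₂; module ≡-Reasoning)
  renaming (sym to ≡-sym; trans to infixr 5 _⨾_)
open import Relation.Nullary using (¬_; yes; no; does)
open import Relation.Nullary.Decidable using (decidable-stable)

open +-*-Solver using (solve; _:=_; _:+_; _:*_; con)

-- Double counting in triangle-free graphs

-- When |V| = 2c - 1, a clique of size w suffices as soon as g(c - w) < c, so g can only be as large
-- as the available Ramsey bounds permit. For c = 14, 16, 17, 18 they give w = 7, 8, 8, 8, and this
-- dictates the values 13, 15, 16, 17 of g at 7, 8, 9, 10; for c ≥ 20 the constant 19 is below c
-- even with the empty clique. The partition and the clique are not asked to be optimal. As g is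
-- monotone, replacing c and w by χ and ω only lowers c + g(c - w), and this freedom is what allows
-- witnesses for parts of the graph to be combined. Minimum matchings and the classes in Gallai's
-- argument come with no decision procedure, so the induction derives a contradiction from the
-- absence of a witness; the final inequality is decidable, and the double negation can be removed
-- there. The searches stay small because only graphs with nearly the least possible number of edges
-- are classified. For 23 and 29 vertices a separate argument first makes the graph regular, which
-- leaves a single edge number to exclude in the former case and a parity contradiction in the
-- latter.

⟦_⟧ : Bool → ℕ
⟦ true ⟧ = 1
⟦ false ⟧ = 0

opaque
  sum : ∀ {n} → (Fin n → ℕ) → ℕ
  sum {zero} f = 0
  sum {suc n} f = f zero + sum (λ i → f (suc i))

  sum-cong : ∀ {n} {f g : Fin n → ℕ} → (∀ i → f i ≡ g i) → sum f ≡ sum g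
  sum-cong {zero} h = refl
  sum-cong {suc n} h = cong₂ _+_ (h zero) (sum-cong (λ i → h (suc i)))

  sum-+ : ∀ {n} (f g : Fin n → ℕ) → sum (λ i → f i + g i) ≡ sum f + sum g
  sum-+ {zero} f g = refl
  sum-+ {suc n} f g = cong (f zero + g zero +_) (sum-+ (λ i → f (suc i)) (λ i → g (suc i))) ⨾
    solve 4 (λ a b c d → (a :+ b) :+ (c :+ d) := (a :+ c) :+ (b :+ d)) refl (f zero) (g zero) (sum (λ i → f (suc i))) (sum (λ i → g (suc i)))

  sum-* : ∀ {n} c (f : Fin n → ℕ) → c * sum f ≡ sum (λ i → c * f i)
  sum-* {zero} c f = *-zeroʳ c
  sum-* {suc n} c f = *-distribˡ-+ c (f zero) _ ⨾ cong (c * f zero +_) (sum-* c (λ i → f (suc i)))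

  sum-swap : ∀ {m n} (f : Fin m → Fin n → ℕ) → sum (λ i → sum (f i)) ≡ sum (λ j → sum (λ i → f i j))
  sum-swap {zero} {n} f = zeros n
    where
    zeros : ∀ n → 0 ≡ sum {n} (λ _ → 0)
    zeros zero = refl
    zeros (suc n) = zeros n
  sum-swap {suc m} f = cong (sum (f zero) +_) (sum-swap (λ i → f (suc i))) ⨾
    ≡-sym (sum-+ (f zero) (λ j → sum (λ i → f (suc i) j)))

  sum-mono : ∀ {n} {f g : Fin n → ℕ} → (∀ i → f i ≤ g i) → sum f ≤ sum g
  sum-mono {zero} h = z≤n
  sum-mono {suc n} h = +-mono-≤ (h zero) (sum-mono (λ i → h (suc i)))

  sum-zero : ∀ {n} {f : Fin n → ℕ} → (∀ i → f i ≡ 0) → sum f ≡ 0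
  sum-zero {zero} h = refl
  sum-zero {suc n} h rewrite h zero = sum-zero (λ i → h (suc i))

-- One vertex type is kept throughout: passing to an induced subgraph changes only the mask, and no
-- vertex is renumbered.
Mask : ℕ → Set
Mask N = Fin N → Bool

_==_ : ∀ {N} → Fin N → Fin N → Bool
x == y = does (x Fin.≟ y)

==-refl : ∀ {N} (x : Fin N) → (x == x) ≡ true
==-refl x with x Fin.≟ x
... | yes _ = refl
... | no ne = ⊥-elim (ne refl)

==⇒≡ : ∀ {N} {x y : Fin N} → (x == y) ≡ true → x ≡ y
==⇒≡ {x = x} {y} h with x Fin.≟ y
... | yes e = e

≢⇒== : ∀ {N} {x y : Fin N} → x ≢ y → (x == y) ≡ false
≢⇒== {x = x} {y} ne with x Fin.≟ y
... | yes e = ⊥-elim (ne e)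
... | no _ = refl

_∖_ : ∀ {N} → Mask N → Fin N → Mask N
(S ∖ v) x = if x == v then false else S x

_⊎ᵐ_ : ∀ {N} → Mask N → Fin N → Mask N
(S ⊎ᵐ v) x = if x == v then true else S x

∑⟨_⟩ : ∀ {N} → Mask N → (Fin N → ℕ) → ℕ
∑⟨ S ⟩ f = sum (λ x → ⟦ S x ⟧ * f x)

#_ : ∀ {N} → Mask N → ℕ
# S = ∑⟨ S ⟩ (λ _ → 1)

infix 9 #_

opaque
  unfolding sum

  sum-single : ∀ {N} (v : Fin N) (f : Fin N → ℕ) → sum (λ x → ⟦ x == v ⟧ * f x) ≡ f v
  sum-single zero f = cong₂ _+_ (+-identityʳ (f zero)) (sum-zero {f = λ x → ⟦ suc x == zero ⟧ * f (suc x)} (λ _ → refl)) ⨾ +-identityʳ (f zero)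
  sum-single {suc N} (suc v) f = sum-cong (λ x → cong (λ b → ⟦ b ⟧ * f (suc x)) (==-suc x)) ⨾ sum-single v (λ x → f (suc x))
    where
    ==-suc : ∀ x → (suc x == suc v) ≡ (x == v)
    ==-suc x with x Fin.≟ v
    ... | yes _ = refl
    ... | no _ = refl

module _ {N : ℕ} where

  ∑-cong : ∀ (S : Mask N) {f g} → (∀ x → S x ≡ true → f x ≡ g x) → ∑⟨ S ⟩ f ≡ ∑⟨ S ⟩ g
  ∑-cong S {f} {g} h = sum-cong eq
    where
    eq : ∀ x → ⟦ S x ⟧ * f x ≡ ⟦ S x ⟧ * g x
    eq x with S x in e
    ... | true = cong (1 *_) (h x e)
    ... | false = refl

  ∑-mono : ∀ (S : Mask N) {f g} → (∀ x → S x ≡ true → f x ≤ g x) → ∑⟨ S ⟩ f ≤ ∑⟨ S ⟩ g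
  ∑-mono S {f} {g} h = sum-mono le
    where
    le : ∀ x → ⟦ S x ⟧ * f x ≤ ⟦ S x ⟧ * g x
    le x with S x in e
    ... | true = *-monoʳ-≤ 1 (h x e)
    ... | false = z≤n

  ∑-resp : ∀ {S T : Mask N} f → (∀ x → S x ≡ T x) → ∑⟨ S ⟩ f ≡ ∑⟨ T ⟩ f
  ∑-resp f h = sum-cong (λ x → cong (λ b → ⟦ b ⟧ * f x) (h x))

  ∑-+ : ∀ (S : Mask N) f g → ∑⟨ S ⟩ (λ x → f x + g x) ≡ ∑⟨ S ⟩ f + ∑⟨ S ⟩ g
  ∑-+ S f g = sum-cong (λ x → *-distribˡ-+ ⟦ S x ⟧ (f x) (g x)) ⨾ sum-+ _ _

  ∑-* : ∀ (S : Mask N) c f → ∑⟨ S ⟩ (λ x → c * f x) ≡ c * ∑⟨ S ⟩ f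
  ∑-* S c f = sum-cong (λ x → swap ⟦ S x ⟧ c (f x)) ⨾ ≡-sym (sum-* c _)
    where
    swap : ∀ a b c → a * (b * c) ≡ b * (a * c)
    swap = solve 3 (λ a b c → a :* (b :* c) := b :* (a :* c)) refl

  ∑-const : ∀ (S : Mask N) c → ∑⟨ S ⟩ (λ _ → c) ≡ # S * c
  ∑-const S c = sum-cong (λ x → cong (⟦ S x ⟧ *_) (≡-sym (*-identityʳ c))) ⨾ ∑-* S c (λ _ → 1) ⨾ *-comm c (# S)

  ∑-comm⟨⟩ : ∀ (S T : Mask N) (f : Fin N → Fin N → ℕ) →
    ∑⟨ S ⟩ (λ x → ∑⟨ T ⟩ (λ y → f x y)) ≡ ∑⟨ T ⟩ (λ y → ∑⟨ S ⟩ (λ x → f x y))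
  ∑-comm⟨⟩ S T f =
    sum-cong (λ x → sum-* ⟦ S x ⟧ _) ⨾ sum-swap _ ⨾
    sum-cong (λ y → sum-cong (λ x → swap ⟦ S x ⟧ ⟦ T y ⟧ (f x y)) ⨾ ≡-sym (sum-* ⟦ T y ⟧ _))
    where
    swap : ∀ a b c → a * (b * c) ≡ b * (a * c)
    swap = solve 3 (λ a b c → a :* (b :* c) := b :* (a :* c)) refl

  ∑-disjoint : ∀ (S P Q : Mask N) f → (∀ x → ⟦ S x ⟧ ≡ ⟦ P x ⟧ + ⟦ Q x ⟧) → ∑⟨ S ⟩ f ≡ ∑⟨ P ⟩ f + ∑⟨ Q ⟩ f
  ∑-disjoint S P Q f h =
    sum-cong (λ x → cong (_* f x) (h x) ⨾ *-distribʳ-+ (f x) ⟦ P x ⟧ ⟦ Q x ⟧) ⨾ sum-+ _ _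

  ∑-single : ∀ (v : Fin N) f → ∑⟨ _== v ⟩ f ≡ f v
  ∑-single = sum-single

  ⟦∖⟧ : ∀ (S : Mask N) {v} → S v ≡ true → ∀ x → ⟦ S x ⟧ ≡ ⟦ x == v ⟧ + ⟦ (S ∖ v) x ⟧
  ⟦∖⟧ S {v} Sv x with x Fin.≟ v
  ... | yes refl rewrite Sv = refl
  ... | no _ = refl

  ⟦⊎⟧ : ∀ (S : Mask N) {v} → S v ≡ false → ∀ x → ⟦ (S ⊎ᵐ v) x ⟧ ≡ ⟦ x == v ⟧ + ⟦ S x ⟧
  ⟦⊎⟧ S {v} Sv x with x Fin.≟ v
  ... | yes refl rewrite Sv = refl
  ... | no _ = refl

  ∑-remove : ∀ (S : Mask N) {v} f → S v ≡ true → ∑⟨ S ⟩ f ≡ f v + ∑⟨ S ∖ v ⟩ f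
  ∑-remove S {v} f Sv = ∑-disjoint S (_== v) (S ∖ v) f (⟦∖⟧ S Sv) ⨾ cong (_+ ∑⟨ S ∖ v ⟩ f) (∑-single v f)

  #-remove : ∀ (S : Mask N) {v} → S v ≡ true → # S ≡ suc (# (S ∖ v))
  #-remove S = ∑-remove S (λ _ → 1)

  #-insert : ∀ (S : Mask N) {v} → S v ≡ false → # (S ⊎ᵐ v) ≡ suc (# S)
  #-insert S {v} Sv = ∑-disjoint (S ⊎ᵐ v) (_== v) S (λ _ → 1) (⟦⊎⟧ S Sv) ⨾ cong (_+ # S) (∑-single v _)

  ∖-⊆ : ∀ (S : Mask N) {v} x → (S ∖ v) x ≡ true → S x ≡ true
  ∖-⊆ S {v} x h with x Fin.≟ v
  ... | no _ = h

  ∖-≢ : ∀ (S : Mask N) {v} x → (S ∖ v) x ≡ true → x ≢ v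
  ∖-≢ S {v} x h with x Fin.≟ v
  ... | no ne = ne

  ∖-intro : ∀ (S : Mask N) {v} x → S x ≡ true → x ≢ v → (S ∖ v) x ≡ true
  ∖-intro S {v} x h ne with x Fin.≟ v
  ... | yes e = ⊥-elim (ne e)
  ... | no _ = h

  ∖-self : ∀ (S : Mask N) v → (S ∖ v) v ≡ false
  ∖-self S v rewrite ==-refl v = refl

  ⊎ᵐ-elim : ∀ (S : Mask N) {v} x → (S ⊎ᵐ v) x ≡ true → x ≡ v ⊎ S x ≡ true
  ⊎ᵐ-elim S {v} x h with x Fin.≟ v
  ... | yes e = inj₁ e
  ... | no _ = inj₂ h

  find : (S : Mask N) → (∃ λ x → S x ≡ true) ⊎ (∀ x → S x ≡ false)
  find S with Fin.any? (λ x → S x Bool.≟ true)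
  ... | yes p = inj₁ p
  ... | no np = inj₂ (λ x → ¬true (S x) (λ e → np (x , e)))
    where
    ¬true : ∀ b → b ≢ true → b ≡ false
    ¬true true h = ⊥-elim (h refl)
    ¬true false h = refl

  nonempty : (S : Mask N) → 0 < # S → ∃ λ x → S x ≡ true
  nonempty S h with find S
  ... | inj₁ p = p
  ... | inj₂ e = ⊥-elim (<⇒≢ h (≡-sym (sum-zero (λ x → cong (λ b → ⟦ b ⟧ * 1) (e x)))))

  #-zero : (S : Mask N) → # S ≡ 0 → ∀ x → S x ≡ false
  #-zero S e with find S
  ... | inj₂ h = h
  ... | inj₁ (x , p) with () ← ≡-sym e ⨾ #-remove S p

dichotomy : ∀ {N} {P Q : Fin N → Set} → (∀ x → P x ⊎ Q x) → ∃ P ⊎ (∀ x → Q x)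
dichotomy {zero} h = inj₂ λ ()
dichotomy {suc N} h with h zero | dichotomy (λ x → h (suc x))
... | inj₁ p | _ = inj₁ (zero , p)
... | inj₂ _ | inj₁ (x , p) = inj₁ (suc x , p)
... | inj₂ q | inj₂ qs = inj₂ λ { zero → q ; (suc x) → qs x }

opaque
  unfolding sum

  -- The first row and the first column have equal sums and the diagonal vanishes; what remains is
  -- the same claim with one index fewer.
  symmetric-sum-even : ∀ {N} (f : Fin N → Fin N → ℕ) → (∀ x y → f x y ≡ f y x) → (∀ x → f x x ≡ 0) →
    ∃ λ h → sum (λ x → sum (f x)) ≡ h + h
  symmetric-sum-even {zero} f s z = 0 , refl
  symmetric-sum-even {suc N} f s z with symmetric-sum-even (λ x y → f (suc x) (suc y)) (λ x y → s _ _) (λ x → z _)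
  ... | h , e = r + h , (begin
      (f zero zero + r) + sum (λ x → f (suc x) zero + sum (λ y → f (suc x) (suc y)))
        ≡⟨ cong₂ _+_ (cong (_+ r) (z zero)) (sum-+ (λ x → f (suc x) zero) _) ⟩
      r + (sum (λ x → f (suc x) zero) + sum (λ x → sum (λ y → f (suc x) (suc y))))
        ≡⟨ cong (r +_) (cong₂ _+_ (sum-cong (λ x → s (suc x) zero)) e) ⟩
      r + (r + (h + h)) ≡⟨ solve 2 (λ r h → r :+ (r :+ (h :+ h)) := (r :+ h) :+ (r :+ h)) refl r h ⟩
      (r + h) + (r + h) ∎)
    where
    open ≡-Reasoning
    r : ℕ
    r = sum (λ y → f zero (suc y))

module Counting {N : ℕ} (G : Graph N) where

  a : Fin N → Fin N → Bool
  a = adj G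

  TriangleFree : Set
  TriangleFree = ∀ x y z → a x y ≡ true → a y z ≡ true → a x z ≡ false

  Independent : Mask N → Set
  Independent I = ∀ x y → I x ≡ true → I y ≡ true → a x y ≡ false

  _⊆_ : Mask N → Mask N → Set
  S ⊆ T = ∀ x → S x ≡ true → T x ≡ true

  α≤ : ℕ → Mask N → Set
  α≤ k S = ∀ I → I ⊆ S → Independent I → # I ≤ k

  d : Mask N → Fin N → ℕ
  d S x = ∑⟨ S ⟩ (λ y → ⟦ a x y ⟧)

  -- Twice the number of edges.
  E : Mask N → ℕ
  E S = ∑⟨ S ⟩ (d S)

  nb far : Mask N → Fin N → Mask N
  nb S v x = S x ∧ a v x
  far S v x = if x == v then false else if a v x then false else S x

  nb-S : ∀ S v x → nb S v x ≡ true → S x ≡ true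
  nb-S S v x h with S x
  ... | true = refl

  nb-a : ∀ S v x → nb S v x ≡ true → a v x ≡ true
  nb-a S v x h with S x
  ... | true = h

  far-S : ∀ S v x → far S v x ≡ true → S x ≡ true
  far-S S v x h with x Fin.≟ v | a v x
  ... | no _ | false = h

  far-a : ∀ S v x → far S v x ≡ true → a v x ≡ false
  far-a S v x h with x Fin.≟ v | a v x
  ... | no _ | false = refl

  far-self : ∀ S v → far S v v ≡ false
  far-self S v rewrite ==-refl v = refl

  ⟦a⟧-sym : ∀ x y → ⟦ a x y ⟧ ≡ ⟦ a y x ⟧
  ⟦a⟧-sym x y = cong ⟦_⟧ (sym G x y)

  -- For disjoint sets this counts the edges between them; `Q S S` is `E S`.
  Q : Mask N → Mask N → ℕ
  Q S T = ∑⟨ S ⟩ (d T)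

  Q-comm : ∀ S T → Q S T ≡ Q T S
  Q-comm S T = ∑-comm⟨⟩ S T (λ x y → ⟦ a x y ⟧) ⨾ ∑-cong T (λ y _ → ∑-cong S (λ x _ → ⟦a⟧-sym x y))

  -- Parity lets every bound on `E` be rounded up to an even number, and it excludes a 7-regular
  -- graph on 29 vertices.
  E-even : ∀ S → ∃ λ h → E S ≡ h + h
  E-even S with symmetric-sum-even (λ x y → ⟦ S x ⟧ * (⟦ S y ⟧ * ⟦ a x y ⟧))
                (λ x y → swap ⟦ S x ⟧ ⟦ S y ⟧ ⟦ a x y ⟧ ⨾ cong (λ z → ⟦ S y ⟧ * (⟦ S x ⟧ * z)) (⟦a⟧-sym x y))
                (λ x → cong (λ b → ⟦ S x ⟧ * (⟦ S x ⟧ * ⟦ b ⟧)) (irrefl G x) ⨾ zeros ⟦ S x ⟧)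
    where
    swap : ∀ a b c → a * (b * c) ≡ b * (a * c)
    swap = solve 3 (λ a b c → a :* (b :* c) := b :* (a :* c)) refl
    zeros : ∀ s → s * (s * 0) ≡ 0
    zeros s = cong (s *_) (*-zeroʳ s) ⨾ *-zeroʳ s
  ... | h , e = h , (sum-cong (λ x → sum-* ⟦ S x ⟧ _) ⨾ e)

  module At {S : Mask N} {v : Fin N} (Sv : S v ≡ true) where

    split : ∀ x → ⟦ S x ⟧ ≡ ⟦ x == v ⟧ + (⟦ nb S v x ⟧ + ⟦ far S v x ⟧)
    split x with x Fin.≟ v
    ... | yes refl rewrite Sv | irrefl G v = refl
    ... | no _ with a v x | S x
    ... | true | true = refl
    ... | true | false = refl
    ... | false | true = refl
    ... | false | false = refl

    ∑-split : ∀ f → ∑⟨ S ⟩ f ≡ f v + (∑⟨ nb S v ⟩ f + ∑⟨ far S v ⟩ f)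
    ∑-split f = sum-cong eq ⨾ sum-+ _ _ ⨾ cong₂ _+_ (∑-single v f) (sum-+ _ _)
      where
      eq : ∀ x → ⟦ S x ⟧ * f x ≡ ⟦ x == v ⟧ * f x + (⟦ nb S v x ⟧ * f x + ⟦ far S v x ⟧ * f x)
      eq x = cong (_* f x) (split x) ⨾
        solve 4 (λ e b r y → (e :+ (b :+ r)) :* y := e :* y :+ (b :* y :+ r :* y)) refl ⟦ x == v ⟧ ⟦ nb S v x ⟧ ⟦ far S v x ⟧ (f x)
       

    d≡#nb : d S v ≡ # (nb S v)
    d≡#nb = sum-cong eq
      where
      eq : ∀ x → ⟦ S x ⟧ * ⟦ a v x ⟧ ≡ ⟦ nb S v x ⟧ * 1
      eq x with S x | a v x
      ... | true | true = refl
      ... | true | false = refl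
      ... | false | _ = refl

    #-split : # S ≡ suc (d S v + # (far S v))
    #-split = ∑-split (λ _ → 1) ⨾ cong (λ z → suc (z + # (far S v))) (≡-sym d≡#nb)

    -- An independent set far from `v` remains independent when `v` is added.
    α-far : ∀ {k} → α≤ (suc k) S → α≤ k (far S v)
    α-far h I I⊆ ind = ≤-pred (≤-trans (≤-reflexive (≡-sym (#-insert I Iv))) (h (I ⊎ᵐ v) sub ind′))
      where
      Iv : I v ≡ false
      Iv with I v in e
      ... | false = refl
      ... | true with () ← ≡-sym (I⊆ v e) ⨾ far-self S v
      sub : (I ⊎ᵐ v) ⊆ S
      sub x p with ⊎ᵐ-elim I x p
      ... | inj₁ refl = Sv
      ... | inj₂ q = far-S S v x (I⊆ x q)
      ind′ : Independent (I ⊎ᵐ v)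
      ind′ x y p q with ⊎ᵐ-elim I x p | ⊎ᵐ-elim I y q
      ... | inj₁ refl | inj₁ refl = irrefl G v
      ... | inj₁ refl | inj₂ q′ = far-a S v y (I⊆ y q′)
      ... | inj₂ p′ | inj₁ refl = sym G x v ⨾ far-a S v x (I⊆ x p′)
      ... | inj₂ p′ | inj₂ q′ = ind x y p′ q′

    module _ (tf : TriangleFree) where

      nb-independent : Independent (nb S v)
      nb-independent x y p q = tf x v y (sym G x v ⨾ nb-a S v x p) (nb-a S v y q)

      d≤α : ∀ {k} → α≤ k S → d S v ≤ k
      d≤α h = ≤-trans (≤-reflexive d≡#nb) (h (nb S v) (λ x → nb-S S v x) nb-independent)

      d-nb : ∀ x → nb S v x ≡ true → d S x ≡ suc (d (far S v) x)
      d-nb x p = ∑-split (λ y → ⟦ a x y ⟧) ⨾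
        cong₂ _+_ (cong ⟦_⟧ (sym G x v ⨾ nb-a S v x p)) (cong (_+ d (far S v) x)
          (∑-cong (nb S v) (λ y q → cong ⟦_⟧ (nb-independent x y p q)) ⨾ ∑-const (nb S v) 0 ⨾ *-zeroʳ (# (nb S v))))

      d-far : ∀ x → far S v x ≡ true → d S x ≡ d (nb S v) x + d (far S v) x
      d-far x p = ∑-split (λ y → ⟦ a x y ⟧) ⨾ cong (λ b → ⟦ b ⟧ + (d (nb S v) x + d (far S v) x)) (sym G x v ⨾ far-a S v x p)

      -- Every edge of S avoiding v and its neighbours lies in far S v, and every other edge
      -- has exactly one end in nb S v, because nb S v is independent.
      E-split : E S ≡ E (far S v) + 2 * ∑⟨ nb S v ⟩ (d S)
      E-split = begin
        E S ≡⟨ ∑-split (d S) ⟩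
        d S v + (Z + ∑⟨ R ⟩ (d S)) ≡⟨ cong (λ z → d S v + (Z + z)) (∑-cong R d-far ⨾ ∑-+ R _ _) ⟩
        d S v + (Z + (Q R B + E R)) ≡⟨ solve 4 (λ a b c e → a :+ (b :+ (c :+ e)) := e :+ (b :+ (a :+ c))) refl (d S v) Z (Q R B) (E R) ⟩
        E R + (Z + (d S v + Q R B)) ≡⟨ cong (λ z → E R + (Z + z)) (≡-sym Z≡) ⟩
        E R + (Z + Z) ≡⟨ cong (λ z → E R + (Z + z)) (≡-sym (+-identityʳ Z)) ⟩
        E R + 2 * Z ∎
        where
        open ≡-Reasoning
        B = nb S v
        R = far S v
        Z = ∑⟨ B ⟩ (d S)
        Z≡ : Z ≡ d S v + Q R B
        Z≡ = ∑-cong B d-nb ⨾ ∑-+ B (λ _ → 1) (d R) ⨾ cong₂ _+_ (≡-sym d≡#nb) (Q-comm B R)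

  module _ (tf : TriangleFree) where

    -- After exchanging the sums, each `u` contributes its degree once for each of its `d S u`
    -- neighbours.
    Z-sum : ∀ S → ∑⟨ S ⟩ (λ v → ∑⟨ nb S v ⟩ (d S)) ≡ ∑⟨ S ⟩ (λ v → d S v * d S v)
    Z-sum S = begin
      ∑⟨ S ⟩ (λ v → ∑⟨ nb S v ⟩ (d S)) ≡⟨ ∑-cong S (λ v _ → sum-cong (nb-weight v)) ⟩
      ∑⟨ S ⟩ (λ v → ∑⟨ S ⟩ (λ u → ⟦ a v u ⟧ * d S u)) ≡⟨ ∑-comm⟨⟩ S S _ ⟩
      ∑⟨ S ⟩ (λ u → ∑⟨ S ⟩ (λ v → ⟦ a v u ⟧ * d S u))
        ≡⟨ ∑-cong S (λ u _ → ∑-cong S (λ v _ → *-comm ⟦ a v u ⟧ (d S u) ⨾ cong (d S u *_) (⟦a⟧-sym v u)) ⨾ ∑-* S (d S u) _) ⟩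
      ∑⟨ S ⟩ (λ u → d S u * d S u) ∎
      where
      open ≡-Reasoning
      nb-weight : ∀ v u → ⟦ nb S v u ⟧ * d S u ≡ ⟦ S u ⟧ * (⟦ a v u ⟧ * d S u)
      nb-weight v u with S u | a v u
      ... | true | true = ≡-sym (+-identityʳ _)
      ... | true | false = refl
      ... | false | _ = refl

    -- Summing E S = E (far S v) + 2 ∑_{u ∼ v} d u over v turns the neighbour sums into ∑ d².
    tangent : ∀ S A B →
      (∀ v → S v ≡ true → B + A * d S v ≤ 2 * (d S v * d S v) + E (far S v)) →
      # S * B + A * E S ≤ # S * E S
    tangent S A B h = begin
      # S * B + A * E S ≡⟨ cong₂ _+_ (≡-sym (∑-const S B)) (≡-sym (∑-* S A (d S))) ⨾ ≡-sym (∑-+ S (λ _ → B) _) ⟩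
      ∑⟨ S ⟩ (λ v → B + A * d S v) ≤⟨ ∑-mono S h ⟩
      ∑⟨ S ⟩ (λ v → 2 * (d S v * d S v) + E (far S v)) ≡⟨ ∑-+ S _ _ ⟩
      ∑⟨ S ⟩ (λ v → 2 * (d S v * d S v)) + F
        ≡⟨ cong (_+ F) (∑-* S 2 _ ⨾ cong (2 *_) (≡-sym (Z-sum S)) ⨾ ≡-sym (∑-* S 2 _)) ⟩
      ∑⟨ S ⟩ (λ v → 2 * ∑⟨ nb S v ⟩ (d S)) + F ≡⟨ +-comm _ F ⨾ ≡-sym (∑-+ S _ _) ⟩
      ∑⟨ S ⟩ (λ v → E (far S v) + 2 * ∑⟨ nb S v ⟩ (d S)) ≡⟨ ∑-cong S (λ v Sv → ≡-sym (At.E-split Sv tf)) ⟩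
      ∑⟨ S ⟩ (λ _ → E S) ≡⟨ ∑-const S (E S) ⟩
      # S * E S ∎
      where
      open ≤-Reasoning
      F = ∑⟨ S ⟩ (λ v → E (far S v))

-- Extending the graph far from a vertex

Row : Set
Row = List Bool

-- A graph on a list of vertices: each row records the adjacencies of a vertex to the later ones.
Tri : Set
Tri = List Row

ones : Row → ℕ
ones [] = 0
ones (b ∷ r) = ⟦ b ⟧ + ones r

disj : Row → Row → Bool
disj (true ∷ xs) (true ∷ ys) = false
disj (true ∷ xs) (false ∷ ys) = disj xs ys
disj (false ∷ xs) (_ ∷ ys) = disj xs ys
disj _ _ = true

minus : Row → Row → Row
minus (b ∷ bs) (true ∷ cs) = false ∷ minus bs cs
minus (b ∷ bs) (false ∷ cs) = b ∷ minus bs cs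
minus bs _ = bs

degs : Tri → List ℕ
degs [] = []
degs (r ∷ rs) = ones r ∷ zipWith (λ b k → ⟦ b ⟧ + k) r (degs rs)

-- The row marks the vertices still available and the number says how many are still to be chosen; a
-- chosen vertex strikes out its later neighbours.
indep : Tri → Row → ℕ → List Row
indep [] _ zero = [] ∷ []
indep [] _ (suc p) = []
indep (r ∷ rs) (true ∷ s) (suc p) = map (true ∷_) (indep rs (minus s r) p) ++ map (false ∷_) (indep rs s (suc p))
indep (r ∷ rs) (true ∷ s) zero = map (false ∷_) (indep rs s zero)
indep (r ∷ rs) (false ∷ s) p = map (false ∷_) (indep rs s p)
indep (r ∷ rs) [] p = []

indepSets : Tri → ℕ → List Row
indepSets H p = indep H (replicate (length H) true) p

Family : Set
Family = List (List Row)

-- List `i` holds the independent sets of `K - i` vertices: together with `i + 1` neighbours of the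
-- centre that all miss it, such a set would form an independent set of `K + 1` vertices.
families : Tri → ℕ → ℕ → Family
families H (suc m) (suc K) = indepSets H (suc K) ∷ families H m K
families H _ _ = []

avoiding : Row → List Row → List Row
avoiding c [] = []
avoiding c (i ∷ is) = if disj c i then i ∷ avoiding c is else avoiding c is

-- An obstacle missed by the new row now tolerates one miss fewer, so the lists move up by one
-- place; an obstacle that is hit is settled.
restrict : Row → Family → Family
restrict c [] = []
restrict c (l ∷ f) = map (avoiding c) f

-- A possible neighbourhood `row` of a neighbour y of v in the graph far from v, with obstacles:
-- for each set T of earlier chosen neighbours of v together with y, the i-th list of a family
-- holds independent sets which no further i + 1 chosen rows may all avoid.
record Cand : Set where
  constructor cand
  field
    size : ℕ
    row  : Row
    fams : List Family
open Cand

mkCands : ℕ → Family → List Row → List Cand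
mkCands p F [] = []
mkCands p F (c ∷ cs) = cand p c (restrict c F ∷ []) ∷ mkCands p F cs

-- Sizes decrease along the list, so the search can stop when the leading size is too small for the
-- remaining total.
candidates : Tri → Family → ℕ → ℕ → List Cand
candidates H F lo zero = mkCands 0 F (indepSets H 0)
candidates H F lo (suc hi) =
  mkCands (suc hi) F (indepSets H (suc hi)) ++ (if lo <ᵇ suc hi then candidates H F lo hi else [])

-- The numbers are capacities: how many more of the chosen rows may contain each far vertex.
fits : Row → List ℕ → Bool
fits (true ∷ c) (zero ∷ ks) = false
fits (true ∷ c) (suc _ ∷ ks) = fits c ks
fits (false ∷ c) (_ ∷ ks) = fits c ks
fits _ _ = true

use : Row → List ℕ → List ℕ
use (true ∷ c) (k ∷ ks) = pred k ∷ use c ks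
use (false ∷ c) (k ∷ ks) = k ∷ use c ks
use _ ks = ks

hitsAll : Row → List Row → Bool
hitsAll c [] = true
hitsAll c (i ∷ is) = if disj c i then false else hitsAll c is

hitsFams : Row → List Family → Bool
hitsFams c [] = true
hitsFams c ([] ∷ Fs) = hitsFams c Fs
hitsFams c ((l ∷ _) ∷ Fs) = if hitsAll c l then hitsFams c Fs else false

-- Here `lo` and `hi` bound the total size of the rows chosen besides the one tested. A surviving
-- row inherits the obstacles of the row just chosen, restricted to those it misses, so that its
-- families range over all sets of earlier choices together with itself.
refine : (hi lo t : ℕ) → List Family → List ℕ → List Cand → List Cand
refine hi lo t Fs ks [] = []
refine hi lo t Fs ks (cand p c Gs ∷ ss) =
  if p + hi <ᵇ t then refine hi lo t Fs ks ss else
  if t <ᵇ p + lo then refine hi lo t Fs ks ss else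
  if hitsFams c Fs then
    (if fits c ks then cand p c (Gs ++ map (restrict c) Fs) ∷ refine hi lo t Fs ks ss else refine hi lo t Fs ks ss)
  else refine hi lo t Fs ks ss

bit : ℕ → Row → Bool
bit _ [] = false
bit zero (b ∷ _) = b
bit (suc j) (_ ∷ c) = bit j c

anyBit : ℕ → List Cand → Bool
anyBit j [] = false
anyBit j (s ∷ ss) = if bit j (row s) then true else anyBit j ss

-- A capacity above the slack means that this far vertex still needs a neighbour, so some candidate
-- must contain it. The first such column is tested, which is a necessary condition and hence safe
-- for pruning.
needMet : (slack j : ℕ) → List ℕ → List Cand → Bool
needMet slack j [] ss = true
needMet slack j (k ∷ ks) ss = if slack <ᵇ k then anyBit j ss else needMet slack (suc j) ks ss

-- All lists of r rows from the candidates, up to order, with t ones in total, hitting all obstacles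
-- and such that column i contains at most k_i and at least k_i - slack ones.
search : (slack lo r t : ℕ) → List Cand → List ℕ → List (List Row)
search slack lo zero t ss ks = if needMet slack 0 ks [] then [] ∷ [] else []
search slack lo (suc r) t [] ks = []
search slack lo (suc r) t (cand p c Fs ∷ ss) ks =
  if p * suc r <ᵇ t then [] else
  if needMet slack 0 ks (cand p c Fs ∷ ss) then
    (if t <ᵇ p + r * lo then [] else
      map (c ∷_) (search slack lo r (t ∸ p)
        (refine (pred r * p) (pred r * lo) (t ∸ p) Fs (use c ks) (cand p c Fs ∷ ss)) (use c ks)))
    ++ search slack lo (suc r) t ss ks
  else []

attach : List Row → Tri → Tri
attach [] H = H
attach (c ∷ cs) H = (replicate (length cs) false ++ c) ∷ attach cs H

-- The new order is the centre, its neighbours, the far vertices. The neighbours are pairwise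
-- non-adjacent, since there are no triangles.
build : Tri → List Row → Tri
build H cs = (replicate (length cs) true ++ replicate (length H) false) ∷ attach cs H

-- A neighbour of the centre has one edge to the centre and between `lo` and `hi` far ones. If all
-- degrees lie between `lo + 1` and `hi + 1`, a vertex with `k` far neighbours occurs in at most
-- `hi + 1 - k` rows and falls short of that by at most `hi - lo`.
coneLists : Tri → (K deg lo hi t : ℕ) → List (List Row)
coneLists H K deg lo hi t =
  search (hi ∸ lo) lo deg t (candidates H (families H deg K) lo hi) (map (suc hi ∸_) (degs H))

glue : Tri → (K deg lo hi t : ℕ) → List Tri
glue H K deg lo hi t = map (build H) (coneLists H K deg lo hi t)

if-false : ∀ {A : Set} {b} {x y : A} → b ≡ false → (if b then x else y) ≡ y
if-false refl = refl

if-true : ∀ {A : Set} {b} {x y : A} → b ≡ true → (if b then x else y) ≡ x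
if-true refl = refl

≤⇒≮ᵇ : ∀ {m n} → n ≤ m → (m <ᵇ n) ≡ false
≤⇒≮ᵇ {m} {n} n≤m with m <ᵇ n in e
... | false = refl
... | true = ⊥-elim (≤⇒≯ n≤m (<ᵇ⇒< m n (subst T (≡-sym e) tt)))

<ᵇ-true : ∀ {m n} → (m <ᵇ n) ≡ true → m < n
<ᵇ-true {m} {n} e = <ᵇ⇒< m n (subst T (≡-sym e) tt)

total : ∀ {A : Set} → (A → ℕ) → List A → ℕ
total f [] = 0
total f (x ∷ xs) = f x + total f xs

⟦⟧-injective : ∀ b c → ⟦ b ⟧ ≡ ⟦ c ⟧ → b ≡ c
⟦⟧-injective true true _ = refl
⟦⟧-injective false false _ = refl

zipWith-map : ∀ {A B C D : Set} (f : B → C → D) (g : A → B) (h : A → C) xs →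
  zipWith f (map g xs) (map h xs) ≡ map (λ x → f (g x) (h x)) xs
zipWith-map f g h [] = refl
zipWith-map f g h (x ∷ xs) = cong (f (g x) (h x) ∷_) (zipWith-map f g h xs)

-- Deleting each listed element from the mask rules out repetitions. The order is free, so a set can
-- be listed anew to match a given adjacency list.
data Enum {N} (S : Mask N) : List (Fin N) → Set where
  none : (∀ x → S x ≡ false) → Enum S []
  next : ∀ {x xs} → S x ≡ true → Enum (S ∖ x) xs → Enum S (x ∷ xs)

module _ {N : ℕ} where

  Enum-∑ : ∀ {S : Mask N} {xs} → Enum S xs → ∀ f → ∑⟨ S ⟩ f ≡ total f xs
  Enum-∑ (none e) f = sum-zero (λ x → cong (λ b → ⟦ b ⟧ * f x) (e x))
  Enum-∑ {S} (next {x} Sx en) f = ∑-remove S f Sx ⨾ cong (f x +_) (Enum-∑ en f)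

  Enum-++ : ∀ {S P Q : Mask N} {ys xs} → (∀ x → ⟦ S x ⟧ ≡ ⟦ P x ⟧ + ⟦ Q x ⟧) → Enum P ys → Enum Q xs → Enum S (ys ++ xs)
  Enum-++ {S} {P} {Q} h (none e) en = relabel en (λ x → ⟦⟧-injective _ _ (≡-sym (h x ⨾ cong (λ b → ⟦ b ⟧ + ⟦ Q x ⟧) (e x))))
    where
    relabel : ∀ {S T : Mask N} {xs} → Enum S xs → (∀ x → S x ≡ T x) → Enum T xs
    relabel (none e) h = none (λ x → ≡-sym (h x) ⨾ e x)
    relabel (next {y} Sx en) h = next (≡-sym (h _) ⨾ Sx) (relabel en (λ x → cong (λ b → if x == y then false else b) (h x)))
  Enum-++ {S} {P} {Q} h (next {y} {ys} Py en) en′ = next Sy (Enum-++ h′ en en′)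
    where
    Sy : S y ≡ true
    Sy with S y | h y
    ... | true | _ = refl
    ... | false | hy rewrite Py with () ← hy
    Qy : Q y ≡ false
    Qy with Q y | h y
    ... | false | _ = refl
    ... | true | hy rewrite Py | Sy with () ← hy
    h′ : ∀ x → ⟦ (S ∖ y) x ⟧ ≡ ⟦ (P ∖ y) x ⟧ + ⟦ Q x ⟧
    h′ x with x Fin.≟ y
    ... | yes refl rewrite Qy = refl
    ... | no _ = h x

  Enum-length : ∀ {S : Mask N} {xs} → Enum S xs → # S ≡ length xs
  Enum-length {xs = xs} en = Enum-∑ en (λ _ → 1) ⨾ go xs
    where
    go : ∀ (xs : List (Fin N)) → total (λ _ → 1) xs ≡ length xs
    go [] = refl
    go (x ∷ xs) = cong suc (go xs)

module Gluing {N : ℕ} (G : Graph N) where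
  open Counting G

  trig : List (Fin N) → Tri
  trig [] = []
  trig (x ∷ xs) = map (a x) xs ∷ trig xs

  length-trig : ∀ xs → length (trig xs) ≡ length xs
  length-trig [] = refl
  length-trig (x ∷ xs) = cong suc (length-trig xs)

  ones-map : ∀ (b : Fin N → Bool) xs → ones (map b xs) ≡ total (λ x → ⟦ b x ⟧) xs
  ones-map b [] = refl
  ones-map b (x ∷ xs) = cong (⟦ b x ⟧ +_) (ones-map b xs)

  ones-cone : ∀ {F xs} → Enum F xs → ∀ y → ones (map (a y) xs) ≡ d F y
  ones-cone {xs = xs} en y = ones-map (a y) xs ⨾ ≡-sym (Enum-∑ en _)

  degs-trig : ∀ xs → degs (trig xs) ≡ map (λ x → total (λ y → ⟦ a x y ⟧) xs) xs
  degs-trig [] = refl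
  degs-trig (x ∷ xs) rewrite degs-trig xs | irrefl G x =
    cong₂ _∷_ (ones-map (a x) xs)
      (zipWith-map _ (a x) _ xs ⨾ map-cong (λ z → cong (λ b → ⟦ b ⟧ + total (λ y → ⟦ a z y ⟧) xs) (sym G x z)) xs)

  degs-Enum : ∀ {F xs} → Enum F xs → degs (trig xs) ≡ map (d F) xs
  degs-Enum {xs = xs} en = degs-trig xs ⨾ map-cong (λ x → ≡-sym (Enum-∑ en _)) xs

  E-Enum : ∀ {F xs} → Enum F xs → E F ≡ total (λ k → k) (degs (trig xs))
  E-Enum {F} {xs} en = Enum-∑ en (d F) ⨾ go xs ⨾ cong (total (λ k → k)) (≡-sym (degs-Enum en))
    where
    go : ∀ ys → total (d F) ys ≡ total (λ k → k) (map (d F) ys)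
    go [] = refl
    go (y ∷ ys) = cong (d F y +_) (go ys)

  minus-map : ∀ (v b : Fin N → Bool) xs → minus (map v xs) (map b xs) ≡ map (λ x → if b x then false else v x) xs
  minus-map v b [] = refl
  minus-map v b (x ∷ xs) with b x
  ... | true = cong (false ∷_) (minus-map v b xs)
  ... | false = cong (v x ∷_) (minus-map v b xs)

  indep-complete : ∀ (b v : Fin N → Bool) xs → (∀ x y → b x ≡ true → b y ≡ true → a x y ≡ false) →
    (∀ x → b x ≡ true → v x ≡ true) → map b xs ∈ indep (trig xs) (map v xs) (ones (map b xs))
  indep-complete b v [] ind b⊆v = here refl
  indep-complete b v (x ∷ xs) ind b⊆v with b x in bx | v x in vx
  ... | true | false with () ← ≡-sym vx ⨾ b⊆v x bx
  ... | false | false = ∈-map⁺ (false ∷_) (indep-complete b v xs ind b⊆v)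
  ... | true | true = ∈-++⁺ˡ (∈-map⁺ (true ∷_) (subst (λ s → map b xs ∈ indep (trig xs) s (ones (map b xs)))
          (≡-sym (minus-map v (a x) xs)) (indep-complete b _ xs ind sub)))
    where
    sub : ∀ y → b y ≡ true → (if a x y then false else v y) ≡ true
    sub y by rewrite ind x y bx by = b⊆v y by
  ... | false | true with indep-complete b v xs ind b⊆v
  ... | mem with ones (map b xs)
  ... | zero = ∈-map⁺ (false ∷_) mem
  ... | suc p = ∈-++⁺ʳ (map (true ∷_) (indep (trig xs) (minus (map v xs) (map (a x) xs)) p)) (∈-map⁺ (false ∷_) mem)

  -- A row produced by `indep`, read back as a set of vertices; `avoid` turns disjointness of rows
  -- into non-adjacency.
  record Realized (F v : Mask N) (xs : List (Fin N)) (p : ℕ) (s : Row) : Set where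
    field
      Z     : Mask N
      #Z    : # Z ≡ p
      Z⊆F   : Z ⊆ F
      Z⊆v   : Z ⊆ v
      ind   : Independent Z
      avoid : ∀ y → disj (map (a y) xs) s ≡ true → ∀ z → Z z ≡ true → a y z ≡ false

  skip : ∀ {F v x xs p s} → Realized (F ∖ x) v xs p s → Realized F v (x ∷ xs) p (false ∷ s)
  skip {F} {v} {x} {xs} {p} {s} ρ = record
    { Z = Z ; #Z = #Z ; Z⊆F = λ z h → ∖-⊆ F z (Z⊆F z h) ; Z⊆v = Z⊆v ; ind = ind ; avoid = λ y h → avoid y (tail y h) }
    where
    open Realized ρ
    tail : ∀ y → disj (map (a y) (x ∷ xs)) (false ∷ s) ≡ true → disj (map (a y) xs) s ≡ true
    tail y h with a y x
    ... | true = h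
    ... | false = h

  take : ∀ {F v x xs p s} → F x ≡ true → v x ≡ true → Realized (F ∖ x) (λ y → if a x y then false else v y) xs p s →
    Realized F v (x ∷ xs) (suc p) (true ∷ s)
  take {F} {v} {x} {xs} {p} {s} Fx vx ρ = record
    { Z = Z ⊎ᵐ x
    ; #Z = #-insert Z Zx ⨾ cong suc #Z
    ; Z⊆F = λ z h → [ (λ { refl → Fx }) , (λ q → ∖-⊆ F z (Z⊆F z q)) ]′ (⊎ᵐ-elim Z z h)
    ; Z⊆v = λ z h → [ (λ { refl → vx }) , (λ q → proj₂ (old z q)) ]′ (⊎ᵐ-elim Z z h)
    ; ind = ind′
    ; avoid = avoid′ }
    where
    open Realized ρ
    Zx : Z x ≡ false
    Zx with Z x in e
    ... | false = refl
    ... | true with () ← ≡-sym (∖-self F x) ⨾ Z⊆F x e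
    old : ∀ z → Z z ≡ true → a x z ≡ false × v z ≡ true
    old z q with a x z | Z⊆v z q
    ... | false | h = refl , h
    ind′ : Independent (Z ⊎ᵐ x)
    ind′ y z hy hz with ⊎ᵐ-elim Z y hy | ⊎ᵐ-elim Z z hz
    ... | inj₁ refl | inj₁ refl = irrefl G x
    ... | inj₁ refl | inj₂ q = proj₁ (old z q)
    ... | inj₂ p | inj₁ refl = sym G y x ⨾ proj₁ (old y p)
    ... | inj₂ p | inj₂ q = ind y z p q
    avoid′ : ∀ y → disj (map (a y) (x ∷ xs)) (true ∷ s) ≡ true → ∀ z → (Z ⊎ᵐ x) z ≡ true → a y z ≡ false
    avoid′ y h z hz with a y x in e
    ... | false with ⊎ᵐ-elim Z z hz
    ... | inj₁ refl = e
    ... | inj₂ q = avoid y h z q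

  indep-sound : ∀ {F} (v : Mask N) {xs} → Enum F xs → ∀ p {s} → s ∈ indep (trig xs) (map v xs) p → Realized F v xs p s
  indep-sound v (none e) zero (here refl) = record
    { Z = λ _ → false ; #Z = sum-zero (λ _ → refl) ; Z⊆F = λ _ () ; Z⊆v = λ _ () ; ind = λ _ _ () ; avoid = λ _ _ _ () }
  indep-sound v (next {x} {xs} Fx en) p m with v x in vx
  indep-sound v (next {x} {xs} Fx en) p m | false with ∈-map⁻ (false ∷_) m
  ... | _ , m′ , refl = skip (indep-sound v en p m′)
  indep-sound v (next {x} {xs} Fx en) zero m | true with ∈-map⁻ (false ∷_) m
  ... | _ , m′ , refl = skip (indep-sound v en zero m′)
  indep-sound v (next {x} {xs} Fx en) (suc p) m | true with ∈-++⁻ (map (true ∷_) (indep (trig xs) (minus (map v xs) (map (a x) xs)) p)) m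
  ... | inj₂ q with ∈-map⁻ (false ∷_) q
  ...   | _ , m′ , refl = skip (indep-sound v en (suc p) m′)
  indep-sound v (next {x} {xs} Fx en) (suc p) m | true | inj₁ q with ∈-map⁻ (true ∷_) q
  ...   | s , m′ , refl = take Fx vx (indep-sound _ en p (subst (λ r → s ∈ indep (trig xs) r p) (minus-map v (a x) xs) m′))

  replicate-true : ∀ (xs : List (Fin N)) → replicate (length (trig xs)) true ≡ map (λ _ → true) xs
  replicate-true [] = refl
  replicate-true (x ∷ xs) = cong (true ∷_) (replicate-true xs)

  module Sound {S : Mask N} {v : Fin N} (Sv : S v ≡ true) (tf : TriangleFree) {K : ℕ} (αS : α≤ K S)
               {xs : List (Fin N)} (en : Enum (far S v) xs) where

    cone : Fin N → Row
    cone y = map (a y) xs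

    size′ : Fin N → ℕ
    size′ = d (far S v)

    -- Typically `Z` is an independent far set, recorded by `I`, together with neighbours of `v`
    -- already chosen. The latter have no edge to the remaining neighbours `R`, so a vertex of `R`
    -- can join `Z` as soon as its row misses `I`.
    record Obstacle (R : Mask N) (q : ℕ) (I : Row) : Set where
      field
        Z     : Mask N
        #Z    : # Z ≡ q
        Z⊆S   : Z ⊆ S
        ind   : Independent Z
        R∩Z   : ∀ y → R y ≡ true → Z y ≡ false
        avoid : ∀ y → R y ≡ true → disj (cone y) I ≡ true → ∀ z → Z z ≡ true → a y z ≡ false

    obstacle-mono : ∀ {R R′ q I} → R′ ⊆ R → Obstacle R q I → Obstacle R′ q I
    obstacle-mono R′⊆R o = record
      { Z = Z ; #Z = #Z ; Z⊆S = Z⊆S ; ind = ind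
      ; R∩Z = λ y h → R∩Z y (R′⊆R y h) ; avoid = λ y h → avoid y (R′⊆R y h) }
      where open Obstacle o

    Insert : ∀ {R q I} (o : Obstacle R q I) y → R y ≡ true → S y ≡ true → disj (cone y) I ≡ true →
      let Z = Obstacle.Z o ⊎ᵐ y in # Z ≡ suc q × Z ⊆ S × Independent Z
    Insert o y Ry Sy dj = #-insert Z (R∩Z y Ry) ⨾ cong suc #Z
      , (λ z h → [ (λ { refl → Sy }) , Z⊆S z ]′ (⊎ᵐ-elim Z z h))
      , λ x z hx hz → ind′ x z (⊎ᵐ-elim Z x hx) (⊎ᵐ-elim Z z hz)
      where
      open Obstacle o
      ind′ : ∀ x z → x ≡ y ⊎ Z x ≡ true → z ≡ y ⊎ Z z ≡ true → a x z ≡ false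
      ind′ x z (inj₁ refl) (inj₁ refl) = irrefl G y
      ind′ x z (inj₁ refl) (inj₂ q) = avoid y Ry dj z q
      ind′ x z (inj₂ p) (inj₁ refl) = sym G x y ⨾ avoid y Ry dj x p
      ind′ x z (inj₂ p) (inj₂ q) = ind x z p q

    obstacle-insert : ∀ {R q I y} → R ⊆ nb S v → R y ≡ true → disj (cone y) I ≡ true → Obstacle R q I → Obstacle (R ∖ y) (suc q) I
    obstacle-insert {R} {y = y} R⊆nb Ry dj o = record
      { Z = Z ⊎ᵐ y ; #Z = proj₁ ins ; Z⊆S = proj₁ (proj₂ ins) ; ind = proj₂ (proj₂ ins)
      ; R∩Z = disjoint
      ; avoid = λ x hx dj′ z hz → avoid′ x hx dj′ z (⊎ᵐ-elim Z z hz) }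
      where
      open Obstacle o
      ins = Insert o y Ry (nb-S S v y (R⊆nb y Ry)) dj
      disjoint : ∀ x → (R ∖ y) x ≡ true → (Z ⊎ᵐ y) x ≡ false
      disjoint x h with x Fin.≟ y
      ... | no _ = R∩Z x h
      avoid′ : ∀ x → (R ∖ y) x ≡ true → disj (cone x) _ ≡ true → ∀ z → z ≡ y ⊎ Z z ≡ true → a x z ≡ false
      avoid′ x hx dj′ z (inj₁ refl) = At.nb-independent Sv tf x y (R⊆nb x (∖-⊆ R x hx)) (R⊆nb y Ry)
      avoid′ x hx dj′ z (inj₂ q) = avoid x (∖-⊆ R x hx) dj′ z q

    -- List `i` holds obstacles of `q - i` vertices; with `q = K`, another `i + 1` vertices would
    -- exceed the independence number.
    FamOK : Mask N → ℕ → Family → Set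
    FamOK R q [] = ⊤
    FamOK R zero (_ ∷ _) = ⊥
    FamOK R (suc q) (l ∷ f) = All (Obstacle R (suc q)) l × FamOK R q f

    famOK-mono : ∀ {R R′} → R′ ⊆ R → ∀ q f → FamOK R q f → FamOK R′ q f
    famOK-mono sub q [] _ = tt
    famOK-mono sub (suc q) (l ∷ f) (p , ps) = All.map (obstacle-mono sub) p , famOK-mono sub q f ps

    avoiding-ok : ∀ {R q y} → R ⊆ nb S v → R y ≡ true → ∀ l → All (Obstacle R q) l → All (Obstacle (R ∖ y) (suc q)) (avoiding (cone y) l)
    avoiding-ok R⊆nb Ry [] [] = []
    avoiding-ok {y = y} R⊆nb Ry (i ∷ l) (o ∷ os) with disj (cone y) i in e
    ... | true = obstacle-insert R⊆nb Ry e o ∷ avoiding-ok R⊆nb Ry l os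
    ... | false = avoiding-ok R⊆nb Ry l os

    shift-ok : ∀ {R y} → R ⊆ nb S v → R y ≡ true → ∀ q f → FamOK R q f → FamOK (R ∖ y) (suc q) (map (avoiding (cone y)) f)
    shift-ok R⊆nb Ry q [] _ = tt
    shift-ok R⊆nb Ry (suc q) (l ∷ f) (p , ps) = avoiding-ok R⊆nb Ry l p , shift-ok R⊆nb Ry q f ps

    restrict-ok : ∀ {R y} → R ⊆ nb S v → R y ≡ true → ∀ q f → FamOK R q f → FamOK (R ∖ y) q (restrict (cone y) f)
    restrict-ok R⊆nb Ry q [] _ = tt
    restrict-ok R⊆nb Ry (suc q) (l ∷ f) (_ , ps) = shift-ok R⊆nb Ry q f ps

    hitsAll-ok : ∀ {R y} → R ⊆ nb S v → R y ≡ true → ∀ l → All (Obstacle R K) l → hitsAll (cone y) l ≡ true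
    hitsAll-ok R⊆nb Ry [] [] = refl
    hitsAll-ok {y = y} R⊆nb Ry (i ∷ l) (o ∷ os) with disj (cone y) i in e
    ... | false = hitsAll-ok R⊆nb Ry l os
    ... | true with Insert o y Ry (nb-S S v y (R⊆nb y Ry)) e
    ... | size , sub , ind = ⊥-elim (1+n≰n (≤-trans (≤-reflexive (≡-sym size)) (αS _ sub ind)))

    hitsFams-ok : ∀ {R y} → R ⊆ nb S v → R y ≡ true → ∀ Fs → All (FamOK R K) Fs → hitsFams (cone y) Fs ≡ true
    hitsFams-ok R⊆nb Ry [] [] = refl
    hitsFams-ok R⊆nb Ry ([] ∷ Fs) (_ ∷ ps) = hitsFams-ok R⊆nb Ry Fs ps
    hitsFams-ok {R} R⊆nb Ry ((l ∷ _) ∷ Fs) (p ∷ ps) = if-true (hitsAll-ok R⊆nb Ry l (headOK K p)) ⨾ hitsFams-ok R⊆nb Ry Fs ps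
      where
      headOK : ∀ q {l f} → FamOK R q (l ∷ f) → All (Obstacle R q) l
      headOK (suc q) (p , _) = p

    record Entry (R : Mask N) (y : Fin N) (s : Cand) : Set where
      constructor entry
      field
        size≡ : size s ≡ size′ y
        row≡  : row s ≡ cone y
        famsOK : All (FamOK (R ∖ y) K) (fams s)

    Covers : Mask N → List Cand → Set
    Covers R ss = ∀ y → R y ≡ true → Any (Entry R y) ss

    d-remove : ∀ {R y} → R y ≡ true → ∀ x → d R x ≡ ⟦ a y x ⟧ + d (R ∖ y) x
    d-remove {R} {y} Ry x = ∑-remove R _ Ry ⨾ cong (_+ d (R ∖ y) x) (⟦a⟧-sym x y)

    -- `d R x` is the number of remaining neighbours joined to `x`. The lower bound on the capacity
    -- justifies `fits`, the upper bound justifies `needMet`.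
    Caps : ℕ → Mask N → List (Fin N) → List ℕ → Set
    Caps slack R = Pointwise (λ x k → d R x ≤ k × k ≤ slack + d R x)

    fits-ok : ∀ {slack R y zs ks} → R y ≡ true → Caps slack R zs ks → fits (map (a y) zs) ks ≡ true
    fits-ok Ry [] = refl
    fits-ok {R = R} {y} {z ∷ _} {zero ∷ _} Ry ((h , _) ∷ hs) with a y z | d-remove {R} {y} Ry z
    ... | false | _ = fits-ok {R = R} {y} Ry hs
    ... | true | e with () ← ≤-trans (≤-reflexive (≡-sym e)) h
    fits-ok {R = R} {y} {z ∷ _} {suc k ∷ _} Ry (_ ∷ hs) with a y z
    ... | false = fits-ok {R = R} {y} Ry hs
    ... | true = fits-ok {R = R} {y} Ry hs

    use-ok : ∀ {slack R y zs ks} → R y ≡ true → Caps slack R zs ks → Caps slack (R ∖ y) zs (use (map (a y) zs) ks)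
    use-ok Ry [] = []
    use-ok {slack} {R} {y} {z ∷ _} {k ∷ _} Ry ((h , h′) ∷ hs) with a y z | d-remove {R} {y} Ry z
    ... | false | e = (≤-trans (≤-reflexive (≡-sym e)) h , ≤-trans h′ (≤-reflexive (cong (slack +_) e))) ∷ use-ok {slack} {R} {y} Ry hs
    ... | true | e = (≤-pred′ (≤-trans (≤-reflexive (≡-sym e)) h) , pred-≤ (≤-trans h′ (≤-reflexive (cong (slack +_) e ⨾ +-suc slack _)))) ∷ use-ok {slack} {R} {y} Ry hs
      where
      ≤-pred′ : ∀ {m k} → suc m ≤ k → m ≤ pred k
      ≤-pred′ (s≤s p) = p
      pred-≤ : ∀ {m k} → k ≤ suc m → pred k ≤ m
      pred-≤ z≤n = z≤n
      pred-≤ (s≤s p) = p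

    anyBit-ok : ∀ {R y j} ss → bit j (cone y) ≡ true → Any (Entry R y) ss → anyBit j ss ≡ true
    anyBit-ok {j = j} (s ∷ ss) b (here en) rewrite Entry.row≡ en | b = refl
    anyBit-ok {j = j} (s ∷ ss) b (there m) with bit j (row s)
    ... | true = refl
    ... | false = anyBit-ok ss b m

    needMet-ok : ∀ {slack R ss} → Covers R ss → ∀ j zs ks → (∀ i y → bit (j + i) (cone y) ≡ bit i (map (a y) zs)) →
      Caps slack R zs ks → needMet slack j ks ss ≡ true
    needMet-ok cov j [] [] h [] = refl
    needMet-ok {slack} {R} {ss} cov j (z ∷ zs) (k ∷ ks) h ((_ , c) ∷ cs) with slack <ᵇ k in e
    ... | false = needMet-ok cov (suc j) zs ks (λ i y → cong (λ m → bit m (cone y)) (≡-sym (+-suc j i)) ⨾ h (suc i) y) cs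
    ... | true = anyBit-ok ss (cong (λ m → bit m (cone y)) (≡-sym (+-identityʳ j)) ⨾ h 0 y ⨾ sym G y z ⨾ nb-a R z y Ry) (cov y (nb-S R z y Ry))
      where
      positive : 0 < # (nb R z)
      positive = ≤-trans (+-cancelˡ-≤ slack 1 (d R z) (≤-trans (≤-reflexive (+-comm slack 1)) (≤-trans (<ᵇ-true e) c)))
        (≤-reflexive (sum-cong λ x → eq x))
        where
        eq : ∀ x → ⟦ R x ⟧ * ⟦ a z x ⟧ ≡ ⟦ nb R z x ⟧ * 1
        eq x with R x | a z x
        ... | true | true = refl
        ... | true | false = refl
        ... | false | _ = refl
      y = proj₁ (nonempty (nb R z) positive)
      Ry = proj₂ (nonempty (nb R z) positive)

    Desc : List Cand → Set
    Desc [] = ⊤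
    Desc (s ∷ ss) = All (λ s′ → size s′ ≤ size s) ss × Desc ss

    refine-All : ∀ {P : ℕ → Set} hi lo t Fs ks ss → All (λ s → P (size s)) ss → All (λ s → P (size s)) (refine hi lo t Fs ks ss)
    refine-All hi lo t Fs ks [] [] = []
    refine-All {P} hi lo t Fs ks (cand p c Gs ∷ ss) (q ∷ qs) with p + hi <ᵇ t | t <ᵇ p + lo | hitsFams c Fs | fits c ks
    ... | true | _ | _ | _ = refine-All {P} hi lo t Fs ks ss qs
    ... | false | true | _ | _ = refine-All {P} hi lo t Fs ks ss qs
    ... | false | false | false | _ = refine-All {P} hi lo t Fs ks ss qs
    ... | false | false | true | false = refine-All {P} hi lo t Fs ks ss qs
    ... | false | false | true | true = q ∷ refine-All {P} hi lo t Fs ks ss qs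

    refine-Desc : ∀ hi lo t Fs ks ss → Desc ss → Desc (refine hi lo t Fs ks ss)
    refine-Desc hi lo t Fs ks [] _ = tt
    refine-Desc hi lo t Fs ks (cand p c Gs ∷ ss) (q , qs) with p + hi <ᵇ t | t <ᵇ p + lo | hitsFams c Fs | fits c ks
    ... | true | _ | _ | _ = refine-Desc hi lo t Fs ks ss qs
    ... | false | true | _ | _ = refine-Desc hi lo t Fs ks ss qs
    ... | false | false | false | _ = refine-Desc hi lo t Fs ks ss qs
    ... | false | false | true | false = refine-Desc hi lo t Fs ks ss qs
    ... | false | false | true | true = refine-All {_≤ p} hi lo t Fs ks ss q , refine-Desc hi lo t Fs ks ss qs

    -- The row of a remaining vertex passes every test. Its old obstacles only lose `y₁` from the
    -- remaining set, and its new ones are those of `y₁` that it misses.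
    refine-ok : ∀ {slack R Fs ks hi lo t y₁ y} → R ⊆ nb S v → (R ∖ y₁) y ≡ true → All (FamOK (R ∖ y₁) K) Fs → Caps slack (R ∖ y₁) xs ks →
      t ≤ size′ y + hi → size′ y + lo ≤ t →
      ∀ ss → Any (Entry R y) ss → Any (Entry (R ∖ y₁) y) (refine hi lo t Fs ks ss)
    refine-ok {R = R} {Fs} {ks} {hi} {lo} {t} {y₁} {y} R⊆nb Ry ok caps t≤ t≥ (cand p c Gs ∷ ss) (here (entry refl refl gs))
      rewrite ≤⇒≮ᵇ t≤ | ≤⇒≮ᵇ t≥ | hitsFams-ok {R ∖ y₁} {y} (λ z h → R⊆nb z (∖-⊆ R z h)) Ry Fs ok | fits-ok {R = R ∖ y₁} {y} Ry caps =
      here (entry refl refl (++⁺ (All.map (λ {f} → famOK-mono sub K f) gs)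
        (map⁺ (All.map (λ {f} → restrict-ok {R ∖ y₁} {y} (λ z h → R⊆nb z (∖-⊆ R z h)) Ry K f) ok))))
      where
      sub : ((R ∖ y₁) ∖ y) ⊆ (R ∖ y)
      sub z h = ∖-intro R z (∖-⊆ R z (∖-⊆ (R ∖ y₁) z h)) (∖-≢ (R ∖ y₁) z h)
    refine-ok {R = R} {Fs} {ks} {hi} {lo} {t} R⊆nb Ry ok caps t≤ t≥ (cand p c Gs ∷ ss) (there m)
      with refine-ok R⊆nb Ry ok caps t≤ t≥ ss m | p + hi <ᵇ t | t <ᵇ p + lo | hitsFams c Fs | fits c ks
    ... | ih | true | _ | _ | _ = ih
    ... | ih | false | true | _ | _ = ih
    ... | ih | false | false | false | _ = ih
    ... | ih | false | false | true | false = ih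
    ... | ih | false | false | true | true = there ih

    -- The order `ys` is part of the conclusion: rows are listed only up to order, and `ys` follows
    -- the order of the candidates.
    Complete : (slack lo r t : ℕ) → List Cand → List ℕ → Mask N → Set
    Complete slack lo r t ss ks R = # R ≡ r → ∑⟨ R ⟩ size′ ≡ t → R ⊆ nb S v → (∀ y → R y ≡ true → lo ≤ size′ y) →
      Covers R ss → Desc ss → Caps slack R xs ks →
      ∃ λ ys → Enum R ys × map cone ys ∈ search slack lo r t ss ks

    search-zero : ∀ slack lo t ss ks R → Complete slack lo zero t ss ks R
    search-zero slack lo t ss ks R #R ΣR R⊆nb big cov desc caps =
      [] , none empty , subst ([] ∈_) (≡-sym (if-true (needMet-ok {slack} {R} none-left 0 xs ks (λ _ _ → refl) caps))) (here refl)
      where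
      empty : ∀ x → R x ≡ false
      empty = #-zero R #R
      none-left : Covers R []
      none-left y Ry with () ← ≡-sym Ry ⨾ empty y

    search-suc : ∀ slack lo r t p c Fs ss ks R →
      Complete slack lo (suc r) t ss ks R → (∀ t′ ss′ ks′ R′ → Complete slack lo r t′ ss′ ks′ R′) →
      Complete slack lo (suc r) t (cand p c Fs ∷ ss) ks R
    search-suc slack lo r t p c Fs ss ks R later next-row #R ΣR R⊆nb big cov desc@(below , desc′) caps =
      subst (λ l → ∃ λ ys → Enum R ys × map cone ys ∈ l)
        (≡-sym (if-false (≤⇒≮ᵇ t≤) ⨾ if-true (needMet-ok cov 0 xs ks (λ _ _ → refl) caps)))
        (choose (dichotomy first))
      where
      entry-size : ∀ {y} ss → All (λ s → size s ≤ p) ss → Any (Entry R y) ss → size′ y ≤ p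
      entry-size (s ∷ ss) (q ∷ qs) (here e) = ≤-trans (≤-reflexive (≡-sym (Entry.size≡ e))) q
      entry-size (s ∷ ss) (q ∷ qs) (there m) = entry-size ss qs m
      size≤p : ∀ y → R y ≡ true → size′ y ≤ p
      size≤p y Ry = entry-size (cand p c Fs ∷ ss) (≤-refl ∷ below) (cov y Ry)
      t≤ : t ≤ p * suc r
      t≤ = ≤-trans (≤-reflexive (≡-sym ΣR)) (≤-trans (∑-mono R size≤p) (≤-reflexive (∑-const R p ⨾ cong (_* p) #R ⨾ *-comm (suc r) p)))
      first : ∀ y → (R y ≡ true × Entry R y (cand p c Fs)) ⊎ (R y ≡ true → Any (Entry R y) ss)
      first y with R y in Ry
      ... | false = inj₂ λ ()
      ... | true with cov y Ry
      ... | here e = inj₁ (refl , e)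
      ... | there m = inj₂ (λ _ → m)
      ks′ = use c ks
      -- The leading candidate stays available, as several neighbours of `v` may have equal rows.
      ss′ = refine (pred r * p) (pred r * lo) (t ∸ p) Fs ks′ (cand p c Fs ∷ ss)
      taken = if t <ᵇ p + r * lo then [] else map (c ∷_) (search slack lo r (t ∸ p) ss′ ks′)
      choose : (∃ λ y → R y ≡ true × Entry R y (cand p c Fs)) ⊎ Covers R ss →
        ∃ λ ys → Enum R ys × map cone ys ∈ taken ++ search slack lo (suc r) t ss ks
      choose (inj₂ rest) with later #R ΣR R⊆nb big rest desc′ caps
      ... | ys , e , m = ys , e , ∈-++⁺ʳ taken m
      choose (inj₁ (y₁ , Ry₁ , entry refl refl ok)) = finish
        (next-row (t ∸ p) ss′ ks′ R′ #R′ ΣR′ (λ z h → R⊆nb z (∖-⊆ R z h)) (λ z h → big z (∖-⊆ R z h)) cov′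
               (refine-Desc (pred r * p) (pred r * lo) (t ∸ p) Fs ks′ (cand p c Fs ∷ ss) desc) caps′)
        where
        R′ = R ∖ y₁
        #R′ : # R′ ≡ r
        #R′ = suc-injective (≡-sym (#-remove R Ry₁) ⨾ #R)
        split : t ≡ size′ y₁ + ∑⟨ R′ ⟩ size′
        split = ≡-sym ΣR ⨾ ∑-remove R size′ Ry₁
        ΣR′ : ∑⟨ R′ ⟩ size′ ≡ t ∸ p
        ΣR′ = ≡-sym (cong (_∸ p) split ⨾ m+n∸m≡n p _)
        caps′ : Caps slack R′ xs ks′
        caps′ = use-ok {slack} {R} {y₁} Ry₁ caps
        others : ∀ {y} → R′ y ≡ true → ∃ λ u → t ∸ p ≡ size′ y + u × u ≤ pred r * p × pred r * lo ≤ u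
        others {y} R′y = ∑⟨ R′ ∖ y ⟩ size′ , ≡-sym ΣR′ ⨾ ∑-remove R′ size′ R′y
          , ≤-trans (∑-mono (R′ ∖ y) (λ z h → size≤p z (∖-⊆ R z (∖-⊆ R′ z h)))) (≤-reflexive (∑-const (R′ ∖ y) p ⨾ cong (_* p) count))
          , ≤-trans (≤-reflexive (≡-sym (∑-const (R′ ∖ y) lo ⨾ cong (_* lo) count))) (∑-mono (R′ ∖ y) (λ z h → big z (∖-⊆ R z (∖-⊆ R′ z h))))
          where
          count : # (R′ ∖ y) ≡ pred r
          count = cong pred (≡-sym (#-remove R′ R′y) ⨾ #R′)
        cov′ : Covers R′ ss′
        cov′ y R′y with others R′y
        ... | u , e , u≤ , u≥ = refine-ok {slack} R⊆nb R′y ok caps′ (≤-trans (≤-reflexive e) (+-monoʳ-≤ (size′ y) u≤))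
              (≤-trans (+-monoʳ-≤ (size′ y) u≥) (≤-reflexive (≡-sym e))) (cand p c Fs ∷ ss) (cov y (∖-⊆ R y R′y))
        enough : p + r * lo ≤ t
        enough = ≤-trans (+-monoʳ-≤ p (≤-trans (≤-reflexive (≡-sym (∑-const R′ lo ⨾ cong (_* lo) #R′)))
          (∑-mono R′ (λ z h → big z (∖-⊆ R z h))))) (≤-reflexive (≡-sym split))
        finish : (∃ λ ys → Enum R′ ys × map cone ys ∈ search slack lo r (t ∸ p) ss′ ks′) →
          ∃ λ ys → Enum R ys × map cone ys ∈ taken ++ search slack lo (suc r) t ss ks
        finish (ys , e , m) = y₁ ∷ ys , next Ry₁ e ,
          ∈-++⁺ˡ (subst (map cone (y₁ ∷ ys) ∈_) (≡-sym (if-false (≤⇒≮ᵇ enough))) (∈-map⁺ (c ∷_) m))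

    search-ok : ∀ slack lo r t ss ks R → Complete slack lo r t ss ks R
    search-ok slack lo zero t ss ks R = search-zero slack lo t ss ks R
    search-ok slack lo (suc r) t [] ks R #R ΣR R⊆nb big cov with nonempty R (≤-trans (s≤s z≤n) (≤-reflexive (≡-sym #R)))
    ... | y , Ry with () ← cov y Ry
    search-ok slack lo (suc r) t (cand p c Fs ∷ ss) ks R =
      search-suc slack lo r t p c Fs ss ks R (search-ok slack lo (suc r) t ss ks R) (search-ok slack lo r)

-- Isomorphic copies and completeness of the search

edge : Tri → ℕ → ℕ → Bool
edge (r ∷ rs) zero (suc j) = bit j r
edge (r ∷ rs) (suc i) zero = bit i r
edge (r ∷ rs) (suc i) (suc j) = edge rs i j
edge _ _ _ = false

weigh : Row → List ℕ → ℕ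
weigh (b ∷ r) (w ∷ ws) = (if b then w else 0) + weigh r ws
weigh _ _ = 0

neighbourSums : Tri → List ℕ → List ℕ
neighbourSums (r ∷ rs) (w ∷ ws) = weigh r ws ∷ zipWith (λ b k → (if b then w else 0) + k) r (neighbourSums rs ws)
neighbourSums _ _ = []

-- Isomorphism invariants of the vertices; they only guide the search for isomorphisms.
keys : Tri → List ℕ
keys H = zipWith (λ k l → k + 100 * l) d₁ (zipWith (λ k l → k + 100 * l) d₂ d₃)
  where
  square : List ℕ → List ℕ
  square = map (λ k → k * k)
  d₁ = degs H
  d₂ = neighbourSums H d₁
  d₃ = neighbourSums H (square (neighbourSums H (square d₂)))

indices : ℕ → ℕ → List ℕ → List ℕ
indices k i [] = []
indices k i (l ∷ ls) = if k ≡ᵇ l then i ∷ indices k (suc i) ls else indices k (suc i) ls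

agrees : Tri → ℕ → List ℕ → Row → Bool
agrees H i [] [] = i <ᵇ length H
agrees H i (z ∷ zs) (b ∷ r) = if i ≡ᵇ z then false else (if edge H i z then (if b then agrees H i zs r else false) else (if b then false else agrees H i zs r))
agrees H i _ _ = false

extensions : Tri → Row → List ℕ → List ℕ → List (List ℕ)
extensions H r zs [] = []
extensions H r zs (i ∷ is) = if agrees H i zs r then (i ∷ zs) ∷ extensions H r zs is else extensions H r zs is

-- Vertices of the catalogue graph are placed from the last to the first, because a row describes
-- adjacency to later vertices only. Images are tried only among vertices with the same key.
labellings : Tri → List ℕ → Tri → List ℕ → List (List ℕ)
labellings H ks (r ∷ rs) (k ∷ ls) = concatMap (λ zs → extensions H r zs (indices k 0 ks)) (labellings H ks rs ls)
labellings H ks (r ∷ rs) [] = []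
labellings H ks [] _ = [] ∷ []

Keyed : Set
Keyed = Tri × List ℕ

withKeys : Tri → Keyed
withKeys H = H , keys H

nonempty? : ∀ {A : Set} → List A → Bool
nonempty? [] = false
nonempty? (_ ∷ _) = true

isomorphic : Keyed → Keyed → Bool
isomorphic (H , ks) (C , ls) =
  if total (λ k → k) ks ≡ᵇ total (λ k → k) ls then
    (if length C ≡ᵇ length H then nonempty? (labellings H ks C ls) else false)
  else false

identified : List Keyed → Keyed → Bool
identified [] H = false
identified (C ∷ Cs) H = if isomorphic H C then true else identified Cs H

allIdentified : List Keyed → List Tri → Bool
allIdentified Cs [] = true
allIdentified Cs (H ∷ Hs) = if identified Cs (withKeys H) then allIdentified Cs Hs else false

catalogue-covers : List Tri → List Tri → Bool
catalogue-covers Cs Hs = allIdentified (map withKeys Cs) Hs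

module Gluing2 {N : ℕ} (G : Graph N) where
  open Counting G
  open Gluing G

  -- Isomorphism with a listed graph is expressed by an enumeration of `S` that reproduces its
  -- adjacency list literally.
  InCatalogue : Mask N → List Tri → Set
  InCatalogue S Cs = ∃ λ xs → Enum S xs × trig xs ∈ Cs

  Enum-All : ∀ {S : Mask N} {xs} → Enum S xs → All (λ x → S x ≡ true) xs
  Enum-All (none _) = []
  Enum-All {S} (next {x} Sx en) = Sx ∷ All.map (λ {y} → ∖-⊆ S y) (Enum-All en)

  mkCands-∈ : ∀ {P : Cand → Set} p F c {l} → P (cand p c (restrict c F ∷ [])) → c ∈ l → Any P (mkCands p F l)
  mkCands-∈ p F c h (here refl) = here h
  mkCands-∈ p F c h (there m) = there (mkCands-∈ p F c h m)

  Any-++⁺ˡ : ∀ {P : Cand → Set} {l m} → Any P l → Any P (l ++ m)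
  Any-++⁺ˡ (here p) = here p
  Any-++⁺ˡ (there p) = there (Any-++⁺ˡ p)

  Any-++⁺ʳ : ∀ {P : Cand → Set} l {m} → Any P m → Any P (l ++ m)
  Any-++⁺ʳ [] p = p
  Any-++⁺ʳ (_ ∷ l) p = there (Any-++⁺ʳ l p)

  candidates-∈ : ∀ {P : Cand → Set} H F lo hi p c → lo ≤ p → p ≤ hi → P (cand p c (restrict c F ∷ [])) → c ∈ indepSets H p →
    Any P (candidates H F lo hi)
  candidates-∈ H F lo zero .zero c l z≤n h m = mkCands-∈ 0 F c h m
  candidates-∈ H F lo (suc hi) p c l u h m with p Data.Nat.≟ suc hi
  ... | yes refl = Any-++⁺ˡ (mkCands-∈ p F c h m)
  ... | no ne = Any-++⁺ʳ (mkCands (suc hi) F (indepSets H (suc hi)))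
        (subst (Any _) (≡-sym (if-true (true⇒ (≤-trans (s≤s l) p<)))) (candidates-∈ H F lo hi p c l (≤-pred p<) h m))
    where
    p< : p < suc hi
    p< = ≤∧≢⇒< u ne
    true⇒ : ∀ {m n} → m < n → (m <ᵇ n) ≡ true
    true⇒ {m} {n} q with m <ᵇ n | <⇒<ᵇ q
    ... | true | _ = refl

  module Complete {S : Mask N} {v : Fin N} (Sv : S v ≡ true) (tf : TriangleFree) {K : ℕ} (αS : α≤ K S)
                  {xs : List (Fin N)} (en : Enum (far S v) xs) where
    open Sound Sv tf αS en

    mkCands-sizes : ∀ p F l → All (λ s → Cand.size s ≤ p) (mkCands p F l)
    mkCands-sizes p F [] = []
    mkCands-sizes p F (c ∷ l) = ≤-refl ∷ mkCands-sizes p F l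

    candidates-sizes : ∀ H F lo hi → All (λ s → Cand.size s ≤ hi) (candidates H F lo hi)
    candidates-sizes H F lo zero = mkCands-sizes 0 F _
    candidates-sizes H F lo (suc hi) = ++⁺ (mkCands-sizes (suc hi) F _) tails
      where
      tails : All (λ s → Cand.size s ≤ suc hi) (if lo <ᵇ suc hi then candidates H F lo hi else [])
      tails with lo <ᵇ suc hi
      ... | true = All.map m≤n⇒m≤1+n (candidates-sizes H F lo hi)
      ... | false = []

    mkCands-Desc : ∀ p F l {m} → All (λ s → Cand.size s ≤ p) m → Desc m → Desc (mkCands p F l ++ m)
    mkCands-Desc p F [] a D = D
    mkCands-Desc p F (c ∷ l) a D = ++⁺ (mkCands-sizes p F l) a , mkCands-Desc p F l a D

    Desc-[] : ∀ l → Desc (l ++ []) → Desc l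
    Desc-[] [] _ = tt
    Desc-[] (s ∷ l) (a , D) = subst (All _) (++-[] l) a , Desc-[] l D
      where
      ++-[] : ∀ (l : List Cand) → l ++ [] ≡ l
      ++-[] [] = refl
      ++-[] (s ∷ l) = cong (s ∷_) (++-[] l)

    candidates-Desc : ∀ H F lo hi → Desc (candidates H F lo hi)
    candidates-Desc H F lo zero = Desc-[] _ (mkCands-Desc 0 F _ [] tt)
    candidates-Desc H F lo (suc hi) with lo <ᵇ suc hi
    ... | true = mkCands-Desc (suc hi) F _ (All.map m≤n⇒m≤1+n (candidates-sizes H F lo hi)) (candidates-Desc H F lo hi)
    ... | false = mkCands-Desc (suc hi) F _ [] tt

    realized-obstacle : ∀ {q I} → Realized (far S v) (λ _ → true) xs q I → Obstacle (nb S v) q I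
    realized-obstacle ρ = record
      { Z = Z ; #Z = #Z ; Z⊆S = λ z h → far-S S v z (Z⊆F z h) ; ind = ind
      ; R∩Z = λ y h → disjoint y h ; avoid = λ y _ → avoid y }
      where
      open Realized ρ
      disjoint : ∀ y → nb S v y ≡ true → Z y ≡ false
      disjoint y h with Z y in e
      ... | false = refl
      ... | true with () ← ≡-sym (nb-a S v y h) ⨾ far-a S v y (Z⊆F y e)

    families-ok : ∀ m q → FamOK (nb S v) q (families (trig xs) m q)
    families-ok zero q = tt
    families-ok (suc m) zero = tt
    families-ok (suc m) (suc q) = All.tabulate (λ {s} h → realized-obstacle
        (indep-sound (λ _ → true) en (suc q) (subst (λ r → s ∈ indep (trig xs) r (suc q)) (replicate-true xs) h)))
      , families-ok m q

    cone-∈ : ∀ y → cone y ∈ indepSets (trig xs) (size′ y)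
    cone-∈ y = subst₂ (λ r p → cone y ∈ indep (trig xs) r p) (≡-sym (replicate-true xs)) (ones-cone en y)
      (indep-complete (a y) (λ _ → true) xs (λ x z h k → tf x y z (sym G x y ⨾ h) k) (λ _ _ → refl))

    trig-attach : ∀ ys → All (λ y → nb S v y ≡ true) ys → trig (ys ++ xs) ≡ attach (map cone ys) (trig xs)
    trig-attach [] [] = refl
    trig-attach (y ∷ ys) (p ∷ ps) = cong₂ _∷_ (map-++ (a y) ys xs ⨾ cong (_++ cone y) (falses ys ps)) (trig-attach ys ps)
      where
      falses : ∀ ys → All (λ y → nb S v y ≡ true) ys → map (a y) ys ≡ replicate (length (map cone ys)) false
      falses [] [] = refl
      falses (z ∷ zs) (q ∷ qs) = cong₂ _∷_ (At.nb-independent Sv tf y z p q) (falses zs qs)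

    trig-build : ∀ ys → All (λ y → nb S v y ≡ true) ys → trig (v ∷ ys ++ xs) ≡ build (trig xs) (map cone ys)
    trig-build ys ps = cong₂ _∷_ (map-++ (a v) ys xs ⨾ cong₂ _++_ (trues ys ps) (falses xs (Enum-All en))) (trig-attach ys ps)
      where
      trues : ∀ ys → All (λ y → nb S v y ≡ true) ys → map (a v) ys ≡ replicate (length (map cone ys)) true
      trues [] [] = refl
      trues (z ∷ zs) (q ∷ qs) = cong₂ _∷_ (nb-a S v z q) (trues zs qs)
      falses : ∀ zs → All (λ y → far S v y ≡ true) zs → map (a v) zs ≡ replicate (length (trig zs)) false
      falses [] [] = refl
      falses (z ∷ zs) (q ∷ qs) = cong₂ _∷_ (far-a S v z q) (falses zs qs)

    -- By `E-split` the number `t` is that of the edges between the neighbours of `v` and the far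
    -- vertices. The degree range becomes a range of row sizes at the neighbours and a range of
    -- capacities at the far vertices.
    glue-complete : ∀ {lo hi t} → (∀ x → S x ≡ true → suc lo ≤ d S x × d S x ≤ suc hi) →
      E S ≡ total (λ k → k) (degs (trig xs)) + 2 * (d S v + t) →
      InCatalogue S (glue (trig xs) K (d S v) lo hi t)
    glue-complete {lo} {hi} {t} range ES with search-ok (hi ∸ lo) lo (d S v) t
        (candidates (trig xs) F lo hi) (map (suc hi ∸_) (degs (trig xs))) (nb S v)
        (≡-sym (At.d≡#nb {S} {v} Sv)) sizes (λ _ h → h) low covers (candidates-Desc (trig xs) F lo hi) caps
      where
      F = families (trig xs) (d S v) K
      size-range : ∀ y → nb S v y ≡ true → lo ≤ size′ y × size′ y ≤ hi
      size-range y h with d S y | At.d-nb Sv tf y h | range y (nb-S S v y h)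
      ... | _ | refl | s≤s l , s≤s u = l , u
      low : ∀ y → nb S v y ≡ true → lo ≤ size′ y
      low y h = proj₁ (size-range y h)
      sizes : ∑⟨ nb S v ⟩ size′ ≡ t
      sizes = +-cancelˡ-≡ (d S v) _ _ (≡-sym Z≡ ⨾ *-cancelˡ-≡ _ _ 2 (+-cancelˡ-≡ (E (far S v)) _ _
          (≡-sym (At.E-split Sv tf) ⨾ ES ⨾ cong (_+ 2 * (d S v + t)) (≡-sym (E-Enum en)))))
        where
        Z≡ : ∑⟨ nb S v ⟩ (d S) ≡ d S v + ∑⟨ nb S v ⟩ size′
        Z≡ = ∑-cong (nb S v) (At.d-nb Sv tf) ⨾ ∑-+ (nb S v) (λ _ → 1) size′ ⨾ cong (_+ ∑⟨ nb S v ⟩ size′) (≡-sym (At.d≡#nb {S} {v} Sv))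
      covers : Covers (nb S v) (candidates (trig xs) F lo hi)
      covers y h = candidates-∈ (trig xs) F lo hi (size′ y) (cone y) (low y h) (proj₂ (size-range y h))
        (entry refl refl (restrict-ok (λ _ k → k) h K F (families-ok (d S v) K) ∷ [])) (cone-∈ y)
      cap : ∀ x → far S v x ≡ true → d (nb S v) x ≤ suc hi ∸ d (far S v) x × suc hi ∸ d (far S v) x ≤ (hi ∸ lo) + d (nb S v) x
      cap x h with d S x | At.d-far Sv tf x h | range x (far-S S v x h)
      ... | _ | refl | l , u = m+n≤o⇒m≤o∸n (d (nb S v) x) u
        , m≤n+o⇒m∸n≤o (suc hi) (d (far S v) x) (≤-trans (s≤s (≤-reflexive (≡-sym (m∸n+n≡m lo≤hi))))
            (≤-trans (≤-reflexive (≡-sym (+-suc (hi ∸ lo) lo))) (≤-trans (+-monoʳ-≤ (hi ∸ lo) l)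
            (≤-reflexive (solve 3 (λ s b f → s :+ (b :+ f) := f :+ (s :+ b)) refl (hi ∸ lo) (d (nb S v) x) (d (far S v) x))))))
        where
        lo≤hi : lo ≤ hi
        lo≤hi = ≤-pred (≤-trans l u)
      caps : Caps (hi ∸ lo) (nb S v) xs (map (suc hi ∸_) (degs (trig xs)))
      caps = subst (λ ks → Caps (hi ∸ lo) (nb S v) xs (map (suc hi ∸_) ks)) (≡-sym (degs-Enum en)) (go xs (Enum-All en))
        where
        go : ∀ zs → All (λ y → far S v y ≡ true) zs → Caps (hi ∸ lo) (nb S v) zs (map (suc hi ∸_) (map (d (far S v)) zs))
        go [] [] = []
        go (z ∷ zs) (p ∷ ps) = cap z p ∷ go zs ps
    ... | ys , en′ , m = v ∷ ys ++ xs , next Sv (Enum-++ parts en′ en)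
        , subst (_∈ glue (trig xs) K (d S v) lo hi t) (≡-sym (trig-build ys (Enum-All en′))) (∈-map⁺ (build (trig xs)) m)
      where
      parts : ∀ x → ⟦ (S ∖ v) x ⟧ ≡ ⟦ nb S v x ⟧ + ⟦ far S v x ⟧
      parts x with x Fin.≟ v
      ... | yes refl rewrite Sv | irrefl G v = refl
      ... | no _ with a v x | S x
      ... | true | true = refl
      ... | true | false = refl
      ... | false | true = refl
      ... | false | false = refl

  -- The vertex `x₀` is a default for indices beyond the end; the lemmas below bound the index by
  -- the length.
  nth : Fin N → List (Fin N) → ℕ → Fin N
  nth x₀ [] i = x₀
  nth x₀ (x ∷ xs) zero = x
  nth x₀ (x ∷ xs) (suc i) = nth x₀ xs i

  bit-map : ∀ x₀ (b : Fin N → Bool) xs {i} → i < length xs → bit i (map b xs) ≡ b (nth x₀ xs i)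
  bit-map x₀ b (x ∷ xs) {zero} _ = refl
  bit-map x₀ b (x ∷ xs) {suc i} (s≤s p) = bit-map x₀ b xs p

  edge-trig : ∀ x₀ xs {i j} → i < length xs → j < length xs → edge (trig xs) i j ≡ a (nth x₀ xs i) (nth x₀ xs j)
  edge-trig x₀ (x ∷ xs) {zero} {zero} _ _ = ≡-sym (irrefl G x)
  edge-trig x₀ (x ∷ xs) {zero} {suc j} _ (s≤s q) = bit-map x₀ (a x) xs q
  edge-trig x₀ (x ∷ xs) {suc i} {zero} (s≤s p) _ = bit-map x₀ (a x) xs p ⨾ sym G x _
  edge-trig x₀ (x ∷ xs) {suc i} {suc j} (s≤s p) (s≤s q) = edge-trig x₀ xs p q

  nth-∈ : ∀ x₀ {S : Mask N} {xs i} → Enum S xs → i < length xs → S (nth x₀ xs i) ≡ true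
  nth-∈ x₀ {i = zero} (next Sx en) _ = Sx
  nth-∈ x₀ {S} {i = suc i} (next Sx en) (s≤s p) = ∖-⊆ S _ (nth-∈ x₀ en p)

  nth-injective : ∀ x₀ {S : Mask N} {xs i j} → Enum S xs → i < length xs → j < length xs → i ≢ j → nth x₀ xs i ≢ nth x₀ xs j
  nth-injective x₀ {i = zero} {zero} en p q ne = ⊥-elim (ne refl)
  nth-injective x₀ {S} {i = zero} {suc j} (next Sx en) p (s≤s q) ne e = ∖-≢ S _ (nth-∈ x₀ en q) (≡-sym e)
  nth-injective x₀ {S} {i = suc i} {zero} (next Sx en) (s≤s p) q ne e = ∖-≢ S _ (nth-∈ x₀ en p) e
  nth-injective x₀ {i = suc i} {suc j} (next Sx en) (s≤s p) (s≤s q) ne = nth-injective x₀ en p q (λ e → ne (cong suc e))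

  Distinct : List (Fin N) → Set
  Distinct [] = ⊤
  Distinct (x ∷ xs) = All (x ≢_) xs × Distinct xs

  Enum-Distinct : ∀ {S : Mask N} xs → All (λ x → S x ≡ true) xs → Distinct xs → # S ≡ length xs → Enum S xs
  Enum-Distinct {S} [] [] _ e = none (#-zero S e)
  Enum-Distinct {S} (x ∷ xs) (p ∷ ps) (q , qs) e = next p (Enum-Distinct xs (remaining xs ps q) qs (suc-injective (≡-sym (#-remove S p) ⨾ e)))
    where
    remaining : ∀ ys → All (λ y → S y ≡ true) ys → All (x ≢_) ys → All (λ y → (S ∖ x) y ≡ true) ys
    remaining [] [] [] = []
    remaining (y ∷ ys) (p ∷ ps) (q ∷ qs) = ∖-intro S y p (λ e → q (≡-sym e)) ∷ remaining ys ps qs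

  ∈-concatMap : ∀ {A B : Set} (f : A → List B) xs {y} → y ∈ concatMap f xs → ∃ λ x → x ∈ xs × y ∈ f x
  ∈-concatMap f (x ∷ xs) m with ∈-++⁻ (f x) m
  ... | inj₁ p = x , here refl , p
  ... | inj₂ p with ∈-concatMap f xs p
  ... | y , q , r = y , there q , r

  module Relabel (x₀ : Fin N) {S : Mask N} {xs} (en : Enum S xs) where

    agrees-sound : ∀ i zs r → All (_< length xs) zs → agrees (trig xs) i zs r ≡ true →
      i < length xs × map (a (nth x₀ xs i)) (map (nth x₀ xs) zs) ≡ r × All (nth x₀ xs i ≢_) (map (nth x₀ xs) zs)
    agrees-sound i [] [] [] h = subst (i <_) (length-trig xs) (<ᵇ-true h) , refl , []
    agrees-sound i (z ∷ zs) (b ∷ r) (z< ∷ zs<) h with i ≡ᵇ z in e | edge (trig xs) i z in eq | b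
    ... | false | true | true = add (agrees-sound i zs r zs< h)
      where
      add : _ → _
      add (i< , same , diff) = i< , cong₂ _∷_ (≡-sym (edge-trig x₀ xs i< z<) ⨾ eq) same
        , nth-injective x₀ en i< z< (λ { refl → distinct e }) ∷ diff
        where
        distinct : (i ≡ᵇ i) ≡ false → ⊥
        distinct h = subst T h (≡⇒≡ᵇ i i refl)
    ... | false | false | false = add (agrees-sound i zs r zs< h)
      where
      add : _ → _
      add (i< , same , diff) = i< , cong₂ _∷_ (≡-sym (edge-trig x₀ xs i< z<) ⨾ eq) same
        , nth-injective x₀ en i< z< (λ { refl → distinct e }) ∷ diff
        where
        distinct : (i ≡ᵇ i) ≡ false → ⊥
        distinct h = subst T h (≡⇒≡ᵇ i i refl)

    extensions-sound : ∀ r zs is {ws} → ws ∈ extensions (trig xs) r zs is → ∃ λ i → ws ≡ i ∷ zs × agrees (trig xs) i zs r ≡ true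
    extensions-sound r zs (i ∷ is) m with agrees (trig xs) i zs r in e
    extensions-sound r zs (i ∷ is) (here refl) | true = i , refl , e
    extensions-sound r zs (i ∷ is) (there m) | true = extensions-sound r zs is m
    extensions-sound r zs (i ∷ is) m | false = extensions-sound r zs is m

    labellings-sound : ∀ ks C ls {ws} → ws ∈ labellings (trig xs) ks C ls →
      All (_< length xs) ws × trig (map (nth x₀ xs) ws) ≡ C × Distinct (map (nth x₀ xs) ws) × length ws ≡ length C
    labellings-sound ks [] ls (here refl) = [] , refl , tt , refl
    labellings-sound ks (r ∷ rs) (k ∷ ls) m with ∈-concatMap (λ zs → extensions (trig xs) r zs (indices k 0 ks)) (labellings (trig xs) ks rs ls) m
    ... | zs , m₁ , m₂ with extensions-sound r zs (indices k 0 ks) m₂ | labellings-sound ks rs ls m₁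
    ... | i , refl , h | zs< , same , diff , len with agrees-sound i zs r zs< h
    ... | i< , same′ , diff′ = i< ∷ zs< , cong₂ _∷_ same′ same , (diff′ , diff) , cong suc len

    isomorphic-sound : ∀ ks C ls → isomorphic (trig xs , ks) (C , ls) ≡ true → ∃ λ ys → Enum S ys × trig ys ≡ C
    isomorphic-sound ks C ls h with total (λ k → k) ks ≡ᵇ total (λ k → k) ls | length C ≡ᵇ length (trig xs) in len
    ... | true | true with labellings (trig xs) ks C ls | labellings-sound ks C ls
    ... | ws ∷ _ | sound with sound (here refl)
    ... | ws< , same , diff , lenw = map (nth x₀ xs) ws
        , Enum-Distinct _ (members ws ws<) diff (Enum-length en ⨾ ≡-sym (length-map _ ws ⨾ lenw ⨾ ≡ᵇ⇒≡ _ _ (subst T (≡-sym len) tt) ⨾ length-trig xs))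
        , same
      where
      members : ∀ ws → All (_< length xs) ws → All (λ x → S x ≡ true) (map (nth x₀ xs) ws)
      members [] [] = []
      members (w ∷ ws) (p ∷ ps) = nth-∈ x₀ en p ∷ members ws ps

    identified-sound : ∀ ks Cs → identified (map withKeys Cs) (trig xs , ks) ≡ true → InCatalogue S Cs
    identified-sound ks (C ∷ Cs) h with isomorphic (trig xs , ks) (withKeys C) in e
    ... | true with isomorphic-sound ks C (keys C) e
    ... | ys , en′ , refl = ys , en′ , here refl
    identified-sound ks (C ∷ Cs) h | false with identified-sound ks Cs h
    ... | ys , en′ , m = ys , en′ , there m

  relabel : Fin N → ∀ {S : Mask N} Cs Hs → catalogue-covers Cs Hs ≡ true → InCatalogue S Hs → InCatalogue S Cs
  relabel x₀ Cs (H ∷ Hs) h (xs , en , m) with identified (map withKeys Cs) (withKeys H) in e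
  relabel x₀ Cs (.(trig xs) ∷ Hs) h (xs , en , here refl) | true = Relabel.identified-sound x₀ en (keys (trig xs)) Cs e
  relabel x₀ Cs (H ∷ Hs) h (xs , en , there m) | true = relabel x₀ Cs Hs h (xs , en , m)

-- Bounds on the number of edges

open Counting
open Gluing
open Gluing2

-- `nothing` plays the role of an infinite minimum: no such graph exists.
AtLeast : Maybe ℕ → ℕ → Set
AtLeast (just m) e = m ≤ e
AtLeast nothing e = ⊥

Bound : ℕ → ℕ → Maybe ℕ → Set
Bound k n w = ∀ {N} (G : Graph N) → TriangleFree G → ∀ S → α≤ G k S → # S ≡ n → AtLeast w (E G S)

lookupM : List (Maybe ℕ) → ℕ → Maybe ℕ
lookupM [] n = nothing
lookupM (w ∷ ws) zero = w
lookupM (w ∷ ws) (suc n) = lookupM ws n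

lookup-beyond : ∀ ws i → length ws ≤ i → lookupM ws i ≡ nothing
lookup-beyond [] i _ = refl
lookup-beyond (w ∷ ws) (suc i) (s≤s h) = lookup-beyond ws i h

-- Past its end the list yields `nothing`, so a table of length `l` for `k` proves R(3, k + 1) ≤
-- `l`.
record Table (k : ℕ) (ws : List (Maybe ℕ)) : Set where
  constructor mkTable
  field
    at : ∀ n → Bound k n (lookupM ws n)
open Table

Classified : ℕ → ℕ → ℕ → List Tri → Set
Classified k n m C = ∀ {N} (G : Graph N) → TriangleFree G → ∀ S → α≤ G k S → # S ≡ n → E G S < m → InCatalogue G S C

allUpTo : ℕ → (ℕ → Bool) → Bool
allUpTo zero p = p zero
allUpTo (suc n) p = if p (suc n) then allUpTo n p else false

allUpTo-sound : ∀ n p {d} → allUpTo n p ≡ true → d ≤ n → p d ≡ true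
allUpTo-sound zero p h z≤n = h
allUpTo-sound (suc n) p {d} h d≤ with p (suc n) in e | d Data.Nat.≟ suc n
... | true | yes refl = e
... | true | no ne = allUpTo-sound n p h (≤-pred (≤∧≢⇒< d≤ ne))

-- A source offers an alternative at a vertex of degree `deg`: either the far graph satisfies E ≥
-- `bound`, which may be used in the line inequality, or it is listed in `graphs` and can be
-- extended by gluing.
record Source (k n : ℕ) : Set where
  constructor source
  field
    {bound}    : ℕ
    deg        : ℕ
    {graphs}   : List Tri
    classified : Classified k (n ∸ suc deg) bound graphs
open Source

override : ∀ {k n} → List (Source k n) → ℕ → ℕ → ℕ
override [] e m = m
override (s ∷ ss) e m = if e ≡ᵇ deg s then bound s else override ss e m

lineAt : Maybe ℕ → (ℕ → ℕ) → ℕ → ℕ → ℕ → Bool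
lineAt nothing f A B e = true
lineAt (just m) f A B e = (B + A * e) ≤ᵇ (2 * (e * e) + f m)

-- The line B + A d lies below 2 d² + E (far S v) for every possible degree d of a vertex v for which
-- far S v is not covered by one of the sources X.
lineBelow : ∀ {k n} → List (Maybe ℕ) → List (Source k n) → ℕ → ℕ → Bool
lineBelow {k} {n} prev X A B = allUpTo (suc k) (λ e → lineAt (lookupM prev (n ∸ suc e)) (override X e) A B e)

contradicts : ℕ → ℕ → ℕ → ℕ → Bool
contradicts n A B e = if A ≤ᵇ n then (n * e) <ᵇ (n * B + A * e) else false

values : ℕ → ℕ → List ℕ
values h zero = []
values h (suc c) = (h + h) ∷ values (suc h) c

-- By `E-split`, half of `D` minus the far part is the degree sum of the `e` neighbours; subtracting
-- their `e` edges to the centre leaves the number of ones in the rows.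
glueAll : ℕ → ℕ → ℕ → ℕ → ℕ → List Tri → List Tri
glueAll D K e lo hi = concatMap (λ H → glue H K e lo hi ((D ∸ total (λ k → k) (degs H)) / 2 ∸ e))

gluedSources : ∀ {k n} → List ℕ → ℕ → List (Source k n) → List Tri
gluedSources {k} Ds lo X = concatMap (λ D → concatMap (λ s → glueAll D (suc k) (deg s) lo k (graphs s)) X) Ds

excluded : Maybe ℕ → Bool
excluded nothing = true
excluded (just _) = false

-- A vertex of degree at most `lo` would leave a far graph of an order already excluded.
degreesAbove : ℕ → List (Maybe ℕ) → ℕ → Bool
degreesAbove n prev lo = allUpTo lo (λ e → excluded (lookupM prev (n ∸ suc e)))

concatMap-∈ : ∀ {A B : Set} (f : A → List B) {x y} {xs} → x ∈ xs → y ∈ f x → y ∈ concatMap f xs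
concatMap-∈ f (here refl) m = ∈-++⁺ˡ m
concatMap-∈ f {xs = z ∷ _} (there p) m = ∈-++⁺ʳ (f z) (concatMap-∈ f p m)

in-concatMap : ∀ {N} (G : Graph N) {S} {A : Set} (f : A → List Tri) {x xs} → x ∈ xs → InCatalogue G S (f x) → InCatalogue G S (concatMap f xs)
in-concatMap G f p (ys , en , m) = ys , en , concatMap-∈ f p m

≤ᵇ-true : ∀ {m n} → (m ≤ᵇ n) ≡ true → m ≤ n
≤ᵇ-true {m} {n} h = ≤ᵇ⇒≤ m n (subst T (≡-sym h) tt)

-- For `A ≤ n` the inequality reads n B ≤ (n - A) E, whose right side grows with E; if it fails at
-- `e`, it fails at all smaller values.
contradicts-sound : ∀ n A B {e E} → contradicts n A B e ≡ true → E ≤ e → n * B + A * E ≤ n * E → ⊥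
contradicts-sound n A B {e} {E} h E≤e le with A ≤ᵇ n in A≤n
... | true with m≤n⇒∃[o]m+o≡n (≤ᵇ-true {A} A≤n)
... | p , refl = <⇒≱ (<ᵇ-true h) (begin
    (A + p) * B + A * e ≤⟨ +-monoˡ-≤ (A * e) (+-cancelʳ-≤ (A * E) _ _ (≤-trans le (≤-reflexive (split E)))) ⟩
    p * E + A * e ≤⟨ +-monoˡ-≤ (A * e) (*-monoʳ-≤ p E≤e) ⟩
    p * e + A * e ≡⟨ ≡-sym (split e) ⟩
    (A + p) * e ∎)
  where
  open ≤-Reasoning
  split : ∀ e → (A + p) * e ≡ p * e + A * e
  split = solve 3 (λ A p e → (A :+ p) :* e := p :* e :+ A :* e) refl A p

values-∈ : ∀ h c e → h ≤ e → e < h + c → e + e ∈ values h c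
values-∈ h zero e h≤ e< = ⊥-elim (<⇒≱ e< (≤-trans (≤-reflexive (+-identityʳ h)) h≤))
values-∈ h (suc c) e h≤ e< with h Data.Nat.≟ e
... | yes refl = here refl
... | no ne = there (values-∈ (suc h) c e (≤∧≢⇒< h≤ ne) (≤-trans e< (≤-reflexive (+-suc h c))))

half-≤ : ∀ {a b} → a + a ≤ b + b → a ≤ b
half-≤ {a} {b} h = ≮⇒≥ (λ b<a → <⇒≱ (+-mono-< b<a b<a) h)

halve : ∀ {D e z c s} → D ≡ e + 2 * z → z ≡ c + s → D ≡ e + 2 * (c + ((D ∸ e) / 2 ∸ c))
halve {e = e} {c = c} {s = s} refl refl = cong (λ z → e + 2 * (c + z)) (≡-sym
  (cong (λ z → z / 2 ∸ c) (m+n∸m≡n e (2 * (c + s)) ⨾ *-comm 2 (c + s)) ⨾ cong (_∸ c) (m*n/n≡m (c + s) 2) ⨾ m+n∸m≡n c s))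

half-< : ∀ a b → a + a < b + b → a < b
half-< a b lt = ≰⇒> (λ b≤a → <⇒≱ lt (+-mono-≤ b≤a b≤a))

module Step {k : ℕ} {prev : List (Maybe ℕ)} (table : Table k prev) where

  module _ {N} (G : Graph N) (tf : TriangleFree G) (S : Mask N) (αS : α≤ G (suc k) S) {n : ℕ} (#S : # S ≡ n) where

    d≤ : ∀ v → S v ≡ true → d G S v ≤ suc k
    d≤ v Sv = At.d≤α G {S} {v} Sv tf αS

    #far : ∀ v → S v ≡ true → # (far G S v) ≡ n ∸ suc (d G S v)
    #far v Sv = ≡-sym (cong (_∸ suc (d G S v)) (≡-sym #S ⨾ At.#-split G {S} {v} Sv) ⨾ m+n∸m≡n (d G S v) _)

    far-bound : ∀ v → S v ≡ true → AtLeast (lookupM prev (n ∸ suc (d G S v))) (E G (far G S v))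
    far-bound v Sv = at table _ G tf (far G S v) (At.α-far G {S} {v} Sv αS) (#far v Sv)

    Found : List (Source k n) → Set
    Found X = ∃ λ v → S v ≡ true × ∃ λ s → s ∈ X × d G S v ≡ deg s × E G (far G S v) < bound s

    override-bound : ∀ X v → S v ≡ true → ∀ m → m ≤ E G (far G S v) → override X (d G S v) m ≤ E G (far G S v) ⊎ Found X
    override-bound [] v Sv m h = inj₁ h
    override-bound (s ∷ X) v Sv m h with d G S v ≡ᵇ deg s in e
    ... | false = [ inj₁ , (λ { (u , Su , t , t∈ , r) → inj₂ (u , Su , t , there t∈ , r) }) ]′ (override-bound X v Sv m h)
    ... | true with bound s ≤? E G (far G S v)
    ... | yes p = inj₁ p
    ... | no np = inj₂ (v , Sv , s , here refl , ≡ᵇ⇒≡ _ _ (subst T (≡-sym e) tt) , ≰⇒> np)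

    line : ∀ X A B → lineBelow {k} {n} prev X A B ≡ true → Found X ⊎ (n * B + A * E G S ≤ n * E G S)
    line X A B h with dichotomy below
      where
      below : ∀ v → Found X ⊎ (S v ≡ true → B + A * d G S v ≤ 2 * (d G S v * d G S v) + E G (far G S v))
      below v with S v in Sv
      ... | false = inj₂ λ ()
      ... | true with lookupM prev (n ∸ suc (d G S v)) | far-bound v Sv | allUpTo-sound (suc k) _ {d G S v} h (d≤ v Sv)
      ... | just m | b | l with override-bound X v Sv m b
      ... | inj₂ f = inj₁ f
      ... | inj₁ o = inj₂ λ _ → ≤-trans (≤ᵇ-true l) (+-monoʳ-≤ (2 * (d G S v * d G S v)) o)
    ... | inj₁ (_ , f) = inj₁ f
    ... | inj₂ f = inj₂ (subst (λ j → j * B + A * E G S ≤ j * E G S) #S (tangent G tf S A B f))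

    deg-range : ∀ {lo} → degreesAbove n prev lo ≡ true → ∀ v → S v ≡ true → suc lo ≤ d G S v × d G S v ≤ suc k
    deg-range {lo} h v Sv = ≰⇒> (λ le → excl _ (far-bound v Sv) (allUpTo-sound lo (λ e → excluded (lookupM prev (n ∸ suc e))) h le)) , d≤ v Sv
      where
      excl : ∀ w {e} → AtLeast w e → excluded w ≡ true → ⊥
      excl (just _) _ ()

    half-excess : ∀ v → S v ≡ true → ∀ {xs} → Enum (far G S v) xs →
      E G S ≡ total (λ k → k) (degs (trig G xs)) + 2 * (d G S v + ((E G S ∸ total (λ k → k) (degs (trig G xs))) / 2 ∸ d G S v))
    half-excess v Sv {xs} en = halve {E G S} {total (λ k → k) (degs (trig G xs))} {∑⟨ nb G S v ⟩ (d G S)} {d G S v} {∑⟨ nb G S v ⟩ (d G (far G S v))} (At.E-split G {S} {v} Sv tf ⨾ cong (_+ 2 * ∑⟨ nb G S v ⟩ (d G S)) (E-Enum G en))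
      (∑-cong (nb G S v) (At.d-nb G {S} {v} Sv tf) ⨾ ∑-+ (nb G S v) (λ _ → 1) (d G (far G S v)) ⨾
        cong (_+ ∑⟨ nb G S v ⟩ (d G (far G S v))) (≡-sym (At.d≡#nb G {S} {v} Sv)))

    glued : ∀ {C lo hi} v → S v ≡ true → InCatalogue G (far G S v) C →
      (∀ x → S x ≡ true → suc lo ≤ d G S x × d G S x ≤ suc hi) →
      InCatalogue G S (glueAll (E G S) (suc k) (d G S v) lo hi C)
    glued {C} {lo} {hi} v Sv (xs , en , m) range = in-concatMap G _ m
      (Complete.glue-complete G {S} {v} Sv tf {suc k} αS {xs} en {lo} {hi}
        {(E G S ∸ total (λ k → k) (degs (trig G xs))) / 2 ∸ d G S v} range (half-excess v Sv en))

  -- All values up to `h + h` are contradicted, and the next even one is `suc h + suc h`.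
  byLine : ∀ {n} A B h → lineBelow {k} {n} prev [] A B ≡ true → contradicts n A B (h + h) ≡ true → Bound (suc k) n (just (suc h + suc h))
  byLine A B h below contra G tf S αS #S with line G tf S αS #S [] A B below
  ... | inj₁ (_ , _ , _ , () , _)
  ... | inj₂ le with E-even G S
  ... | e , E≡ with suc h ≤? e
  ... | yes p = ≤-trans (+-mono-≤ p p) (≤-reflexive (≡-sym E≡))
  ... | no np = ⊥-elim (contradicts-sound _ A B contra (≤-trans (≤-reflexive E≡) (+-mono-≤ e≤h e≤h)) le)
    where
    e≤h : e ≤ h
    e≤h = ≤-pred (≰⇒> np)

  -- Neighbourhoods are independent, so degrees are at most `suc k` and E is at most `n * suc k`.
  impossible : ∀ {n m} → n * suc k < m → Bound (suc k) n (just m) → Bound (suc k) n nothing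
  impossible {n} n< b G tf S αS #S = <⇒≱ n< (≤-trans (b G tf S αS #S)
    (≤-trans (∑-mono S (d≤ G tf S αS #S)) (≤-reflexive (∑-const S (suc k) ⨾ cong (_* suc k) #S))))

  -- This is the recursion R(3, k + 2) ≤ R(3, k + 1) + k + 2: a vertex of degree at most `suc k`
  -- leaves a far graph beyond the end of the previous table.
  tooLarge : ∀ n → suc k + length prev < n → Bound (suc k) n nothing
  tooLarge n n> G tf S αS #S with nonempty S (≤-trans (s≤s z≤n) (≤-trans n> (≤-reflexive (≡-sym #S))))
  ... | v , Sv = subst (λ w → AtLeast w (E G (far G S v))) (lookup-beyond prev _ small) (far-bound G tf S αS #S v Sv)
    where
    small : length prev ≤ n ∸ suc (d G S v)
    small = m+n≤o⇒m≤o∸n (length prev) (≤-trans (≤-reflexive (+-comm (length prev) (suc (d G S v))))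
      (≤-trans (+-monoˡ-≤ (length prev) (s≤s (d≤ G tf S αS #S v Sv))) n>))

  -- Only the `c` even values from `h + h` on are open. If no source applied, the line with the
  -- raised bounds would refute them all; hence some far graph is listed and `S` is obtained from it
  -- by gluing.
  classify : ∀ {n} lo h c → Bound (suc k) n (just (h + h)) → (X : List (Source k n)) (C : List Tri) → ∀ A B →
    degreesAbove n prev lo ≡ true → lineBelow prev X A B ≡ true → contradicts n A B (pred (h + c) + pred (h + c)) ≡ true →
    catalogue-covers C (gluedSources (values h c) lo X) ≡ true →
    Classified (suc k) n ((h + c) + (h + c)) C
  classify {n} lo h c b X C A B low below contra covers G tf S αS #S E< with E-even G S
  ... | e , E≡ with line G tf S αS #S X A B below
  ... | inj₂ le = ⊥-elim (contradicts-sound n A B contra (≤-trans (≤-reflexive E≡) (+-mono-≤ e≤ e≤)) le)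
    where
    e≤ : e ≤ pred (h + c)
    e≤ = <⇒≤pred (half-< e (h + c) (≤-trans (≤-reflexive (cong suc (≡-sym E≡))) E<))
  ... | inj₁ (v , Sv , s , s∈ , dv , small) = relabel G v C _ covers
    (in-concatMap G (λ D → concatMap (λ s → glueAll D (suc k) (deg s) lo k (graphs s)) X) value
      (in-concatMap G (λ s → glueAll (E G S) (suc k) (deg s) lo k (graphs s)) s∈
        (subst (λ i → InCatalogue G S (glueAll (E G S) (suc k) i lo k (graphs s))) dv
          (glued G tf S αS #S v Sv (classified s G tf (far G S v) (At.α-far G {S} {v} Sv αS)
           (#far G tf S αS #S v Sv ⨾ cong (λ i → n ∸ suc i) dv) small) (deg-range G tf S αS #S low)))))
    where
    value : E G S ∈ values h c
    value = subst (_∈ values h c) (≡-sym E≡) (values-∈ h c e (half-≤ (≤-trans (b G tf S αS #S) (≤-reflexive E≡)))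
      (≰⇒> λ le → <⇒≱ E< (≤-trans (+-mono-≤ le le) (≤-reflexive (≡-sym E≡)))))

data Rows (k : ℕ) : ℕ → List (Maybe ℕ) → Set where
  end   : ∀ {n} → (∀ i → n ≤ i → Bound k i nothing) → Rows k n []
  _∷_   : ∀ {n w ws} → Bound k n w → Rows k (suc n) ws → Rows k n (w ∷ ws)

infixr 5 _∷_

zeros : ∀ {k n ws} j → Rows k (j + n) ws → Rows k n (replicate j (just 0) ++ ws)
zeros zero R = R
zeros {k} {n} {ws} (suc j) R = (λ _ _ _ _ _ → z≤n) ∷ zeros j (subst (λ i → Rows k i ws) (≡-sym (+-suc j n)) R)

rows-table : ∀ {k ws} → Rows k 0 ws → Table k ws
rows-table {k} R = mkTable (go 0 R)
  where
  go : ∀ {ws} i → Rows k i ws → ∀ j → Bound k (i + j) (lookupM ws j)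
  go i (end f) j = f (i + j) (m≤m+n i j)
  go i (b ∷ R) zero = subst (λ n → Bound k n _) (≡-sym (+-identityʳ i)) b
  go {w ∷ ws} i (b ∷ R) (suc j) = subst (λ n → Bound k n (lookupM ws j)) (≡-sym (+-suc i j)) (go (suc i) R j)

no-graph : ∀ {k n m} → Classified k n m [] → Bound k n (just m)
no-graph {m = m} cl G tf S αS #S with m ≤? E G S
... | yes p = p
... | no np with cl G tf S αS #S (≰⇒> np)
... | _ , _ , ()

table₀ : Table 0 (just 0 ∷ [])
table₀ = rows-table ((λ _ _ _ _ _ → z≤n) ∷ end none-larger)
  where
  none-larger : ∀ i → 1 ≤ i → Bound 0 i nothing
  none-larger i i≥ G tf S αS #S with nonempty S (≤-trans i≥ (≤-reflexive (≡-sym #S)))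
  ... | v , Sv = <⇒≱ (s≤s z≤n) (≤-trans (≤-reflexive (≡-sym (∑-single v (λ _ → 1)))) (αS (_== v) inS ind))
    where
    inS : ∀ x → (x == v) ≡ true → S x ≡ true
    inS x h with refl ← ==⇒≡ {x = x} {v} h = Sv
    ind : Independent G (_== v)
    ind x y h h′ with refl ← ==⇒≡ {x = x} {v} h | refl ← ==⇒≡ {x = y} {v} h′ = irrefl G x

-- Extremal graphs and Ramsey numbers

orAbove : ∀ {k n} → Bound k n nothing → (∀ i → suc n ≤ i → Bound k i nothing) → ∀ i → n ≤ i → Bound k i nothing
orAbove {k} {n} b f i n≤i with n Data.Nat.≟ i
... | yes refl = b
... | no ne = f i (≤∧≢⇒< n≤i ne)

bits : ℕ → ℕ → Row
bits zero n = []
bits (suc k) n = (n % 2 ≡ᵇ 1) ∷ bits k (n / 2)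

-- Rows as binary numbers, the least significant bit for the next vertex.
decode : List ℕ → Tri
decode [] = []
decode (n ∷ ns) = bits (length ns) n ∷ decode ns

classified-0-0 : Classified 0 0 2 ([] ∷ [])
classified-0-0 G tf S αS #S _ = [] , none (#-zero S #S) , here refl

classified-1-1 : Classified 1 1 2 (([] ∷ []) ∷ [])
classified-1-1 G tf S αS #S _ with nonempty S (≤-reflexive (≡-sym #S))
... | v , Sv = v ∷ [] , next Sv (none (#-zero (S ∖ v) (suc-injective (≡-sym (#-remove S Sv) ⨾ #S)))) , here refl

-- A line of slope `A` and intercept `B` yields E ≥ n B / (n - A), rounded up to an even number. The
-- orders in the initial block have the trivial bound 0.
table₁ : Table 1 (replicate 2 (just 0) ++ just 2 ∷ [])
table₁ = rows-table (zeros 2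
  ( byLine 0 2 0 refl refl
  ∷ end tooLarge))
  where open Step table₀

table₂ : Table 2 (replicate 3 (just 0) ++ just 2 ∷ just 4 ∷ just 10 ∷ [])
table₂ = rows-table (zeros 3
  ( byLine 0 2 0 refl refl
  ∷ byLine 0 4 1 refl refl
  ∷ byLine 0 10 4 refl refl
  ∷ end tooLarge))
  where open Step table₁

table₃ : Table 3 (replicate 4 (just 0) ++ just 2 ∷ just 4 ∷ just 6 ∷ just 12 ∷ just 20 ∷ [])
table₃ = rows-table (zeros 4
  ( byLine 0 2 0 refl refl
  ∷ byLine 0 4 1 refl refl
  ∷ byLine 0 6 2 refl refl
  ∷ byLine 0 12 5 refl refl
  ∷ byLine 1 16 9 refl refl
  ∷ end (orAbove (impossible {n = 9} (≤ᵇ⇒≤ _ _ tt) (byLine 0 28 13 refl refl)) tooLarge)))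
  where open Step table₂

table₄ : Table 4 (replicate 5 (just 0) ++ just 2 ∷ just 4 ∷ just 6 ∷ just 8 ∷ just 14 ∷ just 20 ∷ just 30 ∷ just 40 ∷ just 52 ∷ [])
table₄ = rows-table (zeros 5
  ( byLine 0 2 0 refl refl
  ∷ byLine 0 4 1 refl refl
  ∷ byLine 0 6 2 refl refl
  ∷ byLine 0 8 3 refl refl
  ∷ byLine 0 14 6 refl refl
  ∷ byLine 0 20 9 refl refl
  ∷ byLine 1 26 14 refl refl
  ∷ byLine 1 35 19 refl refl
  ∷ byLine 0 52 25 refl refl
  ∷ end tooLarge))
  where open Step table₃

graphs-1-2 : List Tri
graphs-1-2 = map decode
  ( (1 ∷ 0 ∷ [])
  ∷ [])

classified-1-2 : Classified 1 2 4 graphs-1-2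
classified-1-2 = Step.classify table₀ 0 1 1 (Table.at table₁ 2) (source 1 classified-0-0 ∷ []) graphs-1-2 0 4 refl refl refl refl

-- The pentagon.
graphs-2-5 : List Tri
graphs-2-5 = map decode
  ( (3 ∷ 2 ∷ 2 ∷ 1 ∷ 0 ∷ [])
  ∷ [])

classified-2-5 : Classified 2 5 12 graphs-2-5
classified-2-5 = Step.classify table₁ 1 5 1 (Table.at table₂ 5) (source 2 classified-1-2 ∷ []) graphs-2-5 0 12 refl refl refl refl

-- Two disjoint edges, the path and the cycle on four vertices.
graphs-2-4 : List Tri
graphs-2-4 = map decode
  ( (1 ∷ 0 ∷ 1 ∷ 0 ∷ [])
  ∷ (2 ∷ 2 ∷ 1 ∷ 0 ∷ [])
  ∷ (3 ∷ 2 ∷ 1 ∷ 0 ∷ [])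
  ∷ [])

classified-2-4 : Classified 2 4 10 graphs-2-4
classified-2-4 = Step.classify table₁ 0 2 3 (Table.at table₂ 4) (source 1 classified-1-2 ∷ source 2 classified-1-1 ∷ []) graphs-2-4 3 3 refl refl refl refl

-- A pentagon with a disjoint edge, a pentagon with a pendant path of two edges, and the heptagon.
graphs-3-7 : List Tri
graphs-3-7 = map decode
  ( (1 ∷ 0 ∷ 3 ∷ 2 ∷ 2 ∷ 1 ∷ 0 ∷ [])
  ∷ (1 ∷ 16 ∷ 3 ∷ 2 ∷ 2 ∷ 1 ∷ 0 ∷ [])
  ∷ (3 ∷ 2 ∷ 2 ∷ 2 ∷ 2 ∷ 1 ∷ 0 ∷ [])
  ∷ [])

classified-3-7 : Classified 3 7 16 graphs-3-7
classified-3-7 = Step.classify table₂ 0 6 2 (Table.at table₃ 7) (source 1 classified-2-5 ∷ source 2 classified-2-4 ∷ []) graphs-3-7 1 13 refl refl refl refl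

-- Two disjoint pentagons.
graphs-4-10 : List Tri
graphs-4-10 = map decode
  ( (3 ∷ 2 ∷ 2 ∷ 1 ∷ 0 ∷ 3 ∷ 2 ∷ 2 ∷ 1 ∷ 0 ∷ [])
  ∷ [])

classified-4-10 : Classified 4 10 22 graphs-4-10
classified-4-10 = Step.classify table₃ 0 10 1 (Table.at table₄ 10) (source 2 classified-3-7 ∷ []) graphs-4-10 0 22 refl refl refl refl

graphs-4-11 : List Tri
graphs-4-11 = map decode
  ( (9 ∷ 8 ∷ 9 ∷ 8 ∷ 40 ∷ 20 ∷ 12 ∷ 6 ∷ 1 ∷ 0 ∷ 0 ∷ [])
  ∷ [])

classified-4-11 : Classified 4 11 32 graphs-4-11
classified-4-11 = Step.classify table₃ 1 15 1 (Table.at table₄ 11) (source 3 classified-3-7 ∷ []) graphs-4-11 3 22 refl refl refl refl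

graphs-4-11′ : List Tri
graphs-4-11′ = graphs-4-11 ++ map decode
  ( (65 ∷ 64 ∷ 65 ∷ 64 ∷ 3 ∷ 6 ∷ 12 ∷ 6 ∷ 3 ∷ 0 ∷ 0 ∷ [])
  ∷ (5 ∷ 128 ∷ 6 ∷ 72 ∷ 34 ∷ 12 ∷ 3 ∷ 2 ∷ 2 ∷ 1 ∷ 0 ∷ [])
  ∷ (36 ∷ 68 ∷ 20 ∷ 40 ∷ 18 ∷ 12 ∷ 8 ∷ 4 ∷ 2 ∷ 1 ∷ 0 ∷ [])
  ∷ (17 ∷ 16 ∷ 3 ∷ 40 ∷ 40 ∷ 24 ∷ 12 ∷ 5 ∷ 1 ∷ 0 ∷ 0 ∷ [])
  ∷ (10 ∷ 10 ∷ 33 ∷ 32 ∷ 34 ∷ 18 ∷ 3 ∷ 2 ∷ 2 ∷ 1 ∷ 0 ∷ [])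
  ∷ (3 ∷ 6 ∷ 12 ∷ 10 ∷ 10 ∷ 8 ∷ 8 ∷ 5 ∷ 1 ∷ 1 ∷ 0 ∷ [])
  ∷ [])

classified-4-11′ : Classified 4 11 34 graphs-4-11′
classified-4-11′ = Step.classify table₃ 1 15 2 (Table.at table₄ 11) (source 3 classified-3-7 ∷ []) graphs-4-11′ 5 18 refl refl refl refl

graphs-4-12 : List Tri
graphs-4-12 = map decode
  ( (138 ∷ 74 ∷ 65 ∷ 64 ∷ 66 ∷ 34 ∷ 5 ∷ 4 ∷ 3 ∷ 2 ∷ 1 ∷ 0 ∷ [])
  ∷ [])

classified-4-12 : Classified 4 12 42 graphs-4-12
classified-4-12 = Step.classify table₃ 2 20 1 (Table.at table₄ 12) (source 4 classified-3-7 ∷ []) graphs-4-12 7 17 refl refl refl refl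

-- The line alone gives 62. To attain it, some vertex of degree 4 must have the graph of
-- `graphs-4-11` as its far graph, and this graph has no suitable extension.
none-5-16 : Classified 5 16 64 []
none-5-16 = Step.classify table₄ 1 31 1 (Step.byLine table₄ 3 49 30 refl refl) (source 4 classified-4-11 ∷ []) [] 5 43 refl refl refl refl

-- The line gives 76. The value 80 is the least even m with 138 < m + 60, as `regular` requires on
-- 23 vertices, so 76 and 78 have to be excluded by gluing.
none-5-17 : Classified 5 17 80 []
none-5-17 = Step.classify table₄ 2 38 2 (Step.byLine table₄ 6 48 37 refl refl) (source 5 classified-4-11 ∷ source 4 classified-4-12 ∷ []) [] 7 46 refl refl refl refl

-- The line gives 90, which is also the largest value for 18 vertices of degree at most 5; excluding
-- it leaves no graph at all.
none-5-18′ : Classified 5 18 92 []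
none-5-18′ = Step.classify table₄ 3 45 1 (Step.byLine table₄ 5 64 44 refl refl) (source 5 classified-4-12 ∷ []) [] 7 56 refl refl refl refl

none-5-18 : Bound 5 18 nothing
none-5-18 = Step.impossible table₄ (≤ᵇ⇒≤ _ _ tt) (no-graph none-5-18′)

table₅ : Table 5 (replicate 13 (just 0) ++ just 30 ∷ just 38 ∷ just 50 ∷ just 64 ∷ just 80 ∷ [])
table₅ = rows-table (zeros 13
  ( byLine 1 26 14 refl refl
  ∷ byLine 0 38 18 refl refl
  ∷ byLine 1 45 24 refl refl
  ∷ no-graph none-5-16
  ∷ no-graph none-5-17
  ∷ end (orAbove none-5-18 (orAbove (impossible {n = 19} (≤ᵇ⇒≤ _ _ tt) (byLine 0 102 47 refl refl)) tooLarge))))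
  where open Step table₄

graphs-5-16 : List Tri
graphs-5-16 = map decode
  ( (2057 ∷ 2056 ∷ 328 ∷ 88 ∷ 522 ∷ 522 ∷ 72 ∷ 24 ∷ 80 ∷ 20 ∷ 24 ∷ 12 ∷ 5 ∷ 1 ∷ 0 ∷ 0 ∷ [])
  ∷ (2057 ∷ 2056 ∷ 4105 ∷ 1032 ∷ 522 ∷ 522 ∷ 72 ∷ 24 ∷ 21 ∷ 5 ∷ 9 ∷ 8 ∷ 5 ∷ 1 ∷ 1 ∷ 0 ∷ [])
  ∷ (42 ∷ 42 ∷ 2081 ∷ 2080 ∷ 1153 ∷ 384 ∷ 140 ∷ 137 ∷ 3 ∷ 2 ∷ 6 ∷ 3 ∷ 2 ∷ 2 ∷ 1 ∷ 0 ∷ [])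
  ∷ (15 ∷ 56 ∷ 292 ∷ 580 ∷ 148 ∷ 72 ∷ 18 ∷ 36 ∷ 40 ∷ 24 ∷ 9 ∷ 8 ∷ 4 ∷ 2 ∷ 1 ∷ 0 ∷ [])
  ∷ (15 ∷ 56 ∷ 292 ∷ 324 ∷ 276 ∷ 72 ∷ 66 ∷ 12 ∷ 40 ∷ 18 ∷ 12 ∷ 8 ∷ 4 ∷ 2 ∷ 1 ∷ 0 ∷ [])
  ∷ [])

classified-5-16 : Classified 5 16 66 graphs-5-16
classified-5-16 = Step.classify table₄ 1 32 1 (Table.at table₅ 16) (source 4 classified-4-11′ ∷ source 3 classified-4-12 ∷ []) graphs-5-16 5 45 refl refl refl refl

-- The line gives 118, just short of what `regular` requires on 29 vertices, namely 203 < m + 84.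
none-6-22 : Classified 6 22 120 []
none-6-22 = Step.classify table₅ 3 59 1 (Step.byLine table₅ 8 74 58 refl refl) (source 5 classified-5-16 ∷ []) [] 6 86 refl refl refl refl

graphs-5-16′ : List Tri
graphs-5-16′ = graphs-5-16 ++ map decode
  ( (545 ∷ 544 ∷ 1090 ∷ 274 ∷ 74 ∷ 26 ∷ 160 ∷ 160 ∷ 96 ∷ 48 ∷ 21 ∷ 5 ∷ 5 ∷ 1 ∷ 0 ∷ 0 ∷ [])
  ∷ (521 ∷ 2560 ∷ 44 ∷ 296 ∷ 642 ∷ 50 ∷ 320 ∷ 192 ∷ 104 ∷ 19 ∷ 20 ∷ 9 ∷ 1 ∷ 1 ∷ 0 ∷ 0 ∷ [])
  ∷ (522 ∷ 522 ∷ 2560 ∷ 2560 ∷ 322 ∷ 82 ∷ 131 ∷ 130 ∷ 11 ∷ 10 ∷ 24 ∷ 12 ∷ 5 ∷ 1 ∷ 0 ∷ 0 ∷ [])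
  ∷ (8201 ∷ 8200 ∷ 641 ∷ 640 ∷ 98 ∷ 194 ∷ 259 ∷ 66 ∷ 25 ∷ 3 ∷ 20 ∷ 9 ∷ 2 ∷ 1 ∷ 1 ∷ 0 ∷ [])
  ∷ (4101 ∷ 520 ∷ 522 ∷ 296 ∷ 265 ∷ 768 ∷ 385 ∷ 12 ∷ 67 ∷ 18 ∷ 10 ∷ 3 ∷ 4 ∷ 3 ∷ 0 ∷ 0 ∷ [])
  ∷ (2057 ∷ 2056 ∷ 296 ∷ 104 ∷ 546 ∷ 546 ∷ 320 ∷ 80 ∷ 98 ∷ 50 ∷ 5 ∷ 1 ∷ 5 ∷ 1 ∷ 0 ∷ 0 ∷ [])
  ∷ (2058 ∷ 2058 ∷ 2057 ∷ 2056 ∷ 1033 ∷ 264 ∷ 73 ∷ 24 ∷ 38 ∷ 35 ∷ 2 ∷ 2 ∷ 3 ∷ 2 ∷ 1 ∷ 0 ∷ [])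
  ∷ (26 ∷ 1042 ∷ 4136 ∷ 560 ∷ 1540 ∷ 208 ∷ 192 ∷ 13 ∷ 32 ∷ 19 ∷ 16 ∷ 3 ∷ 6 ∷ 2 ∷ 0 ∷ 0 ∷ [])
  ∷ (2058 ∷ 2058 ∷ 2057 ∷ 2056 ∷ 268 ∷ 73 ∷ 264 ∷ 72 ∷ 35 ∷ 34 ∷ 3 ∷ 2 ∷ 6 ∷ 3 ∷ 0 ∷ 0 ∷ [])
  ∷ (4101 ∷ 520 ∷ 522 ∷ 2081 ∷ 96 ∷ 322 ∷ 385 ∷ 33 ∷ 11 ∷ 18 ∷ 24 ∷ 10 ∷ 5 ∷ 1 ∷ 0 ∷ 0 ∷ [])
  ∷ (112 ∷ 642 ∷ 546 ∷ 530 ∷ 98 ∷ 320 ∷ 320 ∷ 44 ∷ 96 ∷ 21 ∷ 16 ∷ 12 ∷ 5 ∷ 1 ∷ 0 ∷ 0 ∷ [])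
  ∷ (50 ∷ 1030 ∷ 1120 ∷ 578 ∷ 580 ∷ 768 ∷ 97 ∷ 3 ∷ 12 ∷ 33 ∷ 9 ∷ 8 ∷ 6 ∷ 3 ∷ 0 ∷ 0 ∷ [])
  ∷ (1537 ∷ 3072 ∷ 42 ∷ 42 ∷ 164 ∷ 161 ∷ 384 ∷ 192 ∷ 52 ∷ 37 ∷ 12 ∷ 9 ∷ 2 ∷ 2 ∷ 0 ∷ 0 ∷ [])
  ∷ (50 ∷ 1030 ∷ 4225 ∷ 640 ∷ 1036 ∷ 196 ∷ 196 ∷ 14 ∷ 33 ∷ 4 ∷ 12 ∷ 12 ∷ 6 ∷ 2 ∷ 0 ∷ 0 ∷ [])
  ∷ (50 ∷ 1030 ∷ 672 ∷ 546 ∷ 1036 ∷ 768 ∷ 196 ∷ 14 ∷ 36 ∷ 32 ∷ 12 ∷ 3 ∷ 6 ∷ 2 ∷ 0 ∷ 0 ∷ [])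
  ∷ (112 ∷ 578 ∷ 578 ∷ 515 ∷ 514 ∷ 768 ∷ 320 ∷ 28 ∷ 42 ∷ 11 ∷ 16 ∷ 12 ∷ 5 ∷ 1 ∷ 0 ∷ 0 ∷ [])
  ∷ (26 ∷ 1042 ∷ 4192 ∷ 529 ∷ 1536 ∷ 208 ∷ 193 ∷ 13 ∷ 32 ∷ 19 ∷ 16 ∷ 3 ∷ 6 ∷ 2 ∷ 0 ∷ 0 ∷ [])
  ∷ (4099 ∷ 8210 ∷ 2068 ∷ 112 ∷ 89 ∷ 528 ∷ 162 ∷ 152 ∷ 16 ∷ 20 ∷ 5 ∷ 4 ∷ 1 ∷ 2 ∷ 1 ∷ 0 ∷ [])
  ∷ (3 ∷ 1536 ∷ 7168 ∷ 135 ∷ 268 ∷ 74 ∷ 138 ∷ 68 ∷ 65 ∷ 10 ∷ 20 ∷ 12 ∷ 7 ∷ 0 ∷ 0 ∷ 0 ∷ [])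
  ∷ (2051 ∷ 2050 ∷ 2088 ∷ 2088 ∷ 83 ∷ 22 ∷ 72 ∷ 24 ∷ 80 ∷ 20 ∷ 24 ∷ 12 ∷ 5 ∷ 1 ∷ 0 ∷ 0 ∷ [])
  ∷ (50 ∷ 38 ∷ 4192 ∷ 656 ∷ 1153 ∷ 384 ∷ 296 ∷ 112 ∷ 10 ∷ 11 ∷ 8 ∷ 5 ∷ 0 ∷ 2 ∷ 1 ∷ 0 ∷ [])
  ∷ (2051 ∷ 2050 ∷ 6146 ∷ 3074 ∷ 70 ∷ 70 ∷ 38 ∷ 34 ∷ 18 ∷ 17 ∷ 17 ∷ 5 ∷ 4 ∷ 3 ∷ 0 ∷ 0 ∷ [])
  ∷ (42 ∷ 42 ∷ 2208 ∷ 2208 ∷ 1153 ∷ 384 ∷ 196 ∷ 145 ∷ 5 ∷ 1 ∷ 6 ∷ 3 ∷ 2 ∷ 2 ∷ 1 ∷ 0 ∷ [])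
  ∷ (163 ∷ 162 ∷ 642 ∷ 642 ∷ 261 ∷ 65 ∷ 136 ∷ 136 ∷ 69 ∷ 17 ∷ 16 ∷ 4 ∷ 6 ∷ 3 ∷ 0 ∷ 0 ∷ [])
  ∷ (7 ∷ 4144 ∷ 4384 ∷ 1537 ∷ 7 ∷ 104 ∷ 68 ∷ 132 ∷ 42 ∷ 33 ∷ 4 ∷ 6 ∷ 5 ∷ 0 ∷ 1 ∷ 0 ∷ [])
  ∷ (4099 ∷ 1026 ∷ 2180 ∷ 3076 ∷ 71 ∷ 68 ∷ 68 ∷ 69 ∷ 65 ∷ 6 ∷ 18 ∷ 12 ∷ 1 ∷ 3 ∷ 0 ∷ 0 ∷ [])
  ∷ (7 ∷ 8260 ∷ 4116 ∷ 1568 ∷ 38 ∷ 88 ∷ 52 ∷ 33 ∷ 36 ∷ 32 ∷ 9 ∷ 2 ∷ 3 ∷ 2 ∷ 1 ∷ 0 ∷ [])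
  ∷ (4099 ∷ 1026 ∷ 4102 ∷ 3076 ∷ 152 ∷ 262 ∷ 81 ∷ 18 ∷ 18 ∷ 17 ∷ 17 ∷ 5 ∷ 4 ∷ 3 ∷ 0 ∷ 0 ∷ [])
  ∷ (7 ∷ 1028 ∷ 3080 ∷ 3074 ∷ 772 ∷ 133 ∷ 260 ∷ 133 ∷ 12 ∷ 19 ∷ 6 ∷ 10 ∷ 6 ∷ 0 ∷ 0 ∷ 0 ∷ [])
  ∷ (513 ∷ 512 ∷ 523 ∷ 1034 ∷ 265 ∷ 520 ∷ 324 ∷ 49 ∷ 96 ∷ 20 ∷ 30 ∷ 15 ∷ 0 ∷ 0 ∷ 0 ∷ 0 ∷ [])
  ∷ (163 ∷ 162 ∷ 400 ∷ 196 ∷ 147 ∷ 134 ∷ 128 ∷ 128 ∷ 65 ∷ 16 ∷ 10 ∷ 10 ∷ 5 ∷ 1 ∷ 1 ∷ 0 ∷ [])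
  ∷ (7 ∷ 8212 ∷ 4116 ∷ 1552 ∷ 21 ∷ 17 ∷ 80 ∷ 80 ∷ 76 ∷ 11 ∷ 10 ∷ 4 ∷ 1 ∷ 2 ∷ 1 ∷ 0 ∷ [])
  ∷ (26 ∷ 50 ∷ 1537 ∷ 3072 ∷ 656 ∷ 772 ∷ 112 ∷ 164 ∷ 11 ∷ 10 ∷ 9 ∷ 8 ∷ 4 ∷ 1 ∷ 0 ∷ 0 ∷ [])
  ∷ (2051 ∷ 2050 ∷ 6146 ∷ 3074 ∷ 266 ∷ 74 ∷ 56 ∷ 44 ∷ 37 ∷ 33 ∷ 8 ∷ 8 ∷ 3 ∷ 2 ∷ 0 ∷ 0 ∷ [])
  ∷ (688 ∷ 594 ∷ 586 ∷ 296 ∷ 292 ∷ 162 ∷ 128 ∷ 128 ∷ 65 ∷ 16 ∷ 9 ∷ 8 ∷ 5 ∷ 1 ∷ 1 ∷ 0 ∷ [])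
  ∷ (1188 ∷ 1300 ∷ 1100 ∷ 296 ∷ 268 ∷ 50 ∷ 128 ∷ 128 ∷ 40 ∷ 18 ∷ 12 ∷ 8 ∷ 4 ∷ 2 ∷ 1 ∷ 0 ∷ [])
  ∷ (26 ∷ 50 ∷ 1537 ∷ 3072 ∷ 648 ∷ 648 ∷ 168 ∷ 168 ∷ 19 ∷ 6 ∷ 17 ∷ 4 ∷ 4 ∷ 1 ∷ 0 ∷ 0 ∷ [])
  ∷ (1188 ∷ 2324 ∷ 588 ∷ 296 ∷ 76 ∷ 146 ∷ 128 ∷ 128 ∷ 48 ∷ 18 ∷ 10 ∷ 8 ∷ 4 ∷ 2 ∷ 1 ∷ 0 ∷ [])
  ∷ (1188 ∷ 2324 ∷ 588 ∷ 296 ∷ 76 ∷ 146 ∷ 128 ∷ 128 ∷ 40 ∷ 24 ∷ 9 ∷ 8 ∷ 4 ∷ 2 ∷ 1 ∷ 0 ∷ [])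
  ∷ [])

classified-5-16′ : Classified 5 16 68 graphs-5-16′
classified-5-16′ = Step.classify table₄ 1 32 2 (Table.at table₅ 16) (source 4 classified-4-11′ ∷ source 3 classified-4-12 ∷ source 5 classified-4-10 ∷ []) graphs-5-16′ 6 42 refl refl refl refl

-- If all degrees are k or k + 1, the bound on E (far S w) for a vertex w of degree k forces more than
-- half of the vertices of degree k to be neighbours of w; in a triangle-free graph two adjacent
-- vertices of degree k cannot both have this property.
module _ {k n : ℕ} {prev : List (Maybe ℕ)} (table : Table k prev) {m} (at-m : lookupM prev (n ∸ suc k) ≡ just m)
         (large : n * suc k < m + 2 * (k * suc k)) (low : degreesAbove n prev (pred k) ≡ true) (k>0 : 0 < k)
         {N} (G : Graph N) (tf : TriangleFree G) (S : Mask N) (αS : α≤ G (suc k) S) (#S : # S ≡ n) where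

  private
    Lo : Mask N
    Lo x = S x ∧ (d G S x ≡ᵇ k)

    Lo-S : ∀ x → Lo x ≡ true → S x ≡ true
    Lo-S x h with S x
    ... | true = refl

    Lo-d : ∀ x → Lo x ≡ true → d G S x ≡ k
    Lo-d x h with S x
    ... | true = ≡ᵇ⇒≡ _ _ (subst T (≡-sym h) tt)

    d+lo : ∀ x → S x ≡ true → d G S x + ⟦ Lo x ⟧ ≡ suc k
    d+lo x Sx rewrite Sx with d G S x ≡ᵇ k in e | Step.deg-range table G tf S αS #S low x Sx
    ... | true | _ = cong (_+ 1) (≡ᵇ⇒≡ _ _ (subst T (≡-sym e) tt)) ⨾ +-comm k 1
    ... | false | l , u = +-identityʳ _ ⨾ ≤-antisym u (≤∧≢⇒< (≤-trans (≤-reflexive (≡-sym (suc-pred k {{>-nonZero k>0}}))) l) λ { refl → distinct e })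
      where
      distinct : (d G S x ≡ᵇ d G S x) ≡ false → ⊥
      distinct h = subst T h (≡⇒≡ᵇ (d G S x) (d G S x) refl)

    ∑-Lo : ∀ T → (∀ x → T x ≡ true → S x ≡ true) → ∑⟨ T ⟩ (d G S) + ∑⟨ T ⟩ (λ x → ⟦ Lo x ⟧) ≡ # T * suc k
    ∑-Lo T T⊆S = ≡-sym (∑-+ T (d G S) _) ⨾ ∑-cong T (λ x Tx → d+lo x (T⊆S x Tx)) ⨾ ∑-const T (suc k)

    lo-S : ∑⟨ S ⟩ (λ x → ⟦ Lo x ⟧) ≡ # Lo
    lo-S = sum-cong eq
      where
      eq : ∀ x → ⟦ S x ⟧ * ⟦ Lo x ⟧ ≡ ⟦ Lo x ⟧ * 1
      eq x with S x | d G S x ≡ᵇ k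
      ... | true | true = refl
      ... | true | false = refl
      ... | false | _ = refl

    lo-nb : ∀ w → ∑⟨ nb G S w ⟩ (λ x → ⟦ Lo x ⟧) ≡ d G Lo w
    lo-nb w = sum-cong eq
      where
      eq : ∀ x → ⟦ nb G S w x ⟧ * ⟦ Lo x ⟧ ≡ ⟦ Lo x ⟧ * ⟦ adj G w x ⟧
      eq x with S x | d G S x ≡ᵇ k | adj G w x
      ... | true | true | true = refl
      ... | true | true | false = refl
      ... | true | false | true = refl
      ... | true | false | false = refl
      ... | false | _ | _ = refl

    -- Compared with constant degree `suc k`, the degree sum over `S` falls short by `# Lo` and the
    -- one over the neighbours of `w` by `d G Lo w`. By `E-split` the difference `# Lo` minus twice
    -- `d G Lo w` is at most `n * suc k` minus `m + 2 * (k * suc k)`, which `large` makes negative.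
    majority : ∀ w → Lo w ≡ true → # Lo < 2 * d G Lo w
    majority w Lw = +-cancelˡ-< (n * suc k) _ _ (begin-strict
      n * suc k + # Lo <⟨ +-monoˡ-< (# Lo) large ⟩
      m + 2 * (k * suc k) + # Lo ≡⟨ cong (λ z → m + 2 * z + # Lo) (≡-sym Z) ⟩
      m + 2 * (z + x) + # Lo ≡⟨ solve 4 (λ m z x a → m :+ con 2 :* (z :+ x) :+ a := (m :+ con 2 :* z :+ a) :+ con 2 :* x) refl m z x (# Lo) ⟩
      (m + 2 * z + # Lo) + 2 * x ≤⟨ +-monoˡ-≤ (2 * x) (+-monoˡ-≤ (# Lo) (+-monoˡ-≤ (2 * z) m≤)) ⟩
      (E G (far G S w) + 2 * z + # Lo) + 2 * x ≡⟨ cong (λ e → e + # Lo + 2 * x) (≡-sym (At.E-split G {S} {w} Sw tf)) ⟩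
      (E G S + # Lo) + 2 * x ≡⟨ cong (_+ 2 * x) (cong (E G S +_) (≡-sym lo-S) ⨾ ∑-Lo S (λ _ h → h) ⨾ cong (_* suc k) #S) ⟩
      n * suc k + 2 * x ∎)
      where
      open ≤-Reasoning
      open +-*-Solver using (con)
      Sw = Lo-S w Lw
      z = ∑⟨ nb G S w ⟩ (d G S)
      x = d G Lo w
      Z : z + x ≡ k * suc k
      Z = cong (z +_) (≡-sym (lo-nb w)) ⨾ ∑-Lo (nb G S w) (nb-S G S w) ⨾ cong (_* suc k) (≡-sym (At.d≡#nb G {S} {w} Sw) ⨾ Lo-d w Lw)
      m≤ : m ≤ E G (far G S w)
      m≤ = subst (λ v → AtLeast v (E G (far G S w))) (cong (λ i → lookupM prev (n ∸ suc i)) (Lo-d w Lw) ⨾ at-m)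
             (Step.far-bound table G tf S αS #S w Sw)

    nb≡ : ∀ w x → ⟦ Lo x ⟧ * ⟦ adj G w x ⟧ ≡ ⟦ nb G Lo w x ⟧ * 1
    nb≡ w x with Lo x | adj G w x
    ... | true | true = refl
    ... | true | false = refl
    ... | false | _ = refl

    -- Adjacent vertices have no common neighbour.
    disjoint : ∀ w u → adj G w u ≡ true → d G Lo w + d G Lo u ≤ # Lo
    disjoint w u wu = ≤-trans (≤-reflexive (≡-sym (∑-+ Lo (λ y → ⟦ adj G w y ⟧) (λ y → ⟦ adj G u y ⟧)))) (∑-mono Lo (λ y _ → at-most-one y))
      where
      at-most-one : ∀ y → ⟦ adj G w y ⟧ + ⟦ adj G u y ⟧ ≤ 1
      at-most-one y with adj G u y in e
      ... | true rewrite tf w u y wu e = ≤-refl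
      ... | false with adj G w y
      ... | true = ≤-refl
      ... | false = z≤n

    halves : ∀ a x y → a < 2 * x → a < 2 * y → x + y ≤ a → ⊥
    halves a x y p q r = <⇒≱ (+-mono-< p q) (≤-trans (≤-reflexive (≡-sym (*-distribˡ-+ 2 x y)))
      (≤-trans (*-monoʳ-≤ 2 r) (≤-reflexive (cong (a +_) (+-identityʳ a)))))

    positive : ∀ a x → a < 2 * x → 0 < x
    positive a zero ()
    positive a (suc x) _ = s≤s z≤n

    none-low : ∀ w → Lo w ≡ true → ⊥
    none-low w Lw with nonempty (nb G Lo w) (≤-trans (positive (# Lo) (d G Lo w) (majority w Lw)) (≤-reflexive (sum-cong (nb≡ w))))
    ... | u , uw = halves (# Lo) (d G Lo w) (d G Lo u) (majority w Lw) (majority u (nb-S G Lo w u uw)) (disjoint w u (nb-a G Lo w u uw))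

  regular : ∀ x → S x ≡ true → d G S x ≡ suc k
  regular x Sx with Lo x in e | d+lo x Sx
  ... | true | _ = ⊥-elim (none-low x e)
  ... | false | h = ≡-sym (+-identityʳ _) ⨾ h

constant-degree : ∀ {N} (G : Graph N) S r → (∀ x → S x ≡ true → d G S x ≡ r) → ∀ T → (∀ x → T x ≡ true → S x ≡ true) → ∑⟨ T ⟩ (d G S) ≡ # T * r
constant-degree G S r h T T⊆S = ∑-cong T (λ x Tx → h x (T⊆S x Tx)) ⨾ ∑-const T r

no-extension : glueAll 138 6 6 5 5 graphs-5-16′ ≡ []
no-extension = refl

-- The graph would be 6-regular, so each far graph has 16 vertices and E = 138 - 2 · 36 = 66. All
-- such graphs are listed in `graphs-5-16′`, and none extends to a 6-regular graph on 23 vertices.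
none-6-23 : Bound 6 23 nothing
none-6-23 G tf S αS #S with nonempty S (≤-trans (s≤s z≤n) (≤-reflexive (≡-sym #S)))
... | v , Sv = absurd (subst₂ (λ D r → InCatalogue G S (glueAll D 6 r 5 5 graphs-5-16′)) E≡ (six v Sv)
        (Step.glued table₅ G tf S αS #S v Sv
          (classified-5-16′ G tf (far G S v) (At.α-far G {S} {v} Sv αS) (Step.#far table₅ G tf S αS #S v Sv ⨾ cong (λ r → 23 ∸ suc r) (six v Sv))
            (≤-trans (≤-reflexive (cong suc far≡)) (≤ᵇ⇒≤ 67 68 tt)))
          (λ x Sx → ≤-reflexive (≡-sym (six x Sx)) , ≤-reflexive (six x Sx))))
  where
  six : ∀ x → S x ≡ true → d G S x ≡ 6
  six = regular table₅ refl (≤ᵇ⇒≤ _ _ tt) refl (s≤s z≤n) G tf S αS #S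
  E≡ : E G S ≡ 138
  E≡ = constant-degree G S 6 six S (λ _ h → h) ⨾ cong (_* 6) {# S} {23} #S
  Z≡ : ∑⟨ nb G S v ⟩ (d G S) ≡ 36
  Z≡ = constant-degree G S 6 six (nb G S v) (nb-S G S v) ⨾ cong (_* 6) {# (nb G S v)} {6} (≡-sym (At.d≡#nb G {S} {v} Sv) ⨾ six v Sv)
  far≡ : E G (far G S v) ≡ 66
  far≡ = +-cancelʳ-≡ 72 _ _ (cong (λ z → E G (far G S v) + 2 * z) (≡-sym Z≡) ⨾ ≡-sym (At.E-split G {S} {v} Sv tf) ⨾ E≡)
  absurd : InCatalogue G S (glueAll 138 6 6 5 5 graphs-5-16′) → ⊥
  absurd q with subst (InCatalogue G S) no-extension q
  ... | _ , _ , ()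

table₆ : Table 6 (replicate 20 (just 0) ++ just 84 ∷ just 100 ∷ just 120 ∷ [])
table₆ = rows-table (zeros 20
  ( byLine 1 78 41 refl refl
  ∷ byLine 4 80 49 refl refl
  ∷ no-graph none-6-22
  ∷ end (orAbove none-6-23 (orAbove (impossible {n = 24} (≤ᵇ⇒≤ _ _ tt) (byLine 0 152 72 refl refl)) tooLarge))))
  where open Step table₅

-- The graph would be 7-regular, but 29 · 7 is odd.
none-7-29 : Bound 7 29 nothing
none-7-29 G tf S αS #S with E-even G S
... | h , e = odd h (≡-sym (constant-degree G S 7 seven S (λ _ p → p) ⨾ cong (_* 7) {# S} {29} #S) ⨾ e)
  where
  seven : ∀ x → S x ≡ true → d G S x ≡ 7
  seven = regular table₆ refl (≤ᵇ⇒≤ _ _ tt) refl (s≤s z≤n) G tf S αS #S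
  odd : ∀ h → 203 ≡ h + h → ⊥
  odd h e with h ≤? 101
  ... | yes p = <⇒≢ (≤-<-trans (+-mono-≤ p p) (≤ᵇ⇒≤ 203 203 tt)) (≡-sym e)
  ... | no p = <⇒≢ (<-≤-trans (≤ᵇ⇒≤ 204 204 tt) (+-mono-≤ (≰⇒> p) (≰⇒> p))) e

table₇ : Table 7 (replicate 28 (just 0) ++ just 176 ∷ [])
table₇ = rows-table (zeros 28
  ( byLine 10 112 87 refl refl
  ∷ end (orAbove none-7-29 (orAbove (impossible {n = 30} (≤ᵇ⇒≤ _ _ tt) (byLine 0 218 105 refl refl)) tooLarge))))
  where open Step table₆

table₈ : Table 8 (replicate 37 (just 0) ++ [])
table₈ = rows-table (zeros 37
  ( end (orAbove (impossible {n = 37} (≤ᵇ⇒≤ _ _ tt) (byLine 0 304 148 refl refl)) tooLarge)))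
  where open Step table₇

ramsey : ∀ {k ws} → Table k ws → ∀ {N} (G : Graph N) → TriangleFree G → ∀ S → α≤ G k S → # S < length ws
ramsey {ws = ws} table G tf S αS with # S <? length ws
... | yes p = p
... | no np = ⊥-elim (subst (λ w → AtLeast w (E G S)) (lookup-beyond ws (# S) (≮⇒≥ np)) (Table.at table (# S) G tf S αS refl))

-- Matchings and Gallai's lemma

-- Excluded middle is available whenever the goal is a contradiction; the matching arguments and the
-- main induction are phrased this way.
em : ∀ {P : Set} → (P ⊎ ¬ P → ⊥) → ⊥
em k = k (inj₂ λ p → k (inj₁ p))

-- Excluded middle at each of finitely many vertices gives a Boolean mask for an undecided
-- predicate, such as a class of Gallai's relation or an alternating component.
mask-of : ∀ {N} (P : Fin N → Set) → ((A : Mask N) → (∀ x → A x ≡ true → P x) → (∀ x → A x ≡ false → ¬ P x) → ⊥) → ⊥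
mask-of {zero} P k = k (λ ()) (λ ()) (λ ())
mask-of {suc N} P k = em λ
  { (inj₁ p) → mask-of (λ x → P (suc x)) λ A yes no →
      k (λ { zero → true ; (suc x) → A x }) (λ { zero _ → p ; (suc x) → yes x }) (λ { (suc x) → no x })
  ; (inj₂ np) → mask-of (λ x → P (suc x)) λ A yes no →
      k (λ { zero → false ; (suc x) → A x }) (λ { (suc x) → yes x }) (λ { zero _ → np ; (suc x) → no x }) }

least : (Q : ℕ → Set) → ∀ n → Q n → (∀ m → Q m → (∀ j → Q j → m ≤ j) → ⊥) → ⊥
least Q n q k = go n n ≤-refl q
  where
  go : ∀ b m → m ≤ b → Q m → ⊥
  go zero zero _ q = k zero q (λ _ _ → z≤n)
  go (suc b) m m≤ q = em {∃ λ j → j < m × Q j} λ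
    { (inj₁ (j , j<m , qj)) → go b j (≤-pred (≤-trans j<m m≤)) qj
    ; (inj₂ no-smaller) → k m q (λ j qj → ≮⇒≥ (λ j<m → no-smaller (j , j<m , qj))) }

iter : ∀ {A : Set} → (A → A) → ℕ → A → A
iter f zero x = x
iter f (suc n) x = f (iter f n x)

module _ {A : Set} (f : A → A) where

  iter-+ : ∀ m n x → iter f (m + n) x ≡ iter f m (iter f n x)
  iter-+ zero n x = refl
  iter-+ (suc m) n x = cong f (iter-+ m n x)

  iter-suc : ∀ n x → iter f n (f x) ≡ f (iter f n x)
  iter-suc zero x = refl
  iter-suc (suc n) x = cong f (iter-suc n x)

  iter-periodic : ∀ p {x} → iter f p x ≡ x → ∀ q → iter f (q * p) x ≡ x
  iter-periodic p e zero = refl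
  iter-periodic p {x} e (suc q) = iter-+ p (q * p) x ⨾ cong (iter f p) (iter-periodic p e q) ⨾ e

-- (2i + 1) d = d + i (2 d), so periods 2i + 1 and 2d force the period d.
odd-period : ∀ {A : Set} (f : A → A) {x} i d → iter f (suc (i + i)) x ≡ x → iter f (suc ((i + d) + (i + d))) x ≡ x →
  iter f (i + d) x ≡ iter f i x
odd-period f {x} i d pi pj = iter-+ f i d x ⨾ cong (iter f i) (≡-sym (cong (iter f d) (iter-periodic f (d + d) even i)) ⨾
    ≡-sym (iter-+ f d (i * (d + d)) x) ⨾
    cong (λ m → iter f m x) (solve 2 (λ i d → d :+ i :* (d :+ d) := d :* (con 1 :+ (i :+ i))) refl i d) ⨾
    iter-periodic f (suc (i + i)) pi d)
  where
  even : iter f (d + d) x ≡ x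
  even = ≡-sym (iter-+ f (d + d) (suc (i + i)) x ⨾ cong (iter f (d + d)) pi) ⨾
    cong (λ m → iter f m x) (solve 2 (λ i d → (d :+ d) :+ (con 1 :+ (i :+ i)) := con 1 :+ ((i :+ d) :+ (i :+ d))) refl i d) ⨾ pj

∖-other : ∀ {N} (S : Mask N) {v x} → x ≢ v → (S ∖ v) x ≡ S x
∖-other S {v} {x} ne = cong (λ b → if b then false else S x) (≢⇒== ne)

∖-cong : ∀ {N} {S T : Mask N} u → (∀ x → S x ≡ T x) → ∀ x → (S ∖ u) x ≡ (T ∖ u) x
∖-cong u h x = cong (λ b → if x == u then false else b) (h x)

module Matchings {N : ℕ} (H : Graph N) where

  -- A partition into cliques of `H` with at most three vertices; for `H` the complement of a graph,
  -- these are colour classes.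
  data Cover (S : Mask N) : ℕ → Set where
    empty  : (∀ x → S x ≡ false) → Cover S 0
    single : ∀ {c} u → S u ≡ true → Cover (S ∖ u) c → Cover S (suc c)
    pair   : ∀ {c} u v → S u ≡ true → (S ∖ u) v ≡ true → adj H u v ≡ true → Cover ((S ∖ u) ∖ v) c → Cover S (suc c)
    triple : ∀ {c} u v w → S u ≡ true → (S ∖ u) v ≡ true → ((S ∖ u) ∖ v) w ≡ true →
      adj H u v ≡ true → adj H v w ≡ true → adj H u w ≡ true → Cover (((S ∖ u) ∖ v) ∖ w) c → Cover S (suc c)

  Cover-resp : ∀ {S T : Mask N} {c} → (∀ x → S x ≡ T x) → Cover S c → Cover T c
  Cover-resp h (empty e) = empty (λ x → ≡-sym (h x) ⨾ e x)
  Cover-resp h (single u Su C) = single u (≡-sym (h u) ⨾ Su) (Cover-resp (∖-cong u h) C)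
  Cover-resp h (pair u v Su Sv uv C) = pair u v (≡-sym (h u) ⨾ Su) (≡-sym (∖-cong u h v) ⨾ Sv) uv (Cover-resp (∖-cong v (∖-cong u h)) C)
  Cover-resp h (triple u v w Su Sv Sw uv vw uw C) = triple u v w (≡-sym (h u) ⨾ Su) (≡-sym (∖-cong u h v) ⨾ Sv)
      (≡-sym (∖-cong v (∖-cong u h) w) ⨾ Sw) uv vw uw (Cover-resp (∖-cong w (∖-cong v (∖-cong u h))) C)

  -- A matching is an involution whose fixed points are the unmatched vertices, so alternating paths
  -- are orbits of a product of two involutions.
  record Matching (S : Mask N) : Set where
    field
      μ   : Fin N → Fin N
      inv : ∀ x → μ (μ x) ≡ x
      ok  : ∀ x → μ x ≢ x → S x ≡ true × adj H x (μ x) ≡ true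

    free : Mask N
    free x = S x ∧ (μ x == x)

    free-S : ∀ x → free x ≡ true → S x ≡ true
    free-S x h with S x
    ... | true = refl

    free-μ : ∀ x → free x ≡ true → μ x ≡ x
    free-μ x h with S x
    ... | true = ==⇒≡ {x = μ x} h

    free-intro : ∀ x → S x ≡ true → μ x ≡ x → free x ≡ true
    free-intro x Sx e = cong₂ _∧_ Sx (cong (_== x) e ⨾ ==-refl x)

  open Matching

  deficiency : ∀ {S} → Matching S → ℕ
  deficiency M = # free M

  -- A matched pair is a class of two vertices and a fixed point is a class of its own. Only closure
  -- of `S` under `μ` is assumed, so the induction can shrink `S` and keep `μ`.
  matching-cover : ∀ n (S : Mask N) (μ : Fin N → Fin N) → # S ≤ n → (∀ x → S x ≡ true → S (μ x) ≡ true × μ (μ x) ≡ x × (μ x ≢ x → adj H x (μ x) ≡ true)) →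
    ∃ λ c → Cover S c × c + c ≡ # S + # (λ x → S x ∧ (μ x == x))
  matching-cover n S μ #≤ h with find S
  ... | inj₂ e = 0 , empty e , ≡-sym (cong₂ _+_ (sum-zero (λ x → cong (λ b → ⟦ b ⟧ * 1) (e x))) (sum-zero (λ x → cong (λ b → ⟦ b ∧ (μ x == x) ⟧ * 1) (e x))))
  matching-cover zero S μ #≤ h | inj₁ (x , Sx) with () ← ≤-trans (≤-reflexive (≡-sym (#-remove S Sx))) #≤
  matching-cover (suc n) S μ #≤ h | inj₁ (x , Sx) with μ x Fin.≟ x
  ... | yes fix = add (matching-cover n (S ∖ x) μ (≤-pred (≤-trans (≤-reflexive (≡-sym (#-remove S Sx))) #≤)) h′)
    where
    h′ : ∀ y → (S ∖ x) y ≡ true → (S ∖ x) (μ y) ≡ true × μ (μ y) ≡ y × (μ y ≢ y → adj H y (μ y) ≡ true)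
    h′ y Sy with h y (∖-⊆ S y Sy)
    ... | Sμ , inv , ed = ∖-intro S (μ y) Sμ (λ e → ∖-≢ S y Sy (≡-sym inv ⨾ cong μ e ⨾ fix)) , inv , ed
    F = λ y → S y ∧ (μ y == y)
    F′ = λ y → (S ∖ x) y ∧ (μ y == y)
    Fx : F x ≡ true
    Fx = cong₂ _∧_ Sx (cong (_== x) fix ⨾ ==-refl x)
    same : ∀ y → (F ∖ x) y ≡ F′ y
    same y with y Fin.≟ x
    ... | yes _ = refl
    ... | no _ = refl
    add : _ → ∃ λ c → Cover S c × c + c ≡ # S + # F
    add (c , C , e) = suc c , single x Sx C , cong suc (+-suc c c ⨾ cong suc e) ⨾
      solve 2 (λ s f → con 2 :+ (s :+ f) := (con 1 :+ s) :+ (con 1 :+ f)) refl (# (S ∖ x)) (# F′) ⨾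
      cong₂ _+_ (≡-sym (#-remove S Sx)) (cong suc (≡-sym (∑-resp {S = F ∖ x} {T = F′} (λ _ → 1) same)) ⨾ ≡-sym (#-remove F Fx))
  ... | no move = add (matching-cover n ((S ∖ x) ∖ μ x) μ (≤-trans (n≤1+n _) (≤-trans (≤-reflexive (≡-sym (#-remove (S ∖ x) Sμx)))
          (≤-pred (≤-trans (≤-reflexive (≡-sym (#-remove S Sx))) #≤)))) h′)
    where
    Sμx : (S ∖ x) (μ x) ≡ true
    Sμx = ∖-intro S (μ x) (proj₁ (h x Sx)) move
    S′ = (S ∖ x) ∖ μ x
    h′ : ∀ y → S′ y ≡ true → S′ (μ y) ≡ true × μ (μ y) ≡ y × (μ y ≢ y → adj H y (μ y) ≡ true)
    h′ y Sy with h y (∖-⊆ S y (∖-⊆ (S ∖ x) y Sy))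
    ... | Sμ , inv , ed = ∖-intro (S ∖ x) (μ y) (∖-intro S (μ y) Sμ (λ e → ∖-≢ (S ∖ x) y Sy (≡-sym inv ⨾ cong μ e)))
          (λ e → ∖-≢ S y (∖-⊆ (S ∖ x) y Sy) (≡-sym inv ⨾ cong μ e ⨾ proj₁ (proj₂ (h x Sx)))) , inv , ed
    F = λ y → S y ∧ (μ y == y)
    F′ = λ y → S′ y ∧ (μ y == y)
    same : ∀ y → F′ y ≡ F y
    same y with y Fin.≟ μ x
    ... | yes refl rewrite ≢⇒== {x = μ (μ x)} {μ x} (λ e → move (≡-sym e ⨾ proj₁ (proj₂ (h x Sx)))) with S (μ x)
    ...   | true = refl
    ...   | false = refl
    same y | no _ with y Fin.≟ x
    ... | no _ = refl
    ... | yes refl rewrite ≢⇒== move with S x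
    ...   | true = refl
    ...   | false = refl
    add : _ → ∃ λ c → Cover S c × c + c ≡ # S + # F
    add (c , C , e) = suc c , pair x (μ x) Sx Sμx (proj₂ (proj₂ (h x Sx)) move) C , cong suc (+-suc c c ⨾ cong suc e) ⨾
      cong₂ _+_ (cong suc (≡-sym (#-remove (S ∖ x) Sμx)) ⨾ ≡-sym (#-remove S Sx)) (∑-resp {S = F′} {T = F} (λ _ → 1) same)

  cover-of : ∀ {S} (M : Matching S) → ∃ λ c → Cover S c × c + c ≡ # S + deficiency M
  cover-of {S} M = matching-cover (# S) S (μ M) ≤-refl closed
    where
    closed : ∀ x → S x ≡ true → S (μ M x) ≡ true × μ M (μ M x) ≡ x × (μ M x ≢ x → adj H x (μ M x) ≡ true)
    closed x Sx = Sμ , inv M x , (λ ne → proj₂ (ok M x ne))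
      where
      Sμ : S (μ M x) ≡ true
      Sμ with μ M x Fin.≟ x
      ... | yes e = cong S e ⨾ Sx
      ... | no ne = proj₁ (ok M (μ M x) (λ e → ne (≡-sym e ⨾ inv M x)))

  TriangleFreeOn : Mask N → Set
  TriangleFreeOn S = ∀ x y z → S x ≡ true → S y ≡ true → S z ≡ true → adj H x y ≡ true → adj H y z ≡ true → adj H x z ≡ true → ⊥

  trivial-matching : ∀ S → Matching S
  trivial-matching S = record { μ = λ x → x ; inv = λ _ → refl ; ok = λ x ne → ⊥-elim (ne refl) }

  widen : ∀ {S u} → Matching (S ∖ u) → Matching S
  widen {S} M = record { μ = μ M ; inv = inv M ; ok = λ x ne → ∖-⊆ S x (proj₁ (ok M x ne)) , proj₂ (ok M x ne) }

  widen-fixes : ∀ {S u} (M : Matching (S ∖ u)) → μ M u ≡ u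
  widen-fixes {S} {u} M with μ M u Fin.≟ u
  ... | yes e = e
  ... | no ne with () ← ≡-sym (∖-self S u) ⨾ proj₁ (ok M u ne)

  widen-deficiency : ∀ {S u} → S u ≡ true → (M : Matching (S ∖ u)) → deficiency (widen {S} {u} M) ≡ suc (deficiency M)
  widen-deficiency {S} {u} Su M = #-remove (free (widen {S} {u} M)) (free-intro (widen {S} {u} M) u Su (widen-fixes {S} {u} M)) ⨾ cong suc (∑-resp (λ _ → 1) same)
    where
    same : ∀ y → (free (widen {S} {u} M) ∖ u) y ≡ free M y
    same y with y Fin.≟ u
    ... | yes _ = refl
    ... | no _ = refl

  module AddEdge {S : Mask N} (M : Matching S) (u v : Fin N) (uv : adj H u v ≡ true)
                 (Su : S u ≡ true) (Sv : S v ≡ true) (u-free : μ M u ≡ u) (v-free : μ M v ≡ v) where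

    u≢v : u ≢ v
    u≢v refl with () ← ≡-sym uv ⨾ irrefl H u

    ν : Fin N → Fin N
    ν x with x Fin.≟ u
    ... | yes _ = v
    ... | no _ with x Fin.≟ v
    ... | yes _ = u
    ... | no _ = μ M x

    ν-u : ν u ≡ v
    ν-u with u Fin.≟ u
    ... | yes _ = refl
    ... | no ne = ⊥-elim (ne refl)

    ν-v : ν v ≡ u
    ν-v with v Fin.≟ u
    ... | yes e = ⊥-elim (u≢v (≡-sym e))
    ... | no _ with v Fin.≟ v
    ... | yes _ = refl
    ... | no ne = ⊥-elim (ne refl)

    ν-other : ∀ x → x ≢ u → x ≢ v → ν x ≡ μ M x
    ν-other x nu nv with x Fin.≟ u
    ... | yes e = ⊥-elim (nu e)
    ... | no _ with x Fin.≟ v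
    ... | yes e = ⊥-elim (nv e)
    ... | no _ = refl

    data View (x : Fin N) : Set where
      is-u : x ≡ u → View x
      is-v : x ≡ v → View x
      other : x ≢ u → x ≢ v → View x

    view : ∀ x → View x
    view x with x Fin.≟ u | x Fin.≟ v
    ... | yes e | _ = is-u e
    ... | no _ | yes e = is-v e
    ... | no nu | no nv = other nu nv

    μ-other : ∀ x {z} → μ M z ≡ z → x ≢ z → μ M x ≢ z
    μ-other x fz ne e = ne (≡-sym (inv M x) ⨾ cong (μ M) e ⨾ fz)

    added : Matching S
    added = record { μ = ν ; inv = inv′ ; ok = ok′ }
      where
      inv′ : ∀ x → ν (ν x) ≡ x
      inv′ x with view x
      ... | is-u refl = cong ν ν-u ⨾ ν-v
      ... | is-v refl = cong ν ν-v ⨾ ν-u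
      ... | other nu nv = cong ν (ν-other x nu nv) ⨾ ν-other (μ M x) (μ-other x u-free nu) (μ-other x v-free nv) ⨾ inv M x
      ok′ : ∀ x → ν x ≢ x → S x ≡ true × adj H x (ν x) ≡ true
      ok′ x ne with view x
      ... | is-u refl = Su , cong (adj H u) ν-u ⨾ uv
      ... | is-v refl = Sv , cong (adj H v) ν-v ⨾ sym H v u ⨾ uv
      ... | other nu nv = proj₁ (ok M x ne′) , cong (adj H x) (ν-other x nu nv) ⨾ proj₂ (ok M x ne′)
        where
        ne′ : μ M x ≢ x
        ne′ e = ne (ν-other x nu nv ⨾ e)

    added-deficiency : deficiency M ≡ suc (suc (deficiency added))
    added-deficiency = #-remove (free M) (free-intro M u Su u-free) ⨾ cong suc (#-remove (free M ∖ u) (∖-intro (free M) v (free-intro M v Sv v-free) (λ e → u≢v (≡-sym e))) ⨾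
      cong suc (∑-resp (λ _ → 1) same))
      where
      same : ∀ x → ((free M ∖ u) ∖ v) x ≡ free added x
      same x with view x
      ... | is-u refl = ∖-other (free M ∖ u) u≢v ⨾ ∖-self (free M) u ⨾
            ≡-sym (cong (S u ∧_) (cong (_== u) ν-u ⨾ ≢⇒== (λ e → u≢v (≡-sym e))) ⨾ ∧-zeroʳ (S u))
      ... | is-v refl = ∖-self (free M ∖ u) v ⨾ ≡-sym (cong (S v ∧_) (cong (_== v) ν-v ⨾ ≢⇒== u≢v) ⨾ ∧-zeroʳ (S v))
      ... | other nu nv = ∖-other (free M ∖ u) nv ⨾ ∖-other (free M) nu ⨾ cong (λ y → S x ∧ (y == x)) (≡-sym (ν-other x nu nv))

  -- The converse of `cover-of`: without triangles every class is a pair or a single vertex.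
  cover-matching : ∀ {S c} → TriangleFreeOn S → Cover S c → ∃ λ (M : Matching S) → c + c ≡ # S + deficiency M
  cover-matching {S} tf (empty e) = trivial-matching S , ≡-sym (cong₂ _+_ (sum-zero (λ x → cong (λ b → ⟦ b ⟧ * 1) (e x)))
    (sum-zero (λ x → cong (λ b → ⟦ b ∧ (x == x) ⟧ * 1) (e x))))
  cover-matching {S} tf (single {c} u Su C) with cover-matching (λ x y z p q r → tf x y z (∖-⊆ S x p) (∖-⊆ S y q) (∖-⊆ S z r)) C
  ... | M , e = widen {S} {u} M , cong suc (+-suc c c ⨾ cong suc e) ⨾
      solve 2 (λ s f → con 2 :+ (s :+ f) := (con 1 :+ s) :+ (con 1 :+ f)) refl (# (S ∖ u)) (deficiency M) ⨾
      cong₂ _+_ (≡-sym (#-remove S Su)) (≡-sym (widen-deficiency Su M))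
  cover-matching {S} tf (pair {c} u v Su Sv uv C)
    with cover-matching (λ x y z p q r → tf x y z (∖-⊆ S x (∖-⊆ (S ∖ u) x p)) (∖-⊆ S y (∖-⊆ (S ∖ u) y q)) (∖-⊆ S z (∖-⊆ (S ∖ u) z r))) C
  ... | M , e = added , cong suc (+-suc c c ⨾ cong suc e) ⨾ +-cancelʳ-≡ 2 _ _
      (solve 2 (λ s f → (con 2 :+ (s :+ f)) :+ con 2 := (con 1 :+ (con 1 :+ s)) :+ (con 1 :+ (con 1 :+ f))) refl (# ((S ∖ u) ∖ v)) (deficiency M) ⨾
       cong₂ _+_ (cong suc (≡-sym (#-remove (S ∖ u) Sv)) ⨾ ≡-sym (#-remove S Su))
         (≡-sym (widen-deficiency Su M′ ⨾ cong suc (widen-deficiency {S ∖ u} {v} Sv M)) ⨾ added-deficiency) ⨾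
       solve 2 (λ s f → s :+ (con 1 :+ (con 1 :+ f)) := (s :+ f) :+ con 2) refl (# S) (deficiency added))
    where
    M′ : Matching (S ∖ u)
    M′ = widen {S ∖ u} {v} M
    open AddEdge (widen {S} {u} M′) u v uv Su (∖-⊆ S v Sv) (widen-fixes {S} {u} M′) (widen-fixes {S ∖ u} {v} M)
  cover-matching {S} tf (triple u v w Su Sv Sw uv vw uw C) =
    ⊥-elim (tf u v w Su (∖-⊆ S v Sv) (∖-⊆ S w (∖-⊆ (S ∖ u) w Sw)) uv vw uw)

  module Gallai {S : Mask N} {f : ℕ} (min : ∀ (M : Matching S) → f ≤ deficiency M) where

    Minimum : Matching S → Set
    Minimum M = deficiency M ≡ f

    -- Gallai's relation: no matching of minimum deficiency leaves both vertices free. It contains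
    -- adjacency, and its classes are to serve as parts with no edges between them.
    _≈_ : Fin N → Fin N → Set
    x ≈ y = ∀ M → Minimum M → μ M x ≡ x → μ M y ≡ y → ⊥

    -- Adding the edge would lower the deficiency by two.
    adjacent-≈ : ∀ {x y} → S x ≡ true → S y ≡ true → adj H x y ≡ true → x ≈ y
    adjacent-≈ {x} {y} Sx Sy xy M m p q = <⇒≱ (s≤s (n≤1+n _)) (≤-trans (≤-reflexive (≡-sym added-deficiency ⨾ m)) (min added))
      where open AddEdge M x y xy Sx Sy p q

    -- The component of t in the union of two matchings L and M, where t is free in M, is the orbit
    -- of t under the permutation M ∘ L in both directions.
    module Orbit (L M : Matching S) (t : Fin N) (t-free : μ M t ≡ t) where

      σ τ : Fin N → Fin N
      σ x = μ M (μ L x)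
      τ x = μ L (μ M x)

      P : Fin N → Set
      P x = ∃ λ i → x ≡ iter σ i t ⊎ x ≡ iter τ i t

      M-σ : ∀ i → μ M (iter σ i t) ≡ iter τ i t
      L-τ : ∀ i → μ L (iter τ (suc i) t) ≡ iter σ i t
      L-σ : ∀ i → μ L (iter σ i t) ≡ iter τ (suc i) t
      M-τ : ∀ i → μ M (iter τ i t) ≡ iter σ i t
      M-σ zero = t-free
      M-σ (suc i) = inv M _ ⨾ L-σ i
      L-σ i = cong (μ L) (≡-sym (inv M _) ⨾ cong (μ M) (M-σ i))
      L-τ i = inv L _ ⨾ M-τ i
      M-τ i = cong (μ M) (≡-sym (M-σ i)) ⨾ inv M _

      P-M : ∀ {x} → P x → P (μ M x)
      P-M (i , inj₁ e) = i , inj₂ (cong (μ M) e ⨾ M-σ i)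
      P-M (i , inj₂ e) = i , inj₁ (cong (μ M) e ⨾ M-τ i)

      P-L : ∀ {x} → P x → P (μ L x)
      P-L (i , inj₁ e) = suc i , inj₂ (cong (μ L) e ⨾ L-σ i)
      P-L (suc i , inj₂ e) = i , inj₁ (cong (μ L) e ⨾ L-τ i)
      P-L (zero , inj₂ e) = 1 , inj₂ (cong (μ L) e ⨾ L-σ 0)

      σ-τ : ∀ i → iter σ i (iter τ i t) ≡ t
      σ-τ zero = refl
      σ-τ (suc i) = ≡-sym (iter-suc σ i _) ⨾ cong (iter σ i) (cong (μ M) (inv L _) ⨾ inv M _) ⨾ σ-τ i

      -- At a vertex fixed by `L` the orbit turns back: the i-th iterate of `σ` equals the (i +
      -- 1)-st iterate of `τ`, which is inverse to `σ`.
      period-σ : ∀ {x} i → x ≡ iter σ i t → μ L x ≡ x → iter σ (suc (i + i)) t ≡ t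
      period-σ i e fx = iter-+ σ (suc i) i t ⨾ cong (iter σ (suc i)) (≡-sym e ⨾ ≡-sym fx ⨾ cong (μ L) e ⨾ L-σ i) ⨾ σ-τ (suc i)

      period : μ L t ≢ t → ∀ {x} → P x → μ L x ≡ x → ∃ λ i → x ≡ iter σ i t × iter σ (suc (i + i)) t ≡ t
      period Lt (i , inj₁ e) fx = i , e , period-σ i e fx
      period Lt (zero , inj₂ refl) fx = ⊥-elim (Lt fx)
      period Lt (suc i , inj₂ e) fx = i , e′ , period-σ i e′ fx
        where e′ = ≡-sym fx ⨾ cong (μ L) e ⨾ L-τ i

      -- The component of `t` is a path with only one other end: fixed points of `L` after i and j
      -- steps give `t` the periods 2i + 1 and 2j + 1, and `odd-period` identifies them.
      one-free : μ L t ≢ t → ∀ {x y} → P x → P y → μ L x ≡ x → μ L y ≡ y → x ≡ y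
      one-free Lt Px Py fx fy with period Lt Px fx | period Lt Py fy
      ... | i , refl , pi | j , refl , pj with ≤-total i j
      ... | inj₁ i≤j with m≤n⇒∃[o]m+o≡n i≤j
      ...   | k , refl = ≡-sym (odd-period σ i k pi pj)
      one-free Lt Px Py fx fy | i , refl , pi | j , refl , pj | inj₂ j≤i with m≤n⇒∃[o]m+o≡n j≤i
      ...   | k , refl = odd-period σ j k pj pi

    module Swap (L M : Matching S) (A : Mask N) (A-L : ∀ x → A (μ L x) ≡ A x) (A-M : ∀ x → A (μ M x) ≡ A x) where

      ν : Fin N → Fin N
      ν x = if A x then μ M x else μ L x

      swapped : Matching S
      swapped = record { μ = ν ; inv = inv′ ; ok = ok′ }
        where
        inv′ : ∀ x → ν (ν x) ≡ x
        inv′ x with A x in e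
        ... | true rewrite A-M x | e = inv M x
        ... | false rewrite A-L x | e = inv L x
        ok′ : ∀ x → ν x ≢ x → S x ≡ true × adj H x (ν x) ≡ true
        ok′ x ne with A x
        ... | true = ok M x ne
        ... | false = ok L x ne

      swapped-in : ∀ x → A x ≡ true → ν x ≡ μ M x
      swapped-in x e rewrite e = refl

      swapped-out : ∀ x → A x ≡ false → ν x ≡ μ L x
      swapped-out x e rewrite e = refl

    -- At every vertex one exchanged matching acts as `L` and the other as `M`.
    swap-deficiency : ∀ L M A A-L A-M → deficiency (Swap.swapped L M A A-L A-M) + deficiency (Swap.swapped M L A A-M A-L) ≡ deficiency L + deficiency M
    swap-deficiency L M A A-L A-M = ≡-sym (sum-+ (λ x → ⟦ free K x ⟧ * 1) (λ x → ⟦ free K′ x ⟧ * 1)) ⨾ sum-cong eq ⨾ sum-+ (λ x → ⟦ free L x ⟧ * 1) (λ x → ⟦ free M x ⟧ * 1)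
      where
      K = Swap.swapped L M A A-L A-M
      K′ = Swap.swapped M L A A-M A-L
      eq : ∀ x → ⟦ free K x ⟧ * 1 + ⟦ free K′ x ⟧ * 1 ≡ ⟦ free L x ⟧ * 1 + ⟦ free M x ⟧ * 1
      eq x with A x
      ... | true = +-comm (⟦ free M x ⟧ * 1) (⟦ free L x ⟧ * 1)
      ... | false = refl

    module Component {L M : Matching S} (Lmin : Minimum L) (Mmin : Minimum M) (t : Fin N) (t-free : μ M t ≡ t)
                     (A : Mask N) (inside : ∀ z → A z ≡ true → Orbit.P L M t t-free z) (outside : ∀ z → A z ≡ false → ¬ Orbit.P L M t t-free z) where
      open Orbit L M t t-free

      closed : ∀ (g : Fin N → Fin N) → (∀ z → g (g z) ≡ z) → (∀ {z} → P z → P (g z)) → ∀ z → A (g z) ≡ A z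
      closed g gg P-g z with A z in e | A (g z) in e′
      ... | true | true = refl
      ... | false | false = refl
      ... | true | false = ⊥-elim (outside (g z) e′ (P-g (inside z e)))
      ... | false | true = ⊥-elim (outside z e (subst P (gg z) (P-g (inside (g z) e′))))

      A-L : ∀ z → A (μ L z) ≡ A z
      A-L = closed (μ L) (inv L) P-L

      A-M : ∀ z → A (μ M z) ≡ A z
      A-M = closed (μ M) (inv M) P-M

      K : Matching S
      K = Swap.swapped L M A A-L A-M

      -- The two exchanged matchings have total deficiency 2f and at least f each.
      K-minimum : Minimum K
      K-minimum = ≤-antisym (+-cancelʳ-≤ f _ _ (≤-trans (+-monoʳ-≤ (deficiency K) (min (Swap.swapped M L A A-M A-L)))
          (≤-reflexive (swap-deficiency L M A A-L A-M ⨾ cong₂ _+_ Lmin Mmin)))) (min K)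

      t-in : A t ≡ true
      t-in with A t in e
      ... | true = refl
      ... | false = ⊥-elim (outside t e (0 , inj₁ refl))

      K-t : μ K t ≡ t
      K-t = Swap.swapped-in L M A A-L A-M t t-in ⨾ t-free

      K-outside : ∀ {z} → A z ≡ false → μ L z ≡ z → μ K z ≡ z
      K-outside {z} e Lz = Swap.swapped-out L M A A-L A-M z e ⨾ Lz

    -- Suppose `L` leaves `x` and `y` free; take a minimum `M` leaving `t` free and the component of
    -- `t` in `L` and `M`. It contains at most one vertex free in `L`, so it omits `x` or `y`.
    -- Following `M` on it and `L` elsewhere gives a minimum matching that leaves both `t` and the
    -- omitted vertex free.
    ≈-trans : (∀ t → S t ≡ true → (∀ M → Minimum M → μ M t ≢ t) → ⊥) → ∀ {x t y} → S t ≡ true → x ≢ y → x ≈ t → t ≈ y → x ≈ y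
    ≈-trans missed {x} {t} {y} St x≢y x≈t t≈y L Lmin Lx Ly = missed t St λ M Mmin Mt → mask-of (Orbit.P L M t Mt) (finish {M} Mmin Mt)
      where
      finish : ∀ {M} (Mmin : Minimum M) (Mt : μ M t ≡ t) (A : Mask N) → (∀ z → A z ≡ true → Orbit.P L M t Mt z) → (∀ z → A z ≡ false → ¬ Orbit.P L M t Mt z) → ⊥
      finish {M} Mmin Mt A inside outside with A x in Ax | A y in Ay
      ... | true | true = x≢y (Orbit.one-free L M t Mt (x≈t L Lmin Lx) (inside x Ax) (inside y Ay) Lx Ly)
      ... | false | _ = x≈t K K-minimum (K-outside Ax Lx) K-t
        where open Component {L} {M} Lmin Mmin t Mt A inside outside
      ... | true | false = t≈y K K-minimum K-t (K-outside Ay Ly)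
        where open Component {L} {M} Lmin Mmin t Mt A inside outside

-- The induction on the number of vertices

true≢false : true ≢ false
true≢false ()

-- For gap f the theorem asserts |V| ≥ χ + excess f.
excess : ℕ → ℕ
excess 7 = 13
excess 8 = 15
excess 9 = 16
excess 10 = 17
excess f = if f <ᵇ 7 then 2 * f else 19

excess-large : ∀ f → 11 ≤ f → excess f ≡ 19
excess-large f h with m≤n⇒∃[o]m+o≡n h
... | o , refl = refl

excess-≤19 : ∀ f → excess f ≤ 19
excess-≤19 f with f ≤? 11
... | yes p = ≤ᵇ-true (allUpTo-sound 11 (λ f → excess f ≤ᵇ 19) refl p)
... | no np = ≤-reflexive (excess-large f (<⇒≤ (≰⇒> np)))

-- From 11 on the function is constant with its maximal value 19, so only finitely many pairs remain
-- to be evaluated.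
excess-subadditive : ∀ x y → excess (x + y) ≤ excess x + excess y
excess-subadditive x y with x ≤? 11 | y ≤? 11
... | no np | _ = ≤-trans (excess-≤19 (x + y)) (≤-trans (≤-reflexive (≡-sym (excess-large x (<⇒≤ (≰⇒> np))))) (m≤m+n _ _))
... | yes _ | no np = ≤-trans (excess-≤19 (x + y)) (≤-trans (≤-reflexive (≡-sym (excess-large y (<⇒≤ (≰⇒> np))))) (m≤n+m _ _))
... | yes p | yes q = ≤ᵇ-true (allUpTo-sound 11 (λ y → excess (x + y) ≤ᵇ excess x + excess y)
      (allUpTo-sound 11 (λ x → allUpTo 11 (λ y → excess (x + y) ≤ᵇ excess x + excess y)) refl p) q)

excess-suc : ∀ f → excess f ≤ excess (suc f)
excess-suc f with f ≤? 11
... | yes p = ≤ᵇ-true (allUpTo-sound 11 (λ f → excess f ≤ᵇ excess (suc f)) refl p)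
... | no np = ≤-reflexive (excess-large f (<⇒≤ (≰⇒> np)) ⨾ ≡-sym (excess-large (suc f) (m≤n⇒m≤1+n (<⇒≤ (≰⇒> np)))))

excess-mono : ∀ {x y} → x ≤ y → excess x ≤ excess y
excess-mono {x} {y} h with m≤n⇒∃[o]m+o≡n h
... | o , refl = go o
  where
  go : ∀ o → excess x ≤ excess (x + o)
  go zero = ≤-reflexive (cong excess (≡-sym (+-identityʳ x)))
  go (suc o) = ≤-trans (go o) (≤-trans (excess-suc (x + o)) (≤-reflexive (cong excess (≡-sym (+-suc x o)))))

module Main {N : ℕ} (H : Graph N) where
  open Matchings H
  open Matching

  -- `W` is a clique of the complement. Neither `c` nor `W` has to be optimal, which lets witnesses
  -- for parts of `S` be put together.
  record Good (S : Mask N) : Set where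
    constructor good
    field
      {c}   : ℕ
      cover : Cover S c
      W     : Mask N
      W⊆S   : ∀ x → W x ≡ true → S x ≡ true
      ind   : Independent H W
      few   : c + excess (c ∸ # W) ≤ # S

  -- A triangle costs one colour and three vertices, while the excess grows by at most 2.
  good-triangle : ∀ {S} u v w → S u ≡ true → (S ∖ u) v ≡ true → ((S ∖ u) ∖ v) w ≡ true →
    adj H u v ≡ true → adj H v w ≡ true → adj H u w ≡ true → Good (((S ∖ u) ∖ v) ∖ w) → Good S
  good-triangle {S} u v w Su Sv Sw uv vw uw (good {c} C W W⊆S ind few) =
    good (triple u v w Su Sv Sw uv vw uw C) W (λ x h → ∖-⊆ S x (∖-⊆ (S ∖ u) x (∖-⊆ ((S ∖ u) ∖ v) x (W⊆S x h)))) ind (begin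
      suc c + excess (suc c ∸ # W) ≤⟨ +-monoʳ-≤ (suc c) (≤-trans (excess-mono (∸-suc c (# W))) (excess-subadditive 1 (c ∸ # W))) ⟩
      suc c + (2 + excess (c ∸ # W)) ≡⟨ solve 2 (λ c e → (con 1 :+ c) :+ (con 2 :+ e) := con 3 :+ (c :+ e)) refl c (excess (c ∸ # W)) ⟩
      3 + (c + excess (c ∸ # W)) ≤⟨ +-monoʳ-≤ 3 few ⟩
      3 + # (((S ∖ u) ∖ v) ∖ w) ≡⟨ cong (2 +_) (≡-sym (#-remove ((S ∖ u) ∖ v) Sw)) ⟩
      2 + # ((S ∖ u) ∖ v) ≡⟨ cong suc (≡-sym (#-remove (S ∖ u) Sv)) ⟩
      1 + # (S ∖ u) ≡⟨ ≡-sym (#-remove S Su) ⟩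
      # S ∎)
    where
    open ≤-Reasoning
    ∸-suc : ∀ c w → suc c ∸ w ≤ suc (c ∸ w)
    ∸-suc c zero = ≤-refl
    ∸-suc zero (suc w) = ≤-trans (≤-reflexive (0∸n≡0 w)) z≤n
    ∸-suc (suc c) (suc w) = ∸-suc c w

  Disjoint : Mask N → Mask N → Mask N → Set
  Disjoint S P Q = ∀ x → ⟦ S x ⟧ ≡ ⟦ P x ⟧ + ⟦ Q x ⟧

  disjoint-member : ∀ {S P Q u} → Disjoint S P Q → P u ≡ true → S u ≡ true
  disjoint-member {S} {u = u} h Pu with S u | h u
  ... | true | _ = refl
  ... | false | e rewrite Pu with () ← e

  disjoint-remove : ∀ {S P Q} u → Disjoint S P Q → P u ≡ true → Disjoint (S ∖ u) (P ∖ u) Q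
  disjoint-remove {S} {P} {Q} u h Pu x with x Fin.≟ u
  ... | no _ = h x
  ... | yes refl with Q u | S u | h u
  ...   | false | _ | _ = refl
  ...   | true | true | e rewrite Pu with () ← e
  ...   | true | false | e rewrite Pu with () ← e

  cover-union : ∀ {S P Q c c′} → Disjoint S P Q → Cover P c → Cover Q c′ → Cover S (c + c′)
  cover-union {S} {P} {Q} h (empty e) D = Cover-resp (λ x → ⟦⟧-injective _ _ (≡-sym (h x ⨾ cong (λ b → ⟦ b ⟧ + ⟦ Q x ⟧) (e x)))) D
  cover-union {S} {P} {Q} h (single u Pu C) D = single u (disjoint-member {S} {P} {Q} h Pu) (cover-union (disjoint-remove {S} {P} {Q} u h Pu) C D)
  cover-union {S} {P} {Q} h (pair u v Pu Pv uv C) D = pair u v (disjoint-member {S} {P} {Q} h Pu) (disjoint-member {S ∖ u} {P ∖ u} {Q} h′ Pv) uv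
      (cover-union (disjoint-remove {S ∖ u} {P ∖ u} {Q} v h′ Pv) C D)
    where h′ = disjoint-remove {S} {P} {Q} u h Pu
  cover-union {S} {P} {Q} h (triple u v w Pu Pv Pw uv vw uw C) D =
      triple u v w (disjoint-member {S} {P} {Q} h Pu) (disjoint-member {S ∖ u} {P ∖ u} {Q} h′ Pv) (disjoint-member {(S ∖ u) ∖ v} {(P ∖ u) ∖ v} {Q} {w} h″ Pw) uv vw uw
      (cover-union (disjoint-remove {(S ∖ u) ∖ v} {(P ∖ u) ∖ v} {Q} w h″ Pw) C D)
    where
    h′ = disjoint-remove {S} {P} {Q} u h Pu
    h″ = disjoint-remove {S ∖ u} {P ∖ u} {Q} v h′ Pv

  ∸-+-≤ : ∀ c c′ w w′ → (c + c′) ∸ (w + w′) ≤ (c ∸ w) + (c′ ∸ w′)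
  ∸-+-≤ c c′ w w′ = m≤n+o⇒m∸n≤o (c + c′) (w + w′) (≤-trans (+-mono-≤ (m≤n+m∸n c w) (m≤n+m∸n c′ w′))
    (≤-reflexive (solve 4 (λ w x w′ x′ → (w :+ x) :+ (w′ :+ x′) := (w :+ w′) :+ (x :+ x′)) refl w (c ∸ w) w′ (c′ ∸ w′))))

  -- With no edges between the parts, the independent sets add up as the covers do, and the gaps are
  -- handled by subadditivity.
  good-union : ∀ {S A B} → Disjoint S A B → (∀ x y → A x ≡ true → B y ≡ true → adj H x y ≡ false) → Good A → Good B → Good S
  good-union {S} {A} {B} h apart (good {c} C W W⊆A ind few) (good {c′} C′ W′ W′⊆B ind′ few′) =
    good (cover-union h C C′) V V⊆S indV (begin
      c + c′ + excess (c + c′ ∸ # V) ≡⟨ cong (λ w → c + c′ + excess (c + c′ ∸ w)) #V ⟩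
      c + c′ + excess (c + c′ ∸ (# W + # W′)) ≤⟨ +-monoʳ-≤ (c + c′) (≤-trans (excess-mono (∸-+-≤ c c′ (# W) (# W′))) (excess-subadditive (c ∸ # W) (c′ ∸ # W′))) ⟩
      c + c′ + (excess (c ∸ # W) + excess (c′ ∸ # W′))
        ≡⟨ solve 4 (λ a b x y → (a :+ b) :+ (x :+ y) := (a :+ x) :+ (b :+ y)) refl c c′ (excess (c ∸ # W)) (excess (c′ ∸ # W′)) ⟩
      (c + excess (c ∸ # W)) + (c′ + excess (c′ ∸ # W′)) ≤⟨ +-mono-≤ few few′ ⟩
      # A + # B ≡⟨ ≡-sym (∑-disjoint S A B (λ _ → 1) h) ⟩
      # S ∎)
    where
    open ≤-Reasoning
    V : Mask N
    V x = W x ∨ W′ x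
    A∩B : ∀ x → A x ≡ true → B x ≡ true → ⊥
    A∩B x p q with S x | h x
    ... | true | e rewrite p | q with () ← e
    A∩B x p q | false | e rewrite p with () ← e
    V-elim : ∀ x → V x ≡ true → W x ≡ true ⊎ W′ x ≡ true
    V-elim x p with W x
    ... | true = inj₁ refl
    ... | false = inj₂ p
    V⊆S : ∀ x → V x ≡ true → S x ≡ true
    V⊆S x p with V-elim x p
    ... | inj₁ q = disjoint-member {S} {A} {B} h (W⊆A x q)
    ... | inj₂ q = disjoint-member {S} {B} {A} (λ y → h y ⨾ +-comm ⟦ A y ⟧ ⟦ B y ⟧) (W′⊆B x q)
    indV : Independent H V
    indV x y p q with V-elim x p | V-elim y q
    ... | inj₁ r | inj₁ s = ind x y r s
    ... | inj₁ r | inj₂ s = apart x y (W⊆A x r) (W′⊆B y s)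
    ... | inj₂ r | inj₁ s = sym H x y ⨾ apart y x (W⊆A y s) (W′⊆B x r)
    ... | inj₂ r | inj₂ s = ind′ x y r s
    split : Disjoint V W W′
    split x with W x in e | W′ x in e′
    ... | true | true = ⊥-elim (A∩B x (W⊆A x e) (W′⊆B x e′))
    ... | true | false = refl
    ... | false | true = refl
    ... | false | false = refl
    #V : # V ≡ # W + # W′
    #V = ∑-disjoint V W W′ (λ _ → 1) split

  -- The tables speak of graphs that are triangle-free everywhere, while `H` is so only on `S`; all
  -- edges not inside `S` are deleted.
  restricted : Mask N → Graph N
  restricted S = record
    { adj = λ x y → S x ∧ (S y ∧ adj H x y)
    ; sym = λ x y → swap (S x) (S y) (sym H x y)
    ; irrefl = λ x → cong (λ b → S x ∧ (S x ∧ b)) (irrefl H x) ⨾ cong (S x ∧_) (∧-zeroʳ (S x)) ⨾ ∧-zeroʳ (S x) }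
    where
    swap : ∀ p q {r s} → r ≡ s → p ∧ (q ∧ r) ≡ q ∧ (p ∧ s)
    swap true true e = e
    swap true false _ = refl
    swap false true _ = refl
    swap false false _ = refl

  restricted-adj : ∀ S {x y} → S x ≡ true → S y ≡ true → adj (restricted S) x y ≡ adj H x y
  restricted-adj S Sx Sy rewrite Sx | Sy = refl

  restricted-elim : ∀ S {x y} → adj (restricted S) x y ≡ true → S x ≡ true × S y ≡ true × adj H x y ≡ true
  restricted-elim S {x} {y} h with S x | S y
  ... | true | true = refl , refl , h

  restricted-triangleFree : ∀ S → TriangleFreeOn S → TriangleFree (restricted S)
  restricted-triangleFree S tf x y z xy yz with adj (restricted S) x z in e
  ... | false = refl
  ... | true with restricted-elim S {x} {y} xy | restricted-elim S {y} {z} yz | restricted-elim S {x} {z} e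
  ... | Sx , Sy , p | _ , Sz , q | _ , _ , r = ⊥-elim (tf x y z Sx Sy Sz p q r)

  module _ {S : Mask N} (tf : TriangleFreeOn S) (¬good : ¬ Good S) {c : ℕ} (C : Cover S c) (c+c : c + c ≡ # S + 1) where

    -- As `# S` is 2c - 1, the inequality of `Good` amounts to `excess (c ∸ # W)` being at most c -
    -- 1.
    enough : ∀ W → (∀ x → W x ≡ true → S x ≡ true) → Independent H W → excess (c ∸ # W) < c → ⊥
    enough W W⊆S ind h = ¬good (good C W W⊆S ind (≤-pred (≤-trans (≤-reflexive (≡-sym (+-suc c _))) (≤-trans (+-monoʳ-≤ c h) (≤-reflexive (c+c ⨾ +-comm (# S) 1))))))

    by-ramsey : ∀ {k ws} → Table k ws → excess (c ∸ suc k) < c → length ws < c + c → ⊥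
    by-ramsey {k} {ws} table h large = <⇒≱ (ramsey table (restricted S) (restricted-triangleFree S tf) S α)
        (≤-pred (≤-trans large (≤-reflexive (c+c ⨾ +-comm (# S) 1))))
      where
      α : α≤ (restricted S) k S
      α I I⊆S ind = ≮⇒≥ λ k< → enough I I⊆S (λ x y p q → ≡-sym (restricted-adj S (I⊆S x p) (I⊆S y q)) ⨾ ind x y p q)
        (≤-<-trans (excess-mono (∸-monoʳ-≤ c k<)) h)

  factor-critical : ∀ {S} → TriangleFreeOn S → ¬ Good S → ∀ c → Cover S c → c + c ≡ # S + 1 → ⊥
  factor-critical {S} tf ng 0 C e with () ← e ⨾ +-comm (# S) 1
  factor-critical tf ng 1 C e = by-ramsey tf ng C e table₀ (≤ᵇ⇒≤ _ _ tt) (≤ᵇ⇒≤ _ _ tt)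
  factor-critical tf ng 2 C e = by-ramsey tf ng C e table₁ (≤ᵇ⇒≤ _ _ tt) (≤ᵇ⇒≤ _ _ tt)
  factor-critical tf ng 3 C e = by-ramsey tf ng C e table₁ (≤ᵇ⇒≤ _ _ tt) (≤ᵇ⇒≤ _ _ tt)
  factor-critical tf ng 4 C e = by-ramsey tf ng C e table₂ (≤ᵇ⇒≤ _ _ tt) (≤ᵇ⇒≤ _ _ tt)
  factor-critical tf ng 5 C e = by-ramsey tf ng C e table₂ (≤ᵇ⇒≤ _ _ tt) (≤ᵇ⇒≤ _ _ tt)
  factor-critical tf ng 6 C e = by-ramsey tf ng C e table₃ (≤ᵇ⇒≤ _ _ tt) (≤ᵇ⇒≤ _ _ tt)
  factor-critical tf ng 7 C e = by-ramsey tf ng C e table₃ (≤ᵇ⇒≤ _ _ tt) (≤ᵇ⇒≤ _ _ tt)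
  factor-critical tf ng 8 C e = by-ramsey tf ng C e table₄ (≤ᵇ⇒≤ _ _ tt) (≤ᵇ⇒≤ _ _ tt)
  factor-critical tf ng 9 C e = by-ramsey tf ng C e table₄ (≤ᵇ⇒≤ _ _ tt) (≤ᵇ⇒≤ _ _ tt)
  factor-critical tf ng 10 C e = by-ramsey tf ng C e table₅ (≤ᵇ⇒≤ _ _ tt) (≤ᵇ⇒≤ _ _ tt)
  factor-critical tf ng 11 C e = by-ramsey tf ng C e table₅ (≤ᵇ⇒≤ _ _ tt) (≤ᵇ⇒≤ _ _ tt)
  factor-critical tf ng 12 C e = by-ramsey tf ng C e table₆ (≤ᵇ⇒≤ _ _ tt) (≤ᵇ⇒≤ _ _ tt)
  factor-critical tf ng 13 C e = by-ramsey tf ng C e table₆ (≤ᵇ⇒≤ _ _ tt) (≤ᵇ⇒≤ _ _ tt)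
  factor-critical tf ng 14 C e = by-ramsey tf ng C e table₆ (≤ᵇ⇒≤ _ _ tt) (≤ᵇ⇒≤ _ _ tt)
  factor-critical tf ng 15 C e = by-ramsey tf ng C e table₇ (≤ᵇ⇒≤ _ _ tt) (≤ᵇ⇒≤ _ _ tt)
  factor-critical tf ng 16 C e = by-ramsey tf ng C e table₇ (≤ᵇ⇒≤ _ _ tt) (≤ᵇ⇒≤ _ _ tt)
  factor-critical tf ng 17 C e = by-ramsey tf ng C e table₇ (≤ᵇ⇒≤ _ _ tt) (≤ᵇ⇒≤ _ _ tt)
  factor-critical tf ng 18 C e = by-ramsey tf ng C e table₇ (≤ᵇ⇒≤ _ _ tt) (≤ᵇ⇒≤ _ _ tt)
  factor-critical tf ng 19 C e = by-ramsey tf ng C e table₈ (≤ᵇ⇒≤ _ _ tt) (≤ᵇ⇒≤ _ _ tt)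
  -- Here `c` is at least 20, above every value of `excess`, so the empty set serves as `W`.
  factor-critical tf ng c@(suc (suc (suc (suc (suc (suc (suc (suc (suc (suc (suc (suc (suc (suc (suc (suc (suc (suc (suc (suc k)))))))))))))))))))) C e =
    enough tf ng C e (λ _ → false) (λ _ ()) (λ _ _ ()) (≤-trans (s≤s (excess-≤19 (c ∸ # (λ (_ : Fin N) → false)))) (m≤m+n 20 k))

  edge-≢ : ∀ {x y} → adj H x y ≡ true → y ≢ x
  edge-≢ {x} xy refl with () ← ≡-sym xy ⨾ irrefl H x

  <-remove : ∀ {S : Mask N} {n} x → S x ≡ true → # S ≤ suc n → # (S ∖ x) ≤ n
  <-remove {S} x Sx h = ≤-pred (≤-trans (≤-reflexive (≡-sym (#-remove S Sx))) h)

  halve-≤ : ∀ c c′ → c + c ≤ suc (c′ + c′) → c ≤ c′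
  halve-≤ c c′ h = ≮⇒≥ λ lt → <⇒≱ (≤-trans (s≤s (≤-reflexive (≡-sym (+-suc c′ c′)))) (+-mono-≤ lt lt)) h

  module _ {n : ℕ} (smaller : ∀ S → # S ≤ n → ¬ Good S → ⊥) {S : Mask N} (#S≤ : # S ≤ suc n) (¬good : ¬ Good S) (tf : TriangleFreeOn S)
           {s : Fin N} (Ss : S s ≡ true) {f : ℕ} (M : Matching S) (Mf : deficiency M ≡ f) (min : ∀ (M : Matching S) → f ≤ deficiency M) where
    open Gallai {S} {f} min

    cover : ∃ λ c → Cover S c × c + c ≡ # S + f
    cover = proj₁ (cover-of M) , proj₁ (proj₂ (cover-of M)) , (proj₂ (proj₂ (cover-of M)) ⨾ cong (# S +_) Mf)

    -- If every minimum matching covers `t`, then deleting `t` does not lower the deficiency, so a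
    -- cover of the rest has at least as many classes as the minimum cover of `S`. A witness for the
    -- rest, with its cover replaced by this one, then serves for `S`.
    missed : ∀ t → S t ≡ true → (∀ M → Minimum M → μ M t ≢ t) → ⊥
    missed t St covered = smaller (S ∖ t) (<-remove {S} t St #S≤) λ { (good {c′} C′ W W⊆S ind few) → conclude C′ W W⊆S ind few
        (cover-matching (λ x y z p q r → tf x y z (∖-⊆ S x p) (∖-⊆ S y q) (∖-⊆ S z r)) C′) }
      where
      c = proj₁ cover
      conclude : ∀ {c′} → Cover (S ∖ t) c′ → ∀ W → (∀ x → W x ≡ true → (S ∖ t) x ≡ true) → Independent H W → c′ + excess (c′ ∸ # W) ≤ # (S ∖ t) →
        (∃ λ (M : Matching (S ∖ t)) → c′ + c′ ≡ # (S ∖ t) + deficiency M) → ⊥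
      conclude {c′} C′ W W⊆S ind few (M′ , e′) = ¬good (good (proj₁ (proj₂ cover)) W (λ x h → ∖-⊆ S x (W⊆S x h)) ind
          (≤-trans (+-mono-≤ c≤ (excess-mono (∸-monoˡ-≤ (# W) c≤))) (≤-trans few (≤-trans (n≤1+n _) (≤-reflexive (≡-sym (#-remove S St)))))))
        where
        f≤ : f ≤ deficiency M′
        f≤ = ≤-pred (≤∧≢⇒< (≤-trans (min (widen {S} {t} M′)) (≤-reflexive (widen-deficiency St M′)))
               (λ e → covered (widen {S} {t} M′) (widen-deficiency St M′ ⨾ ≡-sym e) (widen-fixes {S} {t} M′)))
        c≤ : c ≤ c′
        c≤ = halve-≤ c c′ (≤-trans (≤-reflexive (proj₂ (proj₂ cover) ⨾ cong (_+ f) (#-remove S St)))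
               (s≤s (≤-trans (+-monoʳ-≤ (# (S ∖ t)) f≤) (≤-reflexive (≡-sym e′)))))

    -- By adjacency and transitivity no edge leaves the class of `u`, and `v` lies outside it
    -- because `M` leaves both free. The class and its complement are therefore smaller sets to
    -- which the induction applies; connectedness never has to be defined.
    separated : ∀ u v → S u ≡ true → S v ≡ true → v ≢ u → μ M u ≡ u → μ M v ≡ v → ⊥
    separated u v Su Sv v≢u Mu Mv = mask-of (λ x → S x ≡ true × (x ≡ u ⊎ x ≈ u)) λ A inside outside → parts A inside outside
      where
      parts : ∀ (A : Mask N) → (∀ x → A x ≡ true → S x ≡ true × (x ≡ u ⊎ x ≈ u)) → (∀ x → A x ≡ false → ¬ (S x ≡ true × (x ≡ u ⊎ x ≈ u))) → ⊥
      parts A inside outside = smaller A (below A v v∉A Sv (λ x h → proj₁ (inside x h))) λ gA →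
          smaller B (below B u u∉B Su B⊆S) λ gB → ¬good (good-union split apart gA gB)
        where
        B : Mask N
        B x = S x ∧ not (A x)
        B-elim : ∀ x → B x ≡ true → S x ≡ true × A x ≡ false
        B-elim x h with S x | A x
        ... | true | false = refl , refl
        B⊆S : ∀ x → B x ≡ true → S x ≡ true
        B⊆S x h = proj₁ (B-elim x h)
        v∉A : A v ≡ false
        v∉A with A v in e
        ... | false = refl
        ... | true with inside v e
        ... | _ , inj₁ eq = ⊥-elim (v≢u eq)
        ... | _ , inj₂ v≈u = ⊥-elim (v≈u M Mf Mv Mu)
        u∉B : B u ≡ false
        u∉B with B u in e
        ... | false = refl
        ... | true = ⊥-elim (outside u (proj₂ (B-elim u e)) (Su , inj₁ refl))
        below : ∀ T x → T x ≡ false → S x ≡ true → (∀ y → T y ≡ true → S y ≡ true) → # T ≤ n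
        below T x Tx Sx T⊆S = ≤-trans (sum-mono le) (<-remove {S} x Sx #S≤)
          where
          le : ∀ y → ⟦ T y ⟧ * 1 ≤ ⟦ (S ∖ x) y ⟧ * 1
          le y with T y in e
          ... | false = z≤n
          ... | true = ≤-reflexive (cong (λ b → ⟦ b ⟧ * 1) (≡-sym (∖-intro S {x} y (T⊆S y e) (λ { refl → true≢false (≡-sym e ⨾ Tx) }))))
        split : Disjoint S A B
        split x with A x in e
        ... | false with S x
        ...   | true = refl
        ...   | false = refl
        split x | true rewrite proj₁ (inside x e) = refl
        apart : ∀ x y → A x ≡ true → B y ≡ true → adj H x y ≡ false
        apart x y Ax By with adj H x y in xy
        ... | false = refl
        ... | true = ⊥-elim (outside y (proj₂ (B-elim y By)) (Sy , related (proj₂ (inside x Ax))))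
          where
          Sy = B⊆S y By
          Sx = proj₁ (inside x Ax)
          y≈x : y ≈ x
          y≈x = adjacent-≈ Sy Sx (sym H y x ⨾ xy)
          related : x ≡ u ⊎ x ≈ u → y ≡ u ⊎ y ≈ u
          related (inj₁ refl) = inj₂ y≈x
          related (inj₂ x≈u) with y Fin.≟ u
          ... | yes e = inj₁ e
          ... | no ne = inj₂ (≈-trans missed Sx ne y≈x x≈u)

    -- With f = 0 every minimum matching covers `s`, against `missed`; f = 1 gives 2c = `# S` + 1;
    -- with f ≥ 2 two free vertices separate `S`.
    triangle-free-step : ⊥
    triangle-free-step with f Data.Nat.≟ 0 | f Data.Nat.≟ 1
    ... | yes refl | _ = missed s Ss λ M₀ m₀ e → true≢false (≡-sym (free-intro M₀ s Ss e) ⨾ #-zero (free M₀) m₀ s)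
    ... | no _ | yes refl = factor-critical tf ¬good (proj₁ cover) (proj₁ (proj₂ cover)) (proj₂ (proj₂ cover))
    ... | no f≢0 | no f≢1 = two (nonempty (free M) (≤-trans (n≢0⇒n>0 f≢0) (≤-reflexive (≡-sym Mf))))
      where
      two : (∃ λ u → free M u ≡ true) → ⊥
      two (u , fu) = second (nonempty (free M ∖ u) (≤-pred (≤-trans (≤∧≢⇒< (n≢0⇒n>0 f≢0) (λ e → f≢1 (≡-sym e)))
                       (≤-reflexive (≡-sym Mf ⨾ #-remove (free M) fu)))))
        where
        second : (∃ λ v → (free M ∖ u) v ≡ true) → ⊥
        second (v , fv) = separated u v (free-S M u fu) (free-S M v fv′) (∖-≢ (free M) v fv) (free-μ M u fu) (free-μ M v fv′)
          where fv′ = ∖-⊆ (free M) v fv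

  ¬¬good : ∀ n S → # S ≤ n → ¬ Good S → ⊥
  ¬¬good n S #S≤ ng with find S
  ... | inj₂ e = ng (good (empty e) (λ _ → false) (λ _ ()) (λ _ _ ()) (≤-trans (≤-reflexive (cong excess (0∸n≡0 (# (λ (_ : Fin N) → false))))) z≤n))
  ¬¬good zero S #S≤ ng | inj₁ (s , Ss) with () ← ≤-trans (≤-reflexive (≡-sym (#-remove S Ss))) #S≤
  ¬¬good (suc n) S #S≤ ng | inj₁ (s , Ss) = em {∃ λ u → ∃ λ v → ∃ λ w → S u ≡ true × S v ≡ true × S w ≡ true × adj H u v ≡ true × adj H v w ≡ true × adj H u w ≡ true} λ
    { (inj₁ (u , v , w , Su , Sv , Sw , uv , vw , uw)) →
        let Sv′ = ∖-intro S v Sv (edge-≢ uv)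
            Sw′ = ∖-intro (S ∖ u) w (∖-intro S w Sw (edge-≢ uw)) (edge-≢ vw)
        in ¬¬good n (((S ∖ u) ∖ v) ∖ w) (≤-trans (n≤1+n _) (≤-trans (≤-reflexive (≡-sym (#-remove ((S ∖ u) ∖ v) Sw′)))
             (≤-trans (n≤1+n _) (≤-trans (≤-reflexive (≡-sym (#-remove (S ∖ u) Sv′))) (<-remove {S} u Su #S≤)))))
             (λ g → ng (good-triangle u v w Su Sv′ Sw′ uv vw uw g))
    ; (inj₂ no-triangle) → least (λ f → ∃ λ (M : Matching S) → deficiency M ≡ f) (deficiency (trivial-matching S)) (trivial-matching S , refl)
        λ { f (M , Mf) min → triangle-free-step (¬¬good n) #S≤ ng
              (λ x y z Sx Sy Sz xy yz xz → no-triangle (x , y , z , Sx , Sy , Sz , xy , yz , xz)) Ss M Mf (λ M′ → min _ (M′ , refl)) } }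

open Main

-- Colourings and cliques from the complement

insert-inverse : ∀ {k N} (W : Mask N) → # W ≡ k → ∃ λ (h : Fin k → Fin N) → (∀ i → W (h i) ≡ true) × (∀ i j → h i ≡ h j → i ≡ j)
insert-inverse {zero} W e = (λ ()) , (λ ()) , λ ()
insert-inverse {suc k} {N} W e with nonempty W (≤-trans (s≤s z≤n) (≤-reflexive (≡-sym e)))
... | x , Wx with insert-inverse {k} (W ∖ x) (suc-injective (≡-sym (#-remove W Wx) ⨾ e))
... | h , inW , inj = h′ , inW′ , inj′
  where
  h′ : Fin (suc k) → Fin N
  h′ zero = x
  h′ (suc i) = h i
  inW′ : ∀ i → W (h′ i) ≡ true
  inW′ zero = Wx
  inW′ (suc i) = ∖-⊆ W (h i) (inW i)
  inj′ : ∀ i j → h′ i ≡ h′ j → i ≡ j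
  inj′ zero zero _ = refl
  inj′ zero (suc j) e = ⊥-elim (∖-≢ W (h j) (inW j) (≡-sym e))
  inj′ (suc i) zero e = ⊥-elim (∖-≢ W (h i) (inW i) e)
  inj′ (suc i) (suc j) e = cong suc (inj i j e)

complement : ∀ {N} → Graph N → Graph N
complement G = record
  { adj = λ x y → not (x == y) ∧ not (adj G x y)
  ; sym = λ x y → cong₂ (λ b c → not b ∧ not c) (==-sym x y) (sym G x y)
  ; irrefl = λ x → cong (λ b → not b ∧ not (adj G x x)) (==-refl x) }
  where
  ==-sym : ∀ {N} (x y : Fin N) → (x == y) ≡ (y == x)
  ==-sym x y with x Fin.≟ y
  ... | yes refl = ≡-sym (==-refl x)
  ... | no ne = ≡-sym (≢⇒== (λ e → ne (≡-sym e)))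

module _ {N : ℕ} (H : Graph N) where
  open Matchings H

  record ProperOn (S : Mask N) (c : ℕ) : Set where
    field
      colour : Fin N → ℕ
      bounded : ∀ x → S x ≡ true → colour x < c
      proper : ∀ x y → S x ≡ true → S y ≡ true → x ≢ y → colour x ≡ colour y → adj H x y ≡ true

  add-class : ∀ {S R c} → (∀ x y → S x ≡ true → S y ≡ true → R x ≡ false → R y ≡ false → x ≢ y → adj H x y ≡ true) → ProperOn R c → ProperOn S (suc c)
  add-class {S} {R} {c} clique ρ = record { colour = colour′ ; bounded = bounded′ ; proper = proper′ }
    where
    open ProperOn ρ
    colour′ : Fin N → ℕ
    colour′ x = if R x then suc (colour x) else 0
    bounded′ : ∀ x → S x ≡ true → colour′ x < suc c
    bounded′ x _ with R x in e
    ... | true = s≤s (bounded x e)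
    ... | false = s≤s z≤n
    proper′ : ∀ x y → S x ≡ true → S y ≡ true → x ≢ y → colour′ x ≡ colour′ y → adj H x y ≡ true
    proper′ x y Sx Sy ne e with R x in Rx | R y in Ry
    ... | true | true = proper x y Rx Ry ne (suc-injective e)
    ... | false | false = clique x y Sx Sy Rx Ry ne

  removed : ∀ {S : Mask N} {u x} → S x ≡ true → (S ∖ u) x ≡ false → x ≡ u
  removed {S} {u} {x} Sx e with x Fin.≟ u
  ... | yes p = p
  ... | no _ = ⊥-elim (true≢false (≡-sym Sx ⨾ e))

  split-removed : ∀ (S : Mask N) u x → (S ∖ u) x ≡ true ⊎ (S ∖ u) x ≡ false
  split-removed S u x with (S ∖ u) x
  ... | true = inj₁ refl
  ... | false = inj₂ refl

  cover-colouring : ∀ {S c} → Cover S c → ProperOn S c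
  cover-colouring (empty e) = record { colour = λ _ → 0 ; bounded = λ x Sx → ⊥-elim (true≢false (≡-sym Sx ⨾ e x))
    ; proper = λ x _ Sx → ⊥-elim (true≢false (≡-sym Sx ⨾ e x)) }
  cover-colouring {S} (single u Su C) = add-class (λ x y Sx Sy Rx Ry ne → ⊥-elim (ne (removed {S} Sx Rx ⨾ ≡-sym (removed {S} Sy Ry)))) (cover-colouring C)
  cover-colouring {S} (pair u v Su Sv uv C) = add-class (λ x y Sx Sy Rx Ry → linked x y (which x Sx Rx) (which y Sy Ry)) (cover-colouring C)
    where
    which : ∀ x → S x ≡ true → ((S ∖ u) ∖ v) x ≡ false → x ≡ u ⊎ x ≡ v
    which x Sx Rx with split-removed S u x
    ... | inj₂ e = inj₁ (removed {S} Sx e)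
    ... | inj₁ e = inj₂ (removed {S ∖ u} e Rx)
    linked : ∀ x y → x ≡ u ⊎ x ≡ v → y ≡ u ⊎ y ≡ v → x ≢ y → adj H x y ≡ true
    linked x y (inj₁ refl) (inj₁ refl) ne = ⊥-elim (ne refl)
    linked x y (inj₁ refl) (inj₂ refl) ne = uv
    linked x y (inj₂ refl) (inj₁ refl) ne = sym H v u ⨾ uv
    linked x y (inj₂ refl) (inj₂ refl) ne = ⊥-elim (ne refl)
  cover-colouring {S} (triple u v w Su Sv Sw uv vw uw C) = add-class (λ x y Sx Sy Rx Ry → linked x y (which x Sx Rx) (which y Sy Ry)) (cover-colouring C)
    where
    which : ∀ x → S x ≡ true → (((S ∖ u) ∖ v) ∖ w) x ≡ false → x ≡ u ⊎ x ≡ v ⊎ x ≡ w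
    which x Sx Rx with split-removed S u x
    ... | inj₂ e = inj₁ (removed {S} Sx e)
    ... | inj₁ e with split-removed (S ∖ u) v x
    ... | inj₂ e′ = inj₂ (inj₁ (removed {S ∖ u} e e′))
    ... | inj₁ e′ = inj₂ (inj₂ (removed {(S ∖ u) ∖ v} e′ Rx))
    linked : ∀ x y → x ≡ u ⊎ x ≡ v ⊎ x ≡ w → y ≡ u ⊎ y ≡ v ⊎ y ≡ w → x ≢ y → adj H x y ≡ true
    linked x y (inj₁ refl) (inj₁ refl) ne = ⊥-elim (ne refl)
    linked x y (inj₁ refl) (inj₂ (inj₁ refl)) ne = uv
    linked x y (inj₁ refl) (inj₂ (inj₂ refl)) ne = uw
    linked x y (inj₂ (inj₁ refl)) (inj₁ refl) ne = sym H v u ⨾ uv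
    linked x y (inj₂ (inj₁ refl)) (inj₂ (inj₁ refl)) ne = ⊥-elim (ne refl)
    linked x y (inj₂ (inj₁ refl)) (inj₂ (inj₂ refl)) ne = vw
    linked x y (inj₂ (inj₂ refl)) (inj₁ refl) ne = sym H w u ⨾ uw
    linked x y (inj₂ (inj₂ refl)) (inj₂ (inj₁ refl)) ne = sym H w v ⨾ vw
    linked x y (inj₂ (inj₂ refl)) (inj₂ (inj₂ refl)) ne = ⊥-elim (ne refl)

module _ {n : ℕ} (G : Graph n) where

  full : Mask n
  full _ = true

  #-full : # full ≡ n
  #-full = go n
    where
    opaque
      unfolding sum
      go : ∀ n → # (λ (_ : Fin n) → true) ≡ n
      go zero = refl
      go (suc n) = cong suc (go n)

  non-edge : ∀ x y → adj (complement G) x y ≡ true → adj G x y ≡ false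
  non-edge x y h with x == y | adj G x y
  ... | false | false = refl

  complement-edge : ∀ x y → x ≢ y → adj (complement G) x y ≡ false → adj G x y ≡ true
  complement-edge x y ne h rewrite ≢⇒== ne with adj G x y
  ... | true = refl

  cover-colourable : ∀ {c} → Matchings.Cover (complement G) full c → Colourable G c
  cover-colourable C = (λ x → fromℕ< (bounded x refl)) , λ u v uv e →
    true≢false (≡-sym uv ⨾ non-edge u v (proper u v refl refl (λ { refl → true≢false (≡-sym uv ⨾ irrefl G u) })
      (≡-sym (Fin.toℕ-fromℕ< (bounded u refl)) ⨾ cong toℕ e ⨾ Fin.toℕ-fromℕ< (bounded v refl))))
    where open ProperOn (cover-colouring (complement G) C)

  independent-clique : ∀ W → Independent (complement G) W → HasClique G (# W)
  independent-clique W ind with insert-inverse {# W} W refl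
  ... | h , inW , inj = h , (λ {i} {j} → inj i j) , λ i j i≢j → complement-edge (h i) (h j) (λ e → i≢j (inj i j e)) (ind (h i) (h j) (inW i) (inW j))

  -- A cover colours `G` and an independent set of the complement is a clique, so χ ≤ c and `# W` ≤
  -- ω; monotonicity of `excess` does the rest.
  order-bound : ∀ χ ω → IsChromaticNumber G χ → IsCliqueNumber G ω → χ + excess (χ ∸ ω) ≤ n
  order-bound χ ω (_ , χ-min) (_ , ω-max) = decidable-stable (χ + excess (χ ∸ ω) ≤? n) λ too-few →
    ¬¬good (complement G) n full (≤-reflexive #-full) λ { (good {c} C W _ ind few) → too-few (begin
      χ + excess (χ ∸ ω) ≤⟨ +-mono-≤ (χ≤ C) (excess-mono (∸-mono (χ≤ C) (≤ω W ind))) ⟩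
      c + excess (c ∸ # W) ≤⟨ few ⟩
      # full ≡⟨ #-full ⟩
      n ∎) }
    where
    open ≤-Reasoning
    χ≤ : ∀ {c} → Matchings.Cover (complement G) full c → χ ≤ c
    χ≤ {c} C = ≮⇒≥ λ c<χ → χ-min c c<χ (cover-colourable C)
    ≤ω : ∀ W → Independent (complement G) W → # W ≤ ω
    ≤ω W ind = ≮⇒≥ λ ω<w → ω-max (# W) ω<w (independent-clique W ind)

theorem4p1 : ∀ (n : ℕ) (G : Graph n) (χ ω : ℕ)
    → IsChromaticNumber G χ → IsCliqueNumber G ω
    → χ ∸ ω ≤ 11
    → (χ ∸ ω ≤ 6 → χ + 2 * (χ ∸ ω) ≤ n)
    × (χ ∸ ω ≡ 7 → χ + 2 * (χ ∸ ω) ∸ 1 ≤ n)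
    × (χ ∸ ω ≡ 8 → χ + 2 * (χ ∸ ω) ∸ 1 ≤ n)
    × (χ ∸ ω ≡ 9 → χ + 16 ≤ n)
    × (χ ∸ ω ≡ 10 → χ + 2 * (χ ∸ ω) ∸ 3 ≤ n)
    × (χ ∸ ω ≡ 11 → χ + 2 * (χ ∸ ω) ∸ 3 ≤ n)
theorem4p1 n G χ ω isχ isω _ =
    (λ h → ≤-trans (+-monoʳ-≤ χ (≤ᵇ-true (allUpTo-sound 6 (λ f → 2 * f ≤ᵇ excess f) refl h))) with-excess)
  , at-offset 7 1 (≤ᵇ⇒≤ _ _ tt) refl , at-offset 8 1 (≤ᵇ⇒≤ _ _ tt) refl , at-gap 9
  , at-offset 10 3 (≤ᵇ⇒≤ _ _ tt) refl , at-offset 11 3 (≤ᵇ⇒≤ _ _ tt) refl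
  where
  with-excess : χ + excess (χ ∸ ω) ≤ n
  with-excess = order-bound G χ ω isχ isω
  at-gap : ∀ f → χ ∸ ω ≡ f → χ + excess f ≤ n
  at-gap f h = subst (λ f → χ + excess f ≤ n) h with-excess
  -- The bound `e ≤ 2 * f` permits moving the truncated subtraction inside the sum.
  at-offset : ∀ f e → e ≤ 2 * f → 2 * f ∸ e ≡ excess f → χ ∸ ω ≡ f → χ + 2 * (χ ∸ ω) ∸ e ≤ n
  at-offset f e e≤ eq h = subst (λ g → χ + 2 * g ∸ e ≤ n) (≡-sym h)
    (≤-trans (≤-reflexive (+-∸-assoc χ e≤ ⨾ cong (χ +_) eq)) (at-gap f h))
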